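{- For every integer $n\ge 3$, the Hermitian polar space $\mathsf{H}(2n-1,4)$ has no ovoid.
   Context: $\mathsf{H}(2n-1,4)$ denotes the finite classical polar space of totally isotropic subspaces of a non-degenerate Hermitian form on $V(2n,4)$ (with respect to the involution $x\mapsto x^2$ of $\mathrm{GF}(4)$), viewed in $\mathrm{PG}(2n-1,4)$; it has rank $n$, and its generators are the totally isotropic subspaces of projective dimension $n-1$. An ovoid of a finite polar space is a set $\mathcal{O}$ of points of the polar space such that every generator meets $\mathcal{O}$ in exactly one point. -}

module Defs where

open import Data.Nat using (ℕ; suc; _*_)
open import Data.Fin using (Fin)
open import Data.Vec using (Vec; []; _∷_; zipWith; map; replicate; foldr; lookup)
open import Data.Product using (Σ; _×_; _,_; ∃)
open import Relation.Binary.PropositionalEquality using (_≡_)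
open import Relation.Nullary using (¬_)
open import Relation.Unary using (Pred)
open import Level using (0ℓ)

data F4 : Set where
  𝟎 𝟏 ω ω² : F4

infixl 6 _⊕_
infixl 7 _⊗_

_⊕_ : F4 → F4 → F4
𝟎  ⊕ y  = y
x  ⊕ 𝟎  = x
𝟏  ⊕ 𝟏  = 𝟎
𝟏  ⊕ ω  = ω²
𝟏  ⊕ ω² = ω
ω  ⊕ 𝟏  = ω²
ω  ⊕ ω  = 𝟎
ω  ⊕ ω² = 𝟏
ω² ⊕ 𝟏  = ω
ω² ⊕ ω  = 𝟏
ω² ⊕ ω² = 𝟎

_⊗_ : F4 → F4 → F4
𝟎  ⊗ y  = 𝟎
x  ⊗ 𝟎  = 𝟎
𝟏  ⊗ y  = y
x  ⊗ 𝟏  = x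
ω  ⊗ ω  = ω²
ω  ⊗ ω² = 𝟏
ω² ⊗ ω  = 𝟏
ω² ⊗ ω² = ω

conj : F4 → F4
conj x = x ⊗ x

Vect : ℕ → Set
Vect m = Vec F4 m

zeroV : ∀ {m} → Vect m
zeroV = replicate _ 𝟎

_+V_ : ∀ {m} → Vect m → Vect m → Vect m
_+V_ = zipWith _⊕_

_·V_ : ∀ {m} → F4 → Vect m → Vect m
c ·V v = map (c ⊗_) v

NonZero : ∀ {m} → Vect m → Set
NonZero v = ¬ (v ≡ zeroV)

herm : ∀ {m} → Vect m → Vect m → F4
herm x y = foldr _ _⊕_ 𝟎 (zipWith (λ a b → a ⊗ conj b) x y)

-- A point of the polar space H(m-1,4): nonzero isotropic vector
-- (projective points are nonzero vectors up to nonzero scalars).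
IsIsotropicPoint : ∀ {m} → Vect m → Set
IsIsotropicPoint v = NonZero v × herm v v ≡ 𝟎

SamePoint : ∀ {m} → Vect m → Vect m → Set
SamePoint u v = Σ F4 λ c → ¬ (c ≡ 𝟎) × u ≡ c ·V v

lincomb : ∀ {k m} → Vec F4 k → Vec (Vect m) k → Vect m
lincomb []       []       = zeroV
lincomb (c ∷ cs) (b ∷ bs) = (c ·V b) +V lincomb cs bs

LinIndep : ∀ {k m} → Vec (Vect m) k → Set
LinIndep {k} bs = (c : Vec F4 k) → lincomb c bs ≡ zeroV → c ≡ replicate k 𝟎

TotallyIsotropic : ∀ {k m} → Vec (Vect m) k → Set
TotallyIsotropic {k} bs = (i j : Fin k) → herm (lookup bs i) (lookup bs j) ≡ 𝟎

-- A basis (b₁,…,bₙ) of a generator of H(2n-1,4): a totally isotropic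
-- subspace of vector dimension n (projective dimension n-1).
IsGeneratorBasis : (n : ℕ) → Vec (Vect (2 * n)) n → Set
IsGeneratorBasis n bs = LinIndep bs × TotallyIsotropic bs

-- An ovoid of H(2n-1,4), given as a set O of vectors whose projective
-- image is the set of points of the ovoid: every element of O is a point
-- of the polar space, and every generator ⟨bs⟩ meets O in exactly one
-- projective point.
IsOvoid : (n : ℕ) → Pred (Vect (2 * n)) 0ℓ → Set
IsOvoid n O =
  ((v : Vect (2 * n)) → O v → IsIsotropicPoint v) ×
  ((bs : Vec (Vect (2 * n)) n) → IsGeneratorBasis n bs →
     (Σ (Vec F4 n) λ c → O (lincomb c bs)) ×
     ((c c′ : Vec F4 n) → O (lincomb c bs) → O (lincomb c′ bs) →
        SamePoint (lincomb c bs) (lincomb c′ bs)))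

{-# OPTIONS --safe #-}
-- Identify an isotropic point ⟨w⟩ of PG(5,4) with ww*, a vector of the 𝔽₂-space
-- of Hermitian matrices over 𝔽₄; then ⟪ uu*, vv* ⟫ is 0 or 1 according as u ⊥ v or
-- not, and e₂ is a quadratic form polarising to ⟪_,_⟫ on matrices of trace 0. An
-- ovoid of H(5,4) has 33 points, 9 of them in w^⊥ for every other point w. By these
-- counts the defect D(w) = ww* + Σ vv*, summed over the ovoid points v ∈ w^⊥, is
-- orthogonal to all vv*, has e₂ = 0, and satisfies D(w) w = 0 and
-- w* D(p) w = p* D(w) p. The matrices vv* span too large a space for their
-- orthogonal complement to contain, modulo the identity, more than a plane. Hence
-- D(p) vanishes on the points collinear with p (otherwise the defects of the points
-- of a line would span too large a space), and if w* D(p) w ≠ 0, then all of w^⊥ is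
-- in the radical of D(w), which forces D(w) to vanish at p as it does on the ovoid:
-- a contradiction. But such a pair p, w exists, since the defects of nine points,
-- three on each of three mutually orthogonal hyperbolic lines, sum to 1 + Σ vv* (now
-- over the whole ovoid), at which e₂ is 1.
-- Larger n reduce to n = 3 by passing to w^⊥/w for a point w off the ovoid.
module Submission where

open import Defs
open import Data.Bool using (Bool; true; false; _∧_; _xor_; not; if_then_else_)
import Data.Bool.Properties as Bool
open import Data.Bool.Solver using (module xor-∧-Solver)
open import Data.Empty using (⊥; ⊥-elim)
open import Data.Fin using (Fin; zero; suc)
open import Data.List as List using (List; []; _∷_; length; cartesianProductWith)
open import Data.List.Membership.Propositional using (_∈_; find; lose)
open import Data.List.Membership.Propositional.Properties using (∈-cartesianProductWith⁺)
open import Data.List.Relation.Unary.All as LAll using ([]; _∷_)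
open import Data.List.Relation.Unary.All.Properties using (¬Any⇒All¬)
open import Data.List.Relation.Unary.AllPairs as LPairs using ([]; _∷_)
open import Data.List.Relation.Unary.Any using (here; there; any?)
open import Data.Nat using (ℕ; zero; suc; _+_; _*_; _≤_; z≤n; s≤s)
open import Data.Nat.Properties using (+-suc; +-identityʳ; +-cancelʳ-≡; *-distribˡ-+; suc-injective) renaming (_≟_ to _≟ℕ_)
open import Data.Nat.Solver using (module +-*-Solver)
open import Data.Product using (Σ; ∃; ∃₂; _×_; _,_; proj₁; proj₂)
open import Data.Sum using (_⊎_; inj₁; inj₂; [_,_]′)
open import Data.Unit using (⊤; tt)
open import Data.Vec using (Vec; []; _∷_; map; _++_; replicate; zipWith; lookup; head; tail)
open import Data.Vec.Properties using (∷-injectiveˡ; ∷-injectiveʳ; lookup-map; ≡-dec)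
open import Data.Vec.Relation.Unary.All using (All; []; _∷_)
open import Data.Vec.Relation.Unary.All.Properties using (lookup⁺; lookup⁻)
open import Data.Vec.Relation.Unary.AllPairs using (AllPairs; []; _∷_)
open import Function using (_∘_)
open import Level using (0ℓ)
open import Relation.Binary.PropositionalEquality
open import Relation.Nullary using (¬_; Dec; yes; no)
open import Relation.Nullary.Decidable using (from-yes; decidable-stable; map′; ¬?; _→-dec_; _×-dec_)
open import Relation.Unary using (Pred)
open xor-∧-Solver using (solve; con; _:+_; _:*_; _:=_)
open ≡-Reasoning

-- The Hermitian matrices of order 6 have dimension 36 over 𝔽₂, those of trace 0 dimension 35, and
-- on the latter ⟪_,_⟫ is alternating with radical spanned by the identity, whose trace is 6 = 0.
-- For ovoid points the Gram matrix of the vv* is J - I. At size 33 it is singular, so one point is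
-- dropped; the other 32 span a nondegenerate space, and what is orthogonal to them in the
-- 34-dimensional quotient by the identity is a plane. The defect D(w) is ww* corrected by ovoid
-- matrices so as to land in this complement, where it represents evaluation at w: ⟪X, D(w)⟫ = w*Xw,
-- whence the symmetry in w and p. The plane determines a defect only modulo the identity, but
-- adding the identity to a matrix of trace 0 changes e₂, since e₂(1) = 15 = 1; so e₂ = 0 fixes the
-- defect itself. A logical obstacle is that an ovoid is an arbitrary predicate, without decidable
-- membership. Since the goal is a negation, the list of its points is obtained under a double
-- negation, and all counting is done on that list.

module ℕ-Solver = +-*-Solver

private variable
  k m n : ℕ
  Elt : Set

-- The field 𝔽₄ and the Hermitian form

infix 4 _≟_
_≟_ : (x y : F4) → Dec (x ≡ y)
𝟎 ≟ 𝟎 = yes refl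
𝟎 ≟ 𝟏 = no λ ()
𝟎 ≟ ω = no λ ()
𝟎 ≟ ω² = no λ ()
𝟏 ≟ 𝟎 = no λ ()
𝟏 ≟ 𝟏 = yes refl
𝟏 ≟ ω = no λ ()
𝟏 ≟ ω² = no λ ()
ω ≟ 𝟎 = no λ ()
ω ≟ 𝟏 = no λ ()
ω ≟ ω = yes refl
ω ≟ ω² = no λ ()
ω² ≟ 𝟎 = no λ ()
ω² ≟ 𝟏 = no λ ()
ω² ≟ ω = no λ ()
ω² ≟ ω² = yes refl

∀F? : {P : F4 → Set} → (∀ x → Dec (P x)) → Dec (∀ x → P x)
∀F? P? = map′
  (λ { (a , b , c , d) 𝟎 → a ; (a , b , c , d) 𝟏 → b ; (a , b , c , d) ω → c ; (a , b , c , d) ω² → d })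
  (λ f → f 𝟎 , f 𝟏 , f ω , f ω²)
  (P? 𝟎 ×-dec P? 𝟏 ×-dec P? ω ×-dec P? ω²)

∃F? : {P : F4 → Set} → (∀ x → Dec (P x)) → Dec (∃ P)
∃F? P? with ∀F? (λ x → ¬? (P? x))
... | yes none = no λ { (x , p) → none x p }
... | no some with P? 𝟎 | P? 𝟏 | P? ω | P? ω²
... | yes p | _ | _ | _ = yes (𝟎 , p)
... | no _ | yes p | _ | _ = yes (𝟏 , p)
... | no _ | no _ | yes p | _ = yes (ω , p)
... | no _ | no _ | no _ | yes p = yes (ω² , p)
... | no a | no b | no c | no d = ⊥-elim (some λ { 𝟎 → a ; 𝟏 → b ; ω → c ; ω² → d })

⊕-assoc : ∀ x y z → (x ⊕ y) ⊕ z ≡ x ⊕ (y ⊕ z)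
⊕-assoc = from-yes (∀F? λ x → ∀F? λ y → ∀F? λ z → (x ⊕ y) ⊕ z ≟ x ⊕ (y ⊕ z))

⊕-comm : ∀ x y → x ⊕ y ≡ y ⊕ x
⊕-comm = from-yes (∀F? λ x → ∀F? λ y → x ⊕ y ≟ y ⊕ x)

⊕-identityʳ : ∀ x → x ⊕ 𝟎 ≡ x
⊕-identityʳ = from-yes (∀F? λ x → x ⊕ 𝟎 ≟ x)

⊕-self : ∀ x → x ⊕ x ≡ 𝟎
⊕-self = from-yes (∀F? λ x → x ⊕ x ≟ 𝟎)

⊕-≡𝟎 : ∀ x y → x ⊕ y ≡ 𝟎 → x ≡ y
⊕-≡𝟎 = from-yes (∀F? λ x → ∀F? λ y → (x ⊕ y ≟ 𝟎) →-dec (x ≟ y))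

⊕-interchange : ∀ a b c d → (a ⊕ b) ⊕ (c ⊕ d) ≡ (a ⊕ c) ⊕ (b ⊕ d)
⊕-interchange = from-yes (∀F? λ a → ∀F? λ b → ∀F? λ c → ∀F? λ d →
  (a ⊕ b) ⊕ (c ⊕ d) ≟ (a ⊕ c) ⊕ (b ⊕ d))

⊗-assoc : ∀ x y z → (x ⊗ y) ⊗ z ≡ x ⊗ (y ⊗ z)
⊗-assoc = from-yes (∀F? λ x → ∀F? λ y → ∀F? λ z → (x ⊗ y) ⊗ z ≟ x ⊗ (y ⊗ z))

⊗-zeroʳ : ∀ x → x ⊗ 𝟎 ≡ 𝟎
⊗-zeroʳ = from-yes (∀F? λ x → x ⊗ 𝟎 ≟ 𝟎)

⊗-identityˡ : ∀ x → 𝟏 ⊗ x ≡ x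
⊗-identityˡ = from-yes (∀F? λ x → 𝟏 ⊗ x ≟ x)

⊗-identityʳ : ∀ x → x ⊗ 𝟏 ≡ x
⊗-identityʳ = from-yes (∀F? λ x → x ⊗ 𝟏 ≟ x)

⊗-distribˡ-⊕ : ∀ x y z → x ⊗ (y ⊕ z) ≡ x ⊗ y ⊕ x ⊗ z
⊗-distribˡ-⊕ = from-yes (∀F? λ x → ∀F? λ y → ∀F? λ z → x ⊗ (y ⊕ z) ≟ x ⊗ y ⊕ x ⊗ z)

⊗-distribʳ-⊕ : ∀ z x y → (x ⊕ y) ⊗ z ≡ x ⊗ z ⊕ y ⊗ z
⊗-distribʳ-⊕ = from-yes (∀F? λ z → ∀F? λ x → ∀F? λ y → (x ⊕ y) ⊗ z ≟ x ⊗ z ⊕ y ⊗ z)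

⊗-≢𝟎 : ∀ x y → ¬ x ≡ 𝟎 → ¬ y ≡ 𝟎 → ¬ x ⊗ y ≡ 𝟎
⊗-≢𝟎 = from-yes (∀F? λ x → ∀F? λ y → ¬? (x ≟ 𝟎) →-dec ¬? (y ≟ 𝟎) →-dec ¬? (x ⊗ y ≟ 𝟎))

-- In 𝔽₄ the inverse of a nonzero element is its conjugate.
conj-inverse : ∀ c → ¬ c ≡ 𝟎 → conj c ⊗ c ≡ 𝟏
conj-inverse = from-yes (∀F? λ c → ¬? (c ≟ 𝟎) →-dec (conj c ⊗ c ≟ 𝟏))

conj-⊕ : ∀ x y → conj (x ⊕ y) ≡ conj x ⊕ conj y
conj-⊕ = from-yes (∀F? λ x → ∀F? λ y → conj (x ⊕ y) ≟ conj x ⊕ conj y)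

conj-⊗-conj : ∀ x y → conj (x ⊗ conj y) ≡ y ⊗ conj x
conj-⊗-conj = from-yes (∀F? λ x → ∀F? λ y → conj (x ⊗ conj y) ≟ y ⊗ conj x)

conj-≡𝟎 : ∀ x → conj x ≡ 𝟎 → x ≡ 𝟎
conj-≡𝟎 = from-yes (∀F? λ x → (conj x ≟ 𝟎) →-dec (x ≟ 𝟎))

-- `nrm` and `trc` are the norm x ⊗ conj x and the trace x ⊕ conj x from 𝔽₄ to 𝔽₂, read as bits. The
-- norm is at the same time the test for being nonzero.
nrm : F4 → Bool
nrm 𝟎 = false
nrm _ = true

trc : F4 → Bool
trc 𝟎  = false
trc 𝟏  = false
trc ω  = true
trc ω² = true

trc-⊕ : ∀ x y → trc (x ⊕ y) ≡ trc x xor trc y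
trc-⊕ = from-yes (∀F? λ x → ∀F? λ y → trc (x ⊕ y) Bool.≟ trc x xor trc y)

trc-conj : ∀ x → trc (conj x) ≡ trc x
trc-conj = from-yes (∀F? λ x → trc (conj x) Bool.≟ trc x)

nrm-conj : ∀ x → nrm (conj x) ≡ nrm x
nrm-conj = from-yes (∀F? λ x → nrm (conj x) Bool.≟ nrm x)

nrm-⊗ : ∀ x y → nrm (x ⊗ y) ≡ nrm x ∧ nrm y
nrm-⊗ = from-yes (∀F? λ x → ∀F? λ y → nrm (x ⊗ y) Bool.≟ nrm x ∧ nrm y)

nrm-⊕ : ∀ x y → nrm (x ⊕ y) ≡ (nrm x xor trc (x ⊗ conj y)) xor nrm y
nrm-⊕ = from-yes (∀F? λ x → ∀F? λ y → nrm (x ⊕ y) Bool.≟ (nrm x xor trc (x ⊗ conj y)) xor nrm y)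

≢𝟎⇒nrm : ∀ x → ¬ x ≡ 𝟎 → nrm x ≡ true
≢𝟎⇒nrm 𝟎 x≢𝟎 = ⊥-elim (x≢𝟎 refl)
≢𝟎⇒nrm 𝟏 _ = refl
≢𝟎⇒nrm ω _ = refl
≢𝟎⇒nrm ω² _ = refl

+V-assoc : (x y z : Vect m) → (x +V y) +V z ≡ x +V (y +V z)
+V-assoc [] [] [] = refl
+V-assoc (a ∷ x) (b ∷ y) (c ∷ z) = cong₂ _∷_ (⊕-assoc a b c) (+V-assoc x y z)

+V-comm : (x y : Vect m) → x +V y ≡ y +V x
+V-comm [] [] = refl
+V-comm (a ∷ x) (b ∷ y) = cong₂ _∷_ (⊕-comm a b) (+V-comm x y)

+V-identityˡ : (x : Vect m) → zeroV +V x ≡ x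
+V-identityˡ [] = refl
+V-identityˡ (a ∷ x) = cong (a ∷_) (+V-identityˡ x)

+V-identityʳ : (x : Vect m) → x +V zeroV ≡ x
+V-identityʳ x = trans (+V-comm x zeroV) (+V-identityˡ x)

+V-self : (x : Vect m) → x +V x ≡ zeroV
+V-self [] = refl
+V-self (a ∷ x) = cong₂ _∷_ (⊕-self a) (+V-self x)

+V-cancel : (x y : Vect m) → x +V (x +V y) ≡ y
+V-cancel x y = trans (sym (+V-assoc x x y)) (trans (cong (_+V y) (+V-self x)) (+V-identityˡ y))

·V-⊗ : (c d : F4) (x : Vect m) → c ·V (d ·V x) ≡ (c ⊗ d) ·V x
·V-⊗ c d [] = refl
·V-⊗ c d (a ∷ x) = cong₂ _∷_ (sym (⊗-assoc c d a)) (·V-⊗ c d x)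

·V-identity : (x : Vect m) → 𝟏 ·V x ≡ x
·V-identity [] = refl
·V-identity (a ∷ x) = cong₂ _∷_ (⊗-identityˡ a) (·V-identity x)

·V-zeroˡ : (x : Vect m) → 𝟎 ·V x ≡ zeroV
·V-zeroˡ [] = refl
·V-zeroˡ (a ∷ x) = cong (𝟎 ∷_) (·V-zeroˡ x)

·V-zeroʳ : ∀ c → c ·V zeroV {m} ≡ zeroV
·V-zeroʳ {zero} c = refl
·V-zeroʳ {suc m} c = cong₂ _∷_ (⊗-zeroʳ c) (·V-zeroʳ c)

·V-distribˡ : (c : F4) (x y : Vect m) → c ·V (x +V y) ≡ (c ·V x) +V (c ·V y)
·V-distribˡ c [] [] = refl
·V-distribˡ c (a ∷ x) (b ∷ y) = cong₂ _∷_ (⊗-distribˡ-⊕ c a b) (·V-distribˡ c x y)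

·V-distribʳ : (c d : F4) (x : Vect m) → (c ⊕ d) ·V x ≡ (c ·V x) +V (d ·V x)
·V-distribʳ c d [] = refl
·V-distribʳ c d (a ∷ x) = cong₂ _∷_ (⊗-distribʳ-⊕ a c d) (·V-distribʳ c d x)

herm-+ˡ : (x y z : Vect m) → herm (x +V y) z ≡ herm x z ⊕ herm y z
herm-+ˡ [] [] [] = refl
herm-+ˡ (a ∷ x) (b ∷ y) (c ∷ z) = begin
  (a ⊕ b) ⊗ conj c ⊕ herm (x +V y) z
    ≡⟨ cong₂ _⊕_ (⊗-distribʳ-⊕ (conj c) a b) (herm-+ˡ x y z) ⟩
  (a ⊗ conj c ⊕ b ⊗ conj c) ⊕ (herm x z ⊕ herm y z)
    ≡⟨ ⊕-interchange (a ⊗ conj c) (b ⊗ conj c) (herm x z) (herm y z) ⟩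
  (a ⊗ conj c ⊕ herm x z) ⊕ (b ⊗ conj c ⊕ herm y z) ∎

herm-·ˡ : (c : F4) (x y : Vect m) → herm (c ·V x) y ≡ c ⊗ herm x y
herm-·ˡ c [] [] = sym (⊗-zeroʳ c)
herm-·ˡ c (a ∷ x) (b ∷ y) = begin
  (c ⊗ a) ⊗ conj b ⊕ herm (c ·V x) y  ≡⟨ cong₂ _⊕_ (⊗-assoc c a (conj b)) (herm-·ˡ c x y) ⟩
  c ⊗ (a ⊗ conj b) ⊕ c ⊗ herm x y     ≡⟨ ⊗-distribˡ-⊕ c (a ⊗ conj b) (herm x y) ⟨
  c ⊗ (a ⊗ conj b ⊕ herm x y)         ∎

herm-conj : (x y : Vect m) → herm y x ≡ conj (herm x y)
herm-conj [] [] = refl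
herm-conj (a ∷ x) (b ∷ y) = begin
  b ⊗ conj a ⊕ herm y x                ≡⟨ cong₂ _⊕_ (sym (conj-⊗-conj a b)) (herm-conj x y) ⟩
  conj (a ⊗ conj b) ⊕ conj (herm x y)  ≡⟨ conj-⊕ (a ⊗ conj b) (herm x y) ⟨
  conj (a ⊗ conj b ⊕ herm x y)         ∎

herm-+ʳ : (x y z : Vect m) → herm x (y +V z) ≡ herm x y ⊕ herm x z
herm-+ʳ x y z = begin
  herm x (y +V z)                  ≡⟨ herm-conj (y +V z) x ⟩
  conj (herm (y +V z) x)           ≡⟨ cong conj (herm-+ˡ y z x) ⟩
  conj (herm y x ⊕ herm z x)       ≡⟨ conj-⊕ (herm y x) (herm z x) ⟩
  conj (herm y x) ⊕ conj (herm z x) ≡⟨ cong₂ _⊕_ (herm-conj y x) (herm-conj z x) ⟨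
  herm x y ⊕ herm x z              ∎

herm-·ʳ : (c : F4) (x y : Vect m) → herm x (c ·V y) ≡ conj c ⊗ herm x y
herm-·ʳ c x y = begin
  herm x (c ·V y)           ≡⟨ herm-conj (c ·V y) x ⟩
  conj (herm (c ·V y) x)    ≡⟨ cong conj (herm-·ˡ c y x) ⟩
  conj (c ⊗ herm y x)       ≡⟨ from-yes (∀F? λ a → ∀F? λ b → conj (a ⊗ b) ≟ conj a ⊗ conj b) c (herm y x) ⟩
  conj c ⊗ conj (herm y x)  ≡⟨ cong (conj c ⊗_) (herm-conj y x) ⟨
  conj c ⊗ herm x y         ∎

herm-zeroˡ : (x : Vect m) → herm zeroV x ≡ 𝟎
herm-zeroˡ [] = refl
herm-zeroˡ (a ∷ x) = herm-zeroˡ x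

herm-zeroʳ : (x : Vect m) → herm x zeroV ≡ 𝟎
herm-zeroʳ x = trans (herm-conj zeroV x) (cong conj (herm-zeroˡ x))

⊥-sym : (x y : Vect m) → herm x y ≡ 𝟎 → herm y x ≡ 𝟎
⊥-sym x y x⊥y = trans (herm-conj x y) (cong conj x⊥y)

⊥-+ʳ : (v x y : Vect m) → herm v x ≡ 𝟎 → herm v y ≡ 𝟎 → herm v (x +V y) ≡ 𝟎
⊥-+ʳ v x y v⊥x v⊥y = trans (herm-+ʳ v x y) (cong₂ _⊕_ v⊥x v⊥y)

⊥-·ʳ : (c : F4) (v x : Vect m) → herm v x ≡ 𝟎 → herm v (c ·V x) ≡ 𝟎
⊥-·ʳ c v x v⊥x = trans (herm-·ʳ c v x) (trans (cong (conj c ⊗_) v⊥x) (⊗-zeroʳ (conj c)))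

isotropic-+ : (x y : Vect m) → herm x x ≡ 𝟎 → herm y y ≡ 𝟎 → herm x y ≡ 𝟎 → herm (x +V y) (x +V y) ≡ 𝟎
isotropic-+ x y xx yy xy = trans (herm-+ˡ x y (x +V y))
  (cong₂ _⊕_ (⊥-+ʳ x x y xx xy) (⊥-+ʳ y x y (⊥-sym x y xy) yy))

isotropic-· : (c : F4) (x : Vect m) → herm x x ≡ 𝟎 → herm (c ·V x) (c ·V x) ≡ 𝟎
isotropic-· c x xx = ⊥-·ʳ c (c ·V x) x
  (trans (herm-·ˡ c x x) (trans (cong (c ⊗_) xx) (⊗-zeroʳ c)))

-- Hermitian matrices

-- (d , r , X) is the Hermitian matrix with corner d, first column r below the
-- corner, and remaining block X.
HM : ℕ → Set
HM zero    = ⊤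
HM (suc m) = Bool × Vect m × HM m

infixl 6 _+H_
_+H_ : HM m → HM m → HM m
_+H_ {zero}  _ _ = tt
_+H_ {suc m} (d , r , X) (d′ , r′ , X′) = d xor d′ , r +V r′ , X +H X′

0H : HM m
0H {zero}  = tt
0H {suc m} = false , zeroV , 0H

scalar : Bool → HM m
scalar {zero}  a = tt
scalar {suc m} a = a , zeroV , scalar a

outer : Vect m → HM m
outer []      = tt
outer (a ∷ u) = nrm a , conj a ·V u , outer u

trace : HM m → Bool
trace {zero}  _ = false
trace {suc m} (d , r , X) = d xor trace X

-- The trace of the matrix product: an off-diagonal entry and its conjugate together contribute a
-- field trace.
⟪_,_⟫ : HM m → HM m → Bool
⟪_,_⟫ {zero}  _ _ = false
⟪_,_⟫ {suc m} (d , r , X) (d′ , r′ , X′) = ((d ∧ d′) xor trc (herm r r′)) xor ⟪ X , X′ ⟫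

-- The second elementary symmetric function of the eigenvalues.
e₂ : HM m → Bool
e₂ {zero}  _ = false
e₂ {suc m} (d , r , X) = ((d ∧ trace X) xor trace (outer r)) xor e₂ X

+H-comm : (X Y : HM m) → X +H Y ≡ Y +H X
+H-comm {zero} _ _ = refl
+H-comm {suc m} (d , r , X) (e , s , Y) =
  cong₂ _,_ (Bool.xor-comm d e) (cong₂ _,_ (+V-comm r s) (+H-comm X Y))

+H-assoc : (X Y Z : HM m) → (X +H Y) +H Z ≡ X +H (Y +H Z)
+H-assoc {zero} _ _ _ = refl
+H-assoc {suc m} (d , r , X) (e , s , Y) (f , t , Z) =
  cong₂ _,_ (Bool.xor-assoc d e f) (cong₂ _,_ (+V-assoc r s t) (+H-assoc X Y Z))

+H-identityˡ : (X : HM m) → 0H +H X ≡ X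
+H-identityˡ {zero} _ = refl
+H-identityˡ {suc m} (d , r , X) = cong₂ _,_ refl (cong₂ _,_ (+V-identityˡ r) (+H-identityˡ X))

+H-identityʳ : (X : HM m) → X +H 0H ≡ X
+H-identityʳ X = trans (+H-comm X 0H) (+H-identityˡ X)

+H-self : (X : HM m) → X +H X ≡ 0H
+H-self {zero} _ = refl
+H-self {suc m} (d , r , X) = cong₂ _,_ (Bool.xor-same d) (cong₂ _,_ (+V-self r) (+H-self X))

+H-interchange : (W X Y Z : HM m) → (W +H X) +H (Y +H Z) ≡ (W +H Y) +H (X +H Z)
+H-interchange W X Y Z = begin
  (W +H X) +H (Y +H Z)  ≡⟨ +H-assoc W X (Y +H Z) ⟩
  W +H (X +H (Y +H Z))  ≡⟨ cong (W +H_) (+H-assoc X Y Z) ⟨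
  W +H ((X +H Y) +H Z)  ≡⟨ cong (λ A → W +H (A +H Z)) (+H-comm X Y) ⟩
  W +H ((Y +H X) +H Z)  ≡⟨ cong (W +H_) (+H-assoc Y X Z) ⟩
  W +H (Y +H (X +H Z))  ≡⟨ +H-assoc W Y (X +H Z) ⟨
  (W +H Y) +H (X +H Z)  ∎

trace-+ : (X Y : HM m) → trace (X +H Y) ≡ trace X xor trace Y
trace-+ {zero} _ _ = refl
trace-+ {suc m} (d , r , X) (e , s , Y) = trans (cong ((d xor e) xor_) (trace-+ X Y))
  (solve 4 (λ d e x y → (d :+ e) :+ (x :+ y) := (d :+ x) :+ (e :+ y)) refl d e (trace X) (trace Y))

trace-0H : trace (0H {m}) ≡ false
trace-0H {zero} = refl
trace-0H {suc m} = trace-0H {m}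

trace-outer-· : (c : F4) (u : Vect m) → trace (outer (c ·V u)) ≡ nrm c ∧ trace (outer u)
trace-outer-· c [] = sym (Bool.∧-zeroʳ (nrm c))
trace-outer-· c (a ∷ u) = trans (cong₂ _xor_ (nrm-⊗ c a) (trace-outer-· c u))
  (sym (Bool.∧-distribˡ-xor (nrm c) (nrm a) (trace (outer u))))

trace-outer-+ : (u v : Vect m) →
  trace (outer (u +V v)) ≡ (trace (outer u) xor trc (herm u v)) xor trace (outer v)
trace-outer-+ [] [] = refl
trace-outer-+ (a ∷ u) (b ∷ v) = begin
  nrm (a ⊕ b) xor trace (outer (u +V v))
    ≡⟨ cong₂ _xor_ (nrm-⊕ a b) (trace-outer-+ u v) ⟩
  ((nrm a xor trc (a ⊗ conj b)) xor nrm b) xor ((tu xor trc (herm u v)) xor tv)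
    ≡⟨ solve 6 (λ p q r s t w → ((p :+ q) :+ r) :+ ((s :+ t) :+ w) := ((p :+ s) :+ (q :+ t)) :+ (r :+ w))
         refl (nrm a) (trc (a ⊗ conj b)) (nrm b) tu (trc (herm u v)) tv ⟩
  ((nrm a xor tu) xor (trc (a ⊗ conj b) xor trc (herm u v))) xor (nrm b xor tv)
    ≡⟨ cong (λ z → ((nrm a xor tu) xor z) xor (nrm b xor tv)) (trc-⊕ (a ⊗ conj b) (herm u v)) ⟨
  ((nrm a xor tu) xor trc (a ⊗ conj b ⊕ herm u v)) xor (nrm b xor tv) ∎
  where
  tu = trace (outer u)
  tv = trace (outer v)

ι : Bool → F4
ι true = 𝟏
ι false = 𝟎

herm-self : (u : Vect m) → herm u u ≡ ι (trace (outer u))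
herm-self [] = refl
herm-self (a ∷ u) = trans (cong (a ⊗ conj a ⊕_) (herm-self u)) (lemma a (trace (outer u)))
  where
  lemma : ∀ a b → a ⊗ conj a ⊕ ι b ≡ ι (nrm a xor b)
  lemma = λ a → λ { true  → from-yes (∀F? λ a → a ⊗ conj a ⊕ 𝟏 ≟ ι (nrm a xor true)) a
                  ; false → from-yes (∀F? λ a → a ⊗ conj a ⊕ 𝟎 ≟ ι (nrm a xor false)) a }

trace-isotropic : (u : Vect m) → herm u u ≡ 𝟎 → trace (outer u) ≡ false
trace-isotropic u uu with trace (outer u) | herm-self u
... | false | _ = refl
... | true  | p with () ← trans (sym uu) p

⟪⟫-+ˡ : (X Y Z : HM m) → ⟪ X +H Y , Z ⟫ ≡ ⟪ X , Z ⟫ xor ⟪ Y , Z ⟫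
⟪⟫-+ˡ {zero} _ _ _ = refl
⟪⟫-+ˡ {suc m} (d , r , X) (e , s , Y) (f , t , Z) = begin
  (((d xor e) ∧ f) xor trc (herm (r +V s) t)) xor ⟪ X +H Y , Z ⟫
    ≡⟨ cong₂ (λ p q → (((d xor e) ∧ f) xor p) xor q)
         (trans (cong trc (herm-+ˡ r s t)) (trc-⊕ (herm r t) (herm s t))) (⟪⟫-+ˡ X Y Z) ⟩
  (((d xor e) ∧ f) xor (trc (herm r t) xor trc (herm s t))) xor (⟪ X , Z ⟫ xor ⟪ Y , Z ⟫)
    ≡⟨ solve 7 (λ d e f p q x y → (((d :+ e) :* f) :+ (p :+ q)) :+ (x :+ y)
         := (((d :* f) :+ p) :+ x) :+ (((e :* f) :+ q) :+ y)) refl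
         d e f (trc (herm r t)) (trc (herm s t)) ⟪ X , Z ⟫ ⟪ Y , Z ⟫ ⟩
  (((d ∧ f) xor trc (herm r t)) xor ⟪ X , Z ⟫) xor (((e ∧ f) xor trc (herm s t)) xor ⟪ Y , Z ⟫) ∎

⟪⟫-comm : (X Y : HM m) → ⟪ X , Y ⟫ ≡ ⟪ Y , X ⟫
⟪⟫-comm {zero} _ _ = refl
⟪⟫-comm {suc m} (d , r , X) (e , s , Y) =
  cong₂ _xor_ (cong₂ _xor_ (Bool.∧-comm d e)
    (sym (trans (cong trc (herm-conj r s)) (trc-conj (herm r s))))) (⟪⟫-comm X Y)

⟪⟫-+ʳ : (X Y Z : HM m) → ⟪ X , Y +H Z ⟫ ≡ ⟪ X , Y ⟫ xor ⟪ X , Z ⟫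
⟪⟫-+ʳ X Y Z = trans (⟪⟫-comm X (Y +H Z))
  (trans (⟪⟫-+ˡ Y Z X) (cong₂ _xor_ (⟪⟫-comm Y X) (⟪⟫-comm Z X)))

⟪⟫-0ˡ : (X : HM m) → ⟪ 0H , X ⟫ ≡ false
⟪⟫-0ˡ {zero} _ = refl
⟪⟫-0ˡ {suc m} (d , r , X) = cong₂ _xor_ (cong trc (herm-zeroˡ r)) (⟪⟫-0ˡ X)

-- Off the diagonal only field traces of elements of 𝔽₂ occur, and these vanish. Consequently ⟪_,_⟫
-- is alternating on matrices of trace 0.
⟪⟫-self : (X : HM m) → ⟪ X , X ⟫ ≡ trace X
⟪⟫-self {zero} _ = refl
⟪⟫-self {suc m} (d , r , X) = begin
  ((d ∧ d) xor trc (herm r r)) xor ⟪ X , X ⟫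
    ≡⟨ cong₂ _xor_ (cong₂ _xor_ (Bool.∧-idem d) (trans (cong trc (herm-self r)) (trc-ι (trace (outer r)))))
         (⟪⟫-self X) ⟩
  (d xor false) xor trace X
    ≡⟨ cong (_xor trace X) (Bool.xor-identityʳ d) ⟩
  d xor trace X ∎
  where
  trc-ι : ∀ b → trc (ι b) ≡ false
  trc-ι true = refl
  trc-ι false = refl

⟪⟫-scalar : (X : HM m) → ⟪ X , scalar true ⟫ ≡ trace X
⟪⟫-scalar {zero} _ = refl
⟪⟫-scalar {suc m} (d , r , X) = cong₂ _xor_
  (trans (cong₂ _xor_ (Bool.∧-identityʳ d) (cong trc (herm-zeroʳ r))) (Bool.xor-identityʳ d)) (⟪⟫-scalar X)

⟪⟫-outer : (u v : Vect m) → ⟪ outer u , outer v ⟫ ≡ nrm (herm u v)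
⟪⟫-outer [] [] = refl
⟪⟫-outer (a ∷ u) (b ∷ v) = begin
  ((nrm a ∧ nrm b) xor trc (herm (conj a ·V u) (conj b ·V v))) xor ⟪ outer u , outer v ⟫
    ≡⟨ cong₂ (λ p q → ((nrm a ∧ nrm b) xor trc p) xor q)
         (trans (herm-·ˡ (conj a) u (conj b ·V v)) (cong (conj a ⊗_) (herm-·ʳ (conj b) u v)))
         (⟪⟫-outer u v) ⟩
  ((nrm a ∧ nrm b) xor trc (conj a ⊗ (conj (conj b) ⊗ herm u v))) xor nrm (herm u v)
    ≡⟨ from-yes (∀F? λ a → ∀F? λ b → ∀F? λ h →
         ((nrm a ∧ nrm b) xor trc (conj a ⊗ (conj (conj b) ⊗ h))) xor nrm h Bool.≟ nrm (a ⊗ conj b ⊕ h))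
         a b (herm u v) ⟩
  nrm (a ⊗ conj b ⊕ herm u v) ∎

e₂-+ : (X Y : HM m) → e₂ (X +H Y) ≡ ((e₂ X xor e₂ Y) xor (trace X ∧ trace Y)) xor ⟪ X , Y ⟫
e₂-+ {zero} _ _ = refl
e₂-+ {suc m} (d , r , X) (e , s , Y) = begin
  (((d xor e) ∧ trace (X +H Y)) xor trace (outer (r +V s))) xor e₂ (X +H Y)
    ≡⟨ cong₂ _xor_ (cong₂ (λ p q → ((d xor e) ∧ p) xor q) (trace-+ X Y) (trace-outer-+ r s)) (e₂-+ X Y) ⟩
  (((d xor e) ∧ (tX xor tY)) xor ((tr xor h) xor ts)) xor (((e₂ X xor e₂ Y) xor (tX ∧ tY)) xor b)
    ≡⟨ solve 10 (λ d e x y r h s p q b →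
         (((d :+ e) :* (x :+ y)) :+ ((r :+ h) :+ s)) :+ (((p :+ q) :+ (x :* y)) :+ b)
         := ((((((d :* x) :+ r) :+ p) :+ (((e :* y) :+ s) :+ q)) :+ ((d :+ x) :* (e :+ y)))
             :+ (((d :* e) :+ h) :+ b))) refl d e tX tY tr h ts (e₂ X) (e₂ Y) b ⟩
  ((((((d ∧ tX) xor tr) xor e₂ X) xor (((e ∧ tY) xor ts) xor e₂ Y)) xor ((d xor tX) ∧ (e xor tY)))
    xor (((d ∧ e) xor h) xor b)) ∎
  where
  tX = trace X
  tY = trace Y
  tr = trace (outer r)
  ts = trace (outer s)
  h  = trc (herm r s)
  b  = ⟪ X , Y ⟫

e₂-0H : e₂ (0H {m}) ≡ false
e₂-0H {zero} = refl
e₂-0H {suc m} = cong₂ _xor_ (lemma m) (e₂-0H {m})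
  where
  lemma : ∀ m → trace (outer (zeroV {m})) ≡ false
  lemma zero = refl
  lemma (suc m) = lemma m

e₂-outer : (u : Vect m) → e₂ (outer u) ≡ false
e₂-outer [] = refl
e₂-outer (a ∷ u) = begin
  ((nrm a ∧ trace (outer u)) xor trace (outer (conj a ·V u))) xor e₂ (outer u)
    ≡⟨ cong₂ (λ p q → ((nrm a ∧ trace (outer u)) xor p) xor q)
         (trans (trace-outer-· (conj a) u) (cong (_∧ trace (outer u)) (nrm-conj a))) (e₂-outer u) ⟩
  ((nrm a ∧ trace (outer u)) xor (nrm a ∧ trace (outer u))) xor false
    ≡⟨ cong (_xor false) (Bool.xor-same (nrm a ∧ trace (outer u))) ⟩
  false ∎

infix 8 _$_
-- The value y*Xy of the Hermitian form with matrix X.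
_$_ : HM m → Vect m → Bool
X $ y = ⟪ X , outer y ⟫

outer-$ : (u y : Vect m) → outer u $ y ≡ nrm (herm u y)
outer-$ = ⟪⟫-outer

outer-· : (c : F4) → ¬ c ≡ 𝟎 → (u : Vect m) → outer (c ·V u) ≡ outer u
outer-· c c≢𝟎 [] = refl
outer-· c c≢𝟎 (a ∷ u) = cong₂ _,_ (from-yes (∀F? λ c → ∀F? λ a → ¬? (c ≟ 𝟎) →-dec (nrm (c ⊗ a) Bool.≟ nrm a)) c a c≢𝟎)
  (cong₂ _,_ (trans (·V-⊗ (conj (c ⊗ a)) c u) (cong (_·V u)
     (from-yes (∀F? λ c → ∀F? λ a → ¬? (c ≟ 𝟎) →-dec (conj (c ⊗ a) ⊗ c ≟ conj a)) c a c≢𝟎))) (outer-· c c≢𝟎 u))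

$-· : (X : HM m) (c : F4) → ¬ c ≡ 𝟎 → (y : Vect m) → X $ (c ·V y) ≡ X $ y
$-· X c c≢𝟎 y = cong ⟪ X ,_⟫ (outer-· c c≢𝟎 y)

$-zero : (X : HM m) → X $ zeroV ≡ false
$-zero {zero} _ = refl
$-zero {suc m} (d , r , X) = cong₂ _xor_
  (cong₂ _xor_ (Bool.∧-zeroʳ d) (cong trc (trans (cong (herm r) (·V-zeroˡ zeroV)) (herm-zeroʳ r)))) ($-zero X)

-- The outer squares of the five points of a line sum to zero.
$-line : (X : HM m) (x y : Vect m) →
  X $ (x +V (𝟏 ·V y)) xor (X $ (x +V (ω ·V y)) xor X $ (x +V (ω² ·V y))) ≡ X $ x xor X $ y
$-line X x y = begin
  X $ (x +V (𝟏 ·V y)) xor (X $ (x +V (ω ·V y)) xor X $ (x +V (ω² ·V y)))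
    ≡⟨ trans (⟪⟫-+ʳ X A (B +H C)) (cong (X $ (x +V (𝟏 ·V y)) xor_) (⟪⟫-+ʳ X B C)) ⟨
  ⟪ X , A +H (B +H C) ⟫
    ≡⟨ cong ⟪ X ,_⟫ (sum x y) ⟩
  ⟪ X , outer x +H outer y ⟫
    ≡⟨ ⟪⟫-+ʳ X (outer x) (outer y) ⟩
  X $ x xor X $ y ∎
  where
  A = outer (x +V (𝟏 ·V y))
  B = outer (x +V (ω ·V y))
  C = outer (x +V (ω² ·V y))
  entry : ∀ a b s t →
    conj (a ⊕ 𝟏 ⊗ b) ⊗ (s ⊕ 𝟏 ⊗ t) ⊕ (conj (a ⊕ ω ⊗ b) ⊗ (s ⊕ ω ⊗ t) ⊕ conj (a ⊕ ω² ⊗ b) ⊗ (s ⊕ ω² ⊗ t))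
    ≡ conj a ⊗ s ⊕ conj b ⊗ t
  entry = from-yes (∀F? λ a → ∀F? λ b → ∀F? λ s → ∀F? λ t →
    conj (a ⊕ 𝟏 ⊗ b) ⊗ (s ⊕ 𝟏 ⊗ t) ⊕ (conj (a ⊕ ω ⊗ b) ⊗ (s ⊕ ω ⊗ t) ⊕ conj (a ⊕ ω² ⊗ b) ⊗ (s ⊕ ω² ⊗ t))
    ≟ conj a ⊗ s ⊕ conj b ⊗ t)
  column : ∀ {k} a b (s t : Vect k) →
    (conj (a ⊕ 𝟏 ⊗ b) ·V (s +V (𝟏 ·V t))) +V
    ((conj (a ⊕ ω ⊗ b) ·V (s +V (ω ·V t))) +V (conj (a ⊕ ω² ⊗ b) ·V (s +V (ω² ·V t))))
    ≡ (conj a ·V s) +V (conj b ·V t)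
  column a b [] [] = refl
  column a b (s ∷ ss) (t ∷ ts) = cong₂ _∷_ (entry a b s t) (column a b ss ts)
  sum : ∀ {k} (x y : Vect k) →
    outer (x +V (𝟏 ·V y)) +H (outer (x +V (ω ·V y)) +H outer (x +V (ω² ·V y))) ≡ outer x +H outer y
  sum [] [] = refl
  sum (a ∷ x) (b ∷ y) = cong₂ _,_
    (from-yes (∀F? λ a → ∀F? λ b →
      nrm (a ⊕ 𝟏 ⊗ b) xor (nrm (a ⊕ ω ⊗ b) xor nrm (a ⊕ ω² ⊗ b)) Bool.≟ nrm a xor nrm b) a b)
    (cong₂ _,_ (column a b x y) (sum x y))

infix 7 _when_
_when_ : HM m → Bool → HM m
X when b = if b then X else 0H

⟪⟫-when : (X Y : HM m) (b : Bool) → ⟪ X when b , Y ⟫ ≡ b ∧ ⟪ X , Y ⟫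
⟪⟫-when X Y true = refl
⟪⟫-when X Y false = ⟪⟫-0ˡ Y

trace-when : (X : HM m) (b : Bool) → trace (X when b) ≡ b ∧ trace X
trace-when X true = refl
trace-when {m} X false = trace-0H {m}

when-xor : (X : HM m) (a b : Bool) → X when (a xor b) ≡ X when a +H X when b
when-xor X false b = sym (+H-identityˡ (X when b))
when-xor X true false = sym (+H-identityʳ X)
when-xor X true true = sym (+H-self X)

-- Linear dependence over 𝔽₂

scalar-$ : (a : Bool) (y : Vect m) → scalar a $ y ≡ a ∧ trace (outer y)
scalar-$ true y = trans (⟪⟫-comm (scalar true) (outer y)) (⟪⟫-scalar (outer y))
scalar-$ {m} false y = trans (cong (_$ y) (scalar-false m)) (⟪⟫-0ˡ (outer y))
  where
  scalar-false : ∀ m → scalar {m} false ≡ 0H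
  scalar-false zero = refl
  scalar-false (suc m) = cong (λ X → false , zeroV , X) (scalar-false m)

-- The three nonzero multiples of a unit coordinate vector all have norm 𝟏. Against a nonzero
-- coordinate of r they produce all nonzero scalars, among which both traces occur.
trc-const⇒zero : (r : Vect m) (b : Bool) → (∀ q → herm q q ≡ 𝟏 → trc (herm r q) ≡ b) → r ≡ zeroV
trc-const⇒zero [] b _ = refl
trc-const⇒zero {suc m} (a ∷ r) b h = cong₂ _∷_
  (lemma a b (at 𝟏 refl) (at ω refl) (at ω² refl))
  (trc-const⇒zero r b (λ q qq → trans (cong (λ z → trc (z ⊕ herm r q)) (sym (⊗-zeroʳ a))) (h (𝟎 ∷ q) qq)))
  where
  at : ∀ c → c ⊗ conj c ≡ 𝟏 → trc (a ⊗ conj c) ≡ b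
  at c cc = trans (cong trc (sym (trans (cong (a ⊗ conj c ⊕_) (herm-zeroʳ r)) (⊕-identityʳ _))))
    (h (c ∷ zeroV) (cong₂ _⊕_ cc (herm-zeroˡ (zeroV {m}))))
  lemma : ∀ a b → trc (a ⊗ conj 𝟏) ≡ b → trc (a ⊗ conj ω) ≡ b → trc (a ⊗ conj ω²) ≡ b → a ≡ 𝟎
  lemma 𝟎 b _ _ _ = refl
  lemma 𝟏 b p q _ with () ← trans p (sym q)
  lemma ω b p q _ with () ← trans p (sym q)
  lemma ω² b p _ q with () ← trans p (sym q)

-- Isotropic points with first coordinate 1 kill the first column.
vanishing⇒scalar : (X : HM (suc m)) → (∀ p → herm p p ≡ 𝟎 → X $ p ≡ false) → ∃ λ a → X ≡ scalar a
vanishing⇒scalar {zero} (d , [] , tt) _ = d , refl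
vanishing⇒scalar {suc m} (d , r , X) h
  with a , refl ← vanishing⇒scalar X (λ p pp → trans
    (sym (cong (_xor X $ p) (cong₂ _xor_ (Bool.∧-zeroʳ d)
      (cong trc (trans (cong (herm r) (·V-zeroˡ p)) (herm-zeroʳ r)))))) (h (𝟎 ∷ p) pp))
  = a , cong₂ _,_ d≡a (cong (_, scalar a) r≡0)
  where
  -- For such q the vector `𝟏 ∷ q` is isotropic, and the matrix takes the value
  -- `(d xor trc (herm r q)) xor a` there.
  at : ∀ q → herm q q ≡ 𝟏 → trc (herm r q) ≡ d xor a
  at q qq = begin
    trc (herm r q)
      ≡⟨ solve 3 (λ d t a → t := (d :+ a) :+ ((d :+ t) :+ a)) refl d (trc (herm r q)) a ⟩
    (d xor a) xor ((d xor trc (herm r q)) xor a)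
      ≡⟨ cong ((d xor a) xor_) (trans (sym (cong₂ _xor_
           (cong₂ _xor_ (Bool.∧-identityʳ d) (cong (trc ∘ herm r) (·V-identity q))) scalar-q))
           (h (𝟏 ∷ q) (cong (𝟏 ⊕_) qq))) ⟩
    (d xor a) xor false
      ≡⟨ Bool.xor-identityʳ (d xor a) ⟩
    d xor a ∎
    where
    scalar-q : scalar a $ q ≡ a
    scalar-q = trans (scalar-$ a q) (trans (cong (a ∧_) (lemma _ (trans (sym (herm-self q)) qq))) (Bool.∧-identityʳ a))
      where
      lemma : ∀ b → ι b ≡ 𝟏 → b ≡ true
      lemma true _ = refl
  r≡0 : r ≡ zeroV
  r≡0 = trc-const⇒zero r (d xor a) at
  d≡a : d ≡ a
  d≡a = lemma d a (trans (sym (at (𝟏 ∷ zeroV) (cong (𝟏 ⊕_) (herm-zeroˡ (zeroV {m})))))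
    (cong trc (trans (cong (λ r → herm r (𝟏 ∷ zeroV {m})) r≡0) (herm-zeroˡ (𝟏 ∷ zeroV {m})))))
    where
    lemma : ∀ d a → d xor a ≡ false → d ≡ a
    lemma true true _ = refl
    lemma false false _ = refl

-- Of the two scalar matrices, e₂ excludes the identity: at order 6 it has 15 principal minors of
-- size 2, an odd number.
vanishing⇒0H : (X : HM 6) → (∀ p → herm p p ≡ 𝟎 → X $ p ≡ false) → e₂ X ≡ false → X ≡ 0H
vanishing⇒0H X h e with vanishing⇒scalar X h
... | false , refl = refl
... | true , refl with () ← e

-- Gaussian elimination on bit vectors

infixl 6 _⊞_
_⊞_ : Vec Bool n → Vec Bool n → Vec Bool n
_⊞_ = zipWith _xor_

falses : Vec Bool n
falses = replicate _ false

⊞-assoc : (x y z : Vec Bool n) → (x ⊞ y) ⊞ z ≡ x ⊞ (y ⊞ z)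
⊞-assoc [] [] [] = refl
⊞-assoc (a ∷ x) (b ∷ y) (c ∷ z) = cong₂ _∷_ (Bool.xor-assoc a b c) (⊞-assoc x y z)

⊞-comm : (x y : Vec Bool n) → x ⊞ y ≡ y ⊞ x
⊞-comm [] [] = refl
⊞-comm (a ∷ x) (b ∷ y) = cong₂ _∷_ (Bool.xor-comm a b) (⊞-comm x y)

scale : Bool → Vec Bool n → Vec Bool n
scale c = map (c ∧_)

comb : Vec Bool k → Vec (Vec Bool n) k → Vec Bool n
comb [] [] = falses
comb (c ∷ cs) (v ∷ vs) = scale c v ⊞ comb cs vs

⊞-swap : (x y z : Vec Bool n) → x ⊞ (y ⊞ z) ≡ y ⊞ (x ⊞ z)
⊞-swap x y z = trans (sym (⊞-assoc x y z)) (trans (cong (_⊞ z) (⊞-comm x y)) (⊞-assoc y x z))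

-- The family split into one vector with leading `true` and the rest. `coeffs` puts the pivot's
-- coefficient back in its original place, and `nonzero` keeps a nontrivial relation nontrivial
-- whatever that coefficient is.
record Pivot (vs : Vec (Vec Bool (suc n)) (suc k)) : Set where
  field
    pivot   : Vec Bool n
    others  : Vec (Vec Bool (suc n)) k
    coeffs  : Bool → Vec Bool k → Vec Bool (suc k)
    comb≡   : ∀ c cs → comb (coeffs c cs) vs ≡ scale c (true ∷ pivot) ⊞ comb cs others
    nonzero : ∀ c cs → coeffs c cs ≡ falses → cs ≡ falses

findPivot : (vs : Vec (Vec Bool (suc n)) (suc k)) → All (λ v → head v ≡ false) vs ⊎ Pivot vs
findPivot ((true ∷ p) ∷ vs) = inj₂ record
  { pivot = p ; others = vs ; coeffs = _∷_ ; comb≡ = λ c cs → refl ; nonzero = λ c cs → ∷-injectiveʳ }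
findPivot {k = zero} ((false ∷ p) ∷ []) = inj₁ (refl ∷ [])
findPivot {k = suc k} ((false ∷ p) ∷ vs) with findPivot vs
... | inj₁ all = inj₁ (refl ∷ all)
... | inj₂ P = inj₂ record
  { pivot = pivot
  ; others = (false ∷ p) ∷ others
  ; coeffs = λ { c (d ∷ cs) → d ∷ coeffs c cs }
  ; comb≡ = λ { c (d ∷ cs) → trans (cong (scale d (false ∷ p) ⊞_) (comb≡ c cs))
                  (⊞-swap (scale d (false ∷ p)) (scale c (true ∷ pivot)) (comb cs others)) }
  ; nonzero = λ { c (d ∷ cs) eq → cong₂ _∷_ (∷-injectiveˡ eq) (nonzero c cs (∷-injectiveʳ eq)) }
  }
  where open Pivot P

eliminate : Vec Bool n → Vec Bool (suc n) → Vec Bool n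
eliminate p (b ∷ v) = scale b p ⊞ v

dot-heads : Vec Bool k → Vec (Vec Bool (suc n)) k → Bool
dot-heads [] [] = false
dot-heads (c ∷ cs) (v ∷ vs) = (c ∧ head v) xor dot-heads cs vs

-- Clearing the heads with the pivot alters a combination by a multiple of the pivot, and
-- `dot-heads` is that multiple.
comb-eliminate : (p : Vec Bool n) (cs : Vec Bool k) (vs : Vec (Vec Bool (suc n)) k) →
  comb cs vs ≡ dot-heads cs vs ∷ (scale (dot-heads cs vs) p ⊞ comb cs (map (eliminate p) vs))
comb-eliminate p [] [] = cong (false ∷_) (zeros p)
  where
  zeros : ∀ {n} (p : Vec Bool n) → falses ≡ scale false p ⊞ falses
  zeros [] = refl
  zeros (a ∷ p) = cong (false ∷_) (zeros p)
comb-eliminate p (c ∷ cs) ((b ∷ v) ∷ vs) = trans (cong (scale c (b ∷ v) ⊞_) (comb-eliminate p cs vs))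
  (cong (((c ∧ b) xor t) ∷_) (lemma p v (comb cs (map (eliminate p) vs))))
  where
  t = dot-heads cs vs
  lemma : ∀ {n} (p v w : Vec Bool n) →
    scale c v ⊞ (scale t p ⊞ w) ≡ scale ((c ∧ b) xor t) p ⊞ (scale c (scale b p ⊞ v) ⊞ w)
  lemma [] [] [] = refl
  lemma (x ∷ p) (y ∷ v) (z ∷ w) = cong₂ _∷_
    (rearrange c b t x y z)
    (lemma p v w)
    where
    rearrange : ∀ c b t x y z →
      (c ∧ y) xor ((t ∧ x) xor z) ≡ (((c ∧ b) xor t) ∧ x) xor ((c ∧ ((b ∧ x) xor y)) xor z)
    rearrange false b t x y z = refl
    rearrange true false t x y z = solve 3 (λ y t z → y :+ (t :+ z) := t :+ (y :+ z)) refl y (t ∧ x) z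
    rearrange true true false x y z =
      trans (sym (cong (_xor (y xor z)) (Bool.xor-same x)))
        (solve 3 (λ x y z → (x :+ x) :+ (y :+ z) := x :+ ((x :+ y) :+ z)) refl x y z)
    rearrange true true true x y z = solve 3 (λ x y z → y :+ (x :+ z) := (x :+ y) :+ z) refl x y z

dependent : ∀ n (vs : Vec (Vec Bool n) (suc n)) → ∃ λ cs → comb cs vs ≡ falses × ¬ cs ≡ falses
dependent zero ([] ∷ []) = true ∷ [] , refl , λ ()
dependent (suc n) vs with findPivot vs
... | inj₁ all with vs | all
... | v ∷ ws | _ ∷ all′ with cs , comb≡0 , cs≢0 ← dependent n (map tail ws) =
  false ∷ cs , trans (cong (scale false v ⊞_) (lift cs ws all′ comb≡0)) (zeros v) , cs≢0 ∘ ∷-injectiveʳ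
  where
  zeros : ∀ {n} (v : Vec Bool n) → scale false v ⊞ falses ≡ falses
  zeros [] = refl
  zeros (a ∷ p) = cong (false ∷_) (zeros p)
  head-comb : ∀ {k} (cs : Vec Bool k) (ws : Vec (Vec Bool (suc n)) k) → All (λ v → head v ≡ false) ws →
    comb cs ws ≡ false ∷ comb cs (map tail ws)
  head-comb [] [] [] = refl
  head-comb (c ∷ cs) ((.false ∷ w) ∷ ws) (refl ∷ all) =
    trans (cong (scale c (false ∷ w) ⊞_) (head-comb cs ws all))
      (cong (_∷ (scale c w ⊞ comb cs (map tail ws))) (trans (Bool.xor-identityʳ (c ∧ false)) (Bool.∧-zeroʳ c)))
  lift : ∀ {k} (cs : Vec Bool k) (ws : Vec (Vec Bool (suc n)) k) → All (λ v → head v ≡ false) ws →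
    comb cs (map tail ws) ≡ falses → comb cs ws ≡ falses
  lift cs ws all eq = trans (head-comb cs ws all) (cong (false ∷_) eq)
dependent (suc n) vs | inj₂ P with cs , comb≡0 , cs≢0 ← dependent n (map (eliminate (Pivot.pivot P)) (Pivot.others P)) =
  -- The pivot enters with the coefficient `t` that it acquired during elimination, so that the two
  -- occurrences cancel.
  coeffs t cs , (begin
    comb (coeffs t cs) vs
      ≡⟨ comb≡ t cs ⟩
    scale t (true ∷ pivot) ⊞ comb cs others
      ≡⟨ cong (scale t (true ∷ pivot) ⊞_) (trans (comb-eliminate pivot cs others)
           (cong (λ w → t ∷ (scale t pivot ⊞ w)) comb≡0)) ⟩
    scale t (true ∷ pivot) ⊞ (t ∷ (scale t pivot ⊞ falses))
      ≡⟨ cong₂ _∷_ (trans (cong (_xor t) (Bool.∧-identityʳ t)) (Bool.xor-same t)) (cancel (scale t pivot)) ⟩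
    falses ∎) , cs≢0 ∘ nonzero t cs
  where
  open Pivot P
  t = dot-heads cs others
  cancel : ∀ {n} (x : Vec Bool n) → x ⊞ (x ⊞ falses) ≡ falses
  cancel [] = refl
  cancel (a ∷ x) = cong₂ _∷_ (trans (cong (a xor_) (Bool.xor-identityʳ a)) (Bool.xor-same a)) (cancel x)

-- Coordinates of Hermitian matrices over 𝔽₂

bits : F4 → Vec Bool 2
bits 𝟎  = false ∷ false ∷ []
bits 𝟏  = true ∷ false ∷ []
bits ω  = false ∷ true ∷ []
bits ω² = true ∷ true ∷ []

bits-⊕ : ∀ a b → bits (a ⊕ b) ≡ bits a ⊞ bits b
bits-⊕ 𝟎 𝟎 = refl
bits-⊕ 𝟎 𝟏 = refl
bits-⊕ 𝟎 ω = refl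
bits-⊕ 𝟎 ω² = refl
bits-⊕ 𝟏 𝟎 = refl
bits-⊕ 𝟏 𝟏 = refl
bits-⊕ 𝟏 ω = refl
bits-⊕ 𝟏 ω² = refl
bits-⊕ ω 𝟎 = refl
bits-⊕ ω 𝟏 = refl
bits-⊕ ω ω = refl
bits-⊕ ω ω² = refl
bits-⊕ ω² 𝟎 = refl
bits-⊕ ω² 𝟏 = refl
bits-⊕ ω² ω = refl
bits-⊕ ω² ω² = refl

bitsV : Vect m → Vec Bool (m * 2)
bitsV [] = []
bitsV (a ∷ r) = bits a ++ bitsV r

-- In closed form (m + 1)² - 1, the dimension over 𝔽₂ of the trace-zero Hermitian matrices of order
-- m + 1; it is 35 for order 6.
dim₀ : ℕ → ℕ
dim₀ zero = zero
dim₀ (suc m) = suc (suc m * 2 + dim₀ m)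

-- All coordinates except the last diagonal entry, which the trace recovers.
bitsH : HM (suc m) → Vec Bool (dim₀ m)
bitsH {zero} _ = []
bitsH {suc m} (d , r , X) = d ∷ (bitsV r ++ bitsH X)

++-⊞ : (x x′ : Vec Bool k) (y y′ : Vec Bool n) → (x ⊞ x′) ++ (y ⊞ y′) ≡ (x ++ y) ⊞ (x′ ++ y′)
++-⊞ [] [] y y′ = refl
++-⊞ (a ∷ x) (b ∷ x′) y y′ = cong ((a xor b) ∷_) (++-⊞ x x′ y y′)

bitsV-+ : (r s : Vect m) → bitsV (r +V s) ≡ bitsV r ⊞ bitsV s
bitsV-+ [] [] = refl
bitsV-+ (a ∷ r) (b ∷ s) = trans (cong₂ _++_ (bits-⊕ a b) (bitsV-+ r s)) (++-⊞ (bits a) (bits b) (bitsV r) (bitsV s))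

bitsH-+ : (X Y : HM (suc m)) → bitsH (X +H Y) ≡ bitsH X ⊞ bitsH Y
bitsH-+ {zero} _ _ = refl
bitsH-+ {suc m} (d , r , X) (e , s , Y) = cong ((d xor e) ∷_)
  (trans (cong₂ _++_ (bitsV-+ r s) (bitsH-+ X Y)) (++-⊞ (bitsV r) (bitsV s) (bitsH X) (bitsH Y)))

++-falses : (x : Vec Bool k) (y : Vec Bool n) → x ++ y ≡ falses → x ≡ falses × y ≡ falses
++-falses [] y eq = refl , eq
++-falses (a ∷ x) y eq with p , q ← ++-falses x y (∷-injectiveʳ eq) = cong₂ _∷_ (∷-injectiveˡ eq) p , q

bitsV-injective : (r : Vect m) → bitsV r ≡ falses → r ≡ zeroV
bitsV-injective [] _ = refl
bitsV-injective (𝟎 ∷ r) eq = cong (𝟎 ∷_) (bitsV-injective r (∷-injectiveʳ (∷-injectiveʳ eq)))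
bitsV-injective (𝟏 ∷ r) ()
bitsV-injective (ω ∷ r) ()
bitsV-injective (ω² ∷ r) ()

bitsH-injective : (X : HM (suc m)) → bitsH X ≡ falses → trace X ≡ false → X ≡ 0H
bitsH-injective {zero} (false , [] , tt) _ _ = refl
bitsH-injective {suc m} (d , r , X) eq tr
  with refl ← ∷-injectiveˡ eq | p , q ← ++-falses (bitsV r) (bitsH X) (∷-injectiveʳ eq)
  = cong₂ _,_ refl (cong₂ _,_ (bitsV-injective r p) (bitsH-injective X q tr))

combH : Vec Bool k → Vec (HM m) k → HM m
combH [] [] = 0H
combH (c ∷ cs) (X ∷ Xs) = X when c +H combH cs Xs

bitsH-0H : bitsH (0H {suc m}) ≡ falses
bitsH-0H {zero} = refl
bitsH-0H {suc m} = cong (false ∷_) (trans (cong₂ _++_ (bitsV-zero (suc m)) (bitsH-0H {m})) (falses-++ (suc m * 2)))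
  where
  bitsV-zero : ∀ m → bitsV (zeroV {m}) ≡ falses
  bitsV-zero zero = refl
  bitsV-zero (suc m) = cong (λ v → false ∷ false ∷ v) (bitsV-zero m)
  falses-++ : ∀ k {n} → falses {k} ++ falses {n} ≡ falses
  falses-++ zero = refl
  falses-++ (suc k) = cong (false ∷_) (falses-++ k)

bitsH-comb : (cs : Vec Bool k) (Xs : Vec (HM (suc m)) k) → bitsH (combH cs Xs) ≡ comb cs (map bitsH Xs)
bitsH-comb {m = m} [] [] = bitsH-0H {m}
bitsH-comb {m = m} (c ∷ cs) (X ∷ Xs) = trans (bitsH-+ (X when c) (combH cs Xs))
  (cong₂ _⊞_ (when-bits c) (bitsH-comb cs Xs))
  where
  when-bits : ∀ c → bitsH (X when c) ≡ scale c (bitsH X)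
  when-bits false = trans (bitsH-0H {m}) (zeros (bitsH X))
    where
    zeros : ∀ {n} (p : Vec Bool n) → falses ≡ scale false p
    zeros [] = refl
    zeros (a ∷ p) = cong (false ∷_) (zeros p)
  when-bits true = ident (bitsH X)
    where
    ident : ∀ {n} (p : Vec Bool n) → p ≡ scale true p
    ident [] = refl
    ident (a ∷ p) = cong (a ∷_) (ident p)

trace-comb : (cs : Vec Bool k) (Xs : Vec (HM m) k) → All (λ X → trace X ≡ false) Xs → trace (combH cs Xs) ≡ false
trace-comb {m = m} [] [] [] = trace-0H {m}
trace-comb (c ∷ cs) (X ∷ Xs) (tX ∷ tXs) = trans (trace-+ (X when c) (combH cs Xs))
  (cong₂ _xor_ (trans (trace-when X c) (trans (cong (c ∧_) tX) (Bool.∧-zeroʳ c))) (trace-comb cs Xs tXs))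

dependentH : (Xs : Vec (HM (suc m)) (suc (dim₀ m))) → All (λ X → trace X ≡ false) Xs →
  ∃ λ cs → combH cs Xs ≡ 0H × ¬ cs ≡ falses
dependentH Xs tXs with cs , eq , cs≢0 ← dependent _ (map bitsH Xs) =
  cs , bitsH-injective (combH cs Xs) (trans (bitsH-comb cs Xs) eq) (trace-comb cs Xs tXs) , cs≢0

-- Outer squares of pairwise non-orthogonal isotropic vectors

xors : Vec Bool k → Bool
xors [] = false
xors (s ∷ ss) = s xor xors ss

Apart : Vect m → Vect m → Set
Apart u v = nrm (herm u v) ≡ true

Isotropic : Vect m → Set
Isotropic v = herm v v ≡ 𝟎

Apart-sym : (u v : Vect m) → Apart u v → Apart v u
Apart-sym u v uv = trans (cong nrm (herm-conj u v)) (trans (nrm-conj (herm u v)) uv)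

comb-apart : (s : Vec Bool k) (vs : Vec (Vect m) k) (v : Vect m) → All (Apart v) vs →
  combH s (map outer vs) $ v ≡ xors s
comb-apart [] [] v [] = ⟪⟫-0ˡ (outer v)
comb-apart (c ∷ s) (u ∷ vs) v (vu ∷ vvs) = trans (⟪⟫-+ˡ (outer u when c) (combH s (map outer vs)) (outer v))
  (cong₂ _xor_ (trans (⟪⟫-when (outer u) (outer v) c)
      (trans (cong (c ∧_) (trans (outer-$ u v) (Apart-sym v u vu))) (Bool.∧-identityʳ c)))
    (comb-apart s vs v vvs))

-- Row j of the Gram matrix J - I applied to s: every outer square takes the value `true` at
-- `lookup vs j` except its own.
comb-lookup : (s : Vec Bool k) (vs : Vec (Vect m) k) → All Isotropic vs → AllPairs Apart vs → (j : Fin k) →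
  combH s (map outer vs) $ lookup vs j ≡ xors s xor lookup s j
comb-lookup (c ∷ s) (v ∷ vs) (vv ∷ iso) (vvs ∷ ap) zero = begin
  (outer v when c +H combH s (map outer vs)) $ v
    ≡⟨ ⟪⟫-+ˡ (outer v when c) (combH s (map outer vs)) (outer v) ⟩
  ⟪ outer v when c , outer v ⟫ xor combH s (map outer vs) $ v
    ≡⟨ cong₂ _xor_ (trans (⟪⟫-when (outer v) (outer v) c) (trans (cong (c ∧_) (trans (outer-$ v v) (cong nrm vv))) (Bool.∧-zeroʳ c)))
         (comb-apart s vs v vvs) ⟩
  xors s
    ≡⟨ trans (sym (cong (_xor xors s) (Bool.xor-same c))) (solve 2 (λ c x → (c :+ c) :+ x := (c :+ x) :+ c) refl c (xors s)) ⟩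
  (c xor xors s) xor c ∎
comb-lookup (c ∷ s) (v ∷ vs) (vv ∷ iso) (vvs ∷ ap) (suc j) = begin
  (outer v when c +H combH s (map outer vs)) $ lookup vs j
    ≡⟨ ⟪⟫-+ˡ (outer v when c) (combH s (map outer vs)) (outer (lookup vs j)) ⟩
  ⟪ outer v when c , outer (lookup vs j) ⟫ xor combH s (map outer vs) $ lookup vs j
    ≡⟨ cong₂ _xor_ (trans (⟪⟫-when (outer v) (outer (lookup vs j)) c)
         (trans (cong (c ∧_) (trans (outer-$ v (lookup vs j)) (lookup⁺ vvs j))) (Bool.∧-identityʳ c)))
         (comb-lookup s vs iso ap j) ⟩
  c xor (xors s xor lookup s j)
    ≡⟨ Bool.xor-assoc c (xors s) (lookup s j) ⟨
  (c xor xors s) xor lookup s j ∎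

xor-≡ : ∀ a b → a xor b ≡ false → a ≡ b
xor-≡ true true _ = refl
xor-≡ false false _ = refl

lookup-const : (s : Vec Bool k) (b : Bool) → (∀ j → lookup s j ≡ b) → s ≡ replicate k b
lookup-const [] b _ = refl
lookup-const (c ∷ s) b h = cong₂ _∷_ (h zero) (lookup-const s b (h ∘ suc))

-- The Gram matrix of vs is J − I, of even size, hence invertible over 𝔽₂.
comb-independent : (s : Vec Bool 32) (vs : Vec (Vect m) 32) → All Isotropic vs → AllPairs Apart vs →
  (∀ j → combH s (map outer vs) $ lookup vs j ≡ false) → s ≡ falses
comb-independent s vs iso ap h = constant (xors s) refl (lookup-const s (xors s)
    (λ j → sym (xor-≡ (xors s) (lookup s j) (trans (sym (comb-lookup s vs iso ap j)) (h j)))))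
  where
  constant : ∀ b → xors s ≡ b → s ≡ replicate 32 b → s ≡ falses
  constant false _ eq = eq
  constant true p eq with () ← trans (sym (cong xors eq)) p

comb-falses : (Xs : Vec (HM m) k) → combH falses Xs ≡ 0H
comb-falses [] = refl
comb-falses (X ∷ Xs) = trans (+H-identityˡ (combH falses Xs)) (comb-falses Xs)

traces-outer : (vs : Vec (Vect m) k) → All Isotropic vs → All (λ X → trace X ≡ false) (map outer vs)
traces-outer [] [] = []
traces-outer (v ∷ vs) (p ∷ ps) = trace-isotropic v p ∷ traces-outer vs ps

-- Nothing is known about ⟪ a , d ⟫ and ⟪ b , d ⟫, so the order of elimination matters. Pairing the
-- relation with the vs kills s, as a, b, c, d are orthogonal to them; then pairing with c gives δ,
-- with b and a gives α and β, and finally with d gives γ.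
quadruple-independent : (vs : Vec (Vect 6) 32) → All Isotropic vs → AllPairs Apart vs →
  (a b c d : HM 6) → All (λ X → trace X ≡ false) (a ∷ b ∷ c ∷ d ∷ []) →
  All (λ X → ∀ j → X $ lookup vs j ≡ false) (a ∷ b ∷ c ∷ d ∷ []) →
  ⟪ a , b ⟫ ≡ true → ⟪ a , c ⟫ ≡ false → ⟪ b , c ⟫ ≡ false → ⟪ c , d ⟫ ≡ true →
  (α β γ δ : Bool) (s : Vec Bool 32) →
  combH (α ∷ β ∷ γ ∷ δ ∷ s) (a ∷ b ∷ c ∷ d ∷ map outer vs) ≡ 0H → (α ∷ β ∷ γ ∷ δ ∷ s) ≡ falses
quadruple-independent vs iso ap a b c d (ta ∷ tb ∷ tc ∷ td ∷ []) (a⊥ ∷ b⊥ ∷ c⊥ ∷ d⊥ ∷ []) ab ac bc cd α β γ δ s eq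
  = cong₂ _∷_ α≡0 (cong₂ _∷_ β≡0 (cong₂ _∷_ γ≡0 (cong₂ _∷_ δ≡0 s≡0)))
  where
  S = combH s (map outer vs)
  expand : ∀ Z → ((α ∧ ⟪ a , Z ⟫) xor ((β ∧ ⟪ b , Z ⟫) xor ((γ ∧ ⟪ c , Z ⟫) xor (δ ∧ ⟪ d , Z ⟫)))) xor ⟪ S , Z ⟫ ≡ false
  expand Z = begin
    ((α ∧ ⟪ a , Z ⟫) xor ((β ∧ ⟪ b , Z ⟫) xor ((γ ∧ ⟪ c , Z ⟫) xor (δ ∧ ⟪ d , Z ⟫)))) xor ⟪ S , Z ⟫
      ≡⟨ solve 5 (λ p q r t x → (p :+ (q :+ (r :+ t))) :+ x := p :+ (q :+ (r :+ (t :+ x)))) refl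
           (α ∧ ⟪ a , Z ⟫) (β ∧ ⟪ b , Z ⟫) (γ ∧ ⟪ c , Z ⟫) (δ ∧ ⟪ d , Z ⟫) ⟪ S , Z ⟫ ⟩
    (α ∧ ⟪ a , Z ⟫) xor ((β ∧ ⟪ b , Z ⟫) xor ((γ ∧ ⟪ c , Z ⟫) xor ((δ ∧ ⟪ d , Z ⟫) xor ⟪ S , Z ⟫)))
      ≡⟨ split α a _ (split β b _ (split γ c _ (split δ d S refl))) ⟨
    ⟪ combH (α ∷ β ∷ γ ∷ δ ∷ s) (a ∷ b ∷ c ∷ d ∷ map outer vs) , Z ⟫
      ≡⟨ trans (cong ⟪_, Z ⟫ eq) (⟪⟫-0ˡ Z) ⟩
    false ∎
    where
    split : ∀ c X Y {y} → ⟪ Y , Z ⟫ ≡ y → ⟪ X when c +H Y , Z ⟫ ≡ (c ∧ ⟪ X , Z ⟫) xor y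
    split c X Y eq = trans (⟪⟫-+ˡ (X when c) Y Z) (cong₂ _xor_ (⟪⟫-when X Z c) eq)
  pair : ∀ Z {p q r t} → ⟪ a , Z ⟫ ≡ p → ⟪ b , Z ⟫ ≡ q → ⟪ c , Z ⟫ ≡ r → ⟪ d , Z ⟫ ≡ t →
    ((α ∧ p) xor ((β ∧ q) xor ((γ ∧ r) xor (δ ∧ t)))) xor ⟪ S , Z ⟫ ≡ false
  pair Z refl refl refl refl = expand Z
  s≡0 : s ≡ falses
  s≡0 = comb-independent s vs iso ap λ j → trans
    (solve 5 (λ α β γ δ x → x := ((α :* con false) :+ ((β :* con false) :+ ((γ :* con false) :+ (δ :* con false)))) :+ x)
      refl α β γ δ (S $ lookup vs j))
    (pair (outer (lookup vs j)) (a⊥ j) (b⊥ j) (c⊥ j) (d⊥ j))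
  S⊥ : ∀ Z → ⟪ S , Z ⟫ ≡ false
  S⊥ Z = trans (cong (λ s → ⟪ combH s (map outer vs) , Z ⟫) s≡0)
    (trans (cong ⟪_, Z ⟫ (comb-falses (map outer vs))) (⟪⟫-0ˡ Z))
  pair′ : ∀ Z {p q r t} → ⟪ a , Z ⟫ ≡ p → ⟪ b , Z ⟫ ≡ q → ⟪ c , Z ⟫ ≡ r → ⟪ d , Z ⟫ ≡ t →
    (α ∧ p) xor ((β ∧ q) xor ((γ ∧ r) xor (δ ∧ t))) ≡ false
  pair′ Z {p} {q} {r} {t} pa pb pc pd = trans (sym (Bool.xor-identityʳ _))
    (trans (cong (((α ∧ p) xor ((β ∧ q) xor ((γ ∧ r) xor (δ ∧ t)))) xor_) (sym (S⊥ Z))) (pair Z pa pb pc pd))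
  self : (X : HM 6) → trace X ≡ false → ⟪ X , X ⟫ ≡ false
  self X tX = trans (⟪⟫-self X) tX
  flip : ∀ (X Y : HM 6) {x} → ⟪ X , Y ⟫ ≡ x → ⟪ Y , X ⟫ ≡ x
  flip X Y eq = trans (⟪⟫-comm Y X) eq
  δ≡0 : δ ≡ false
  δ≡0 = trans
    (solve 4 (λ α β γ δ → δ := (α :* con false) :+ ((β :* con false) :+ ((γ :* con false) :+ (δ :* con true)))) refl α β γ δ)
    (pair′ c ac bc (self c tc) (flip c d cd))
  α≡0 : α ≡ false
  α≡0 = trans
    (solve 4 (λ α β γ x → α := (α :* con true) :+ ((β :* con false) :+ ((γ :* con false) :+ (con false :* x)))) refl α β γ ⟪ d , b ⟫)
    (trans (cong (λ δ → (α ∧ true) xor ((β ∧ false) xor ((γ ∧ false) xor (δ ∧ ⟪ d , b ⟫)))) (sym δ≡0))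
      (pair′ b ab (self b tb) (flip b c bc) refl))
  β≡0 : β ≡ false
  β≡0 = trans
    (solve 4 (λ α β γ x → β := (α :* con false) :+ ((β :* con true) :+ ((γ :* con false) :+ (con false :* x)))) refl α β γ ⟪ d , a ⟫)
    (trans (cong (λ δ → (α ∧ false) xor ((β ∧ true) xor ((γ ∧ false) xor (δ ∧ ⟪ d , a ⟫)))) (sym δ≡0))
      (pair′ a (self a ta) (flip a b ab) (flip a c ac) refl))
  γ≡0 : γ ≡ false
  γ≡0 = trans
    (solve 3 (λ x y γ → γ := (con false :* x) :+ ((con false :* y) :+ ((γ :* con true) :+ con false))) refl ⟪ a , d ⟫ ⟪ b , d ⟫ γ)
    (trans (cong₂ (λ α β → (α ∧ ⟪ a , d ⟫) xor ((β ∧ ⟪ b , d ⟫) xor ((γ ∧ true) xor false))) (sym α≡0) (sym β≡0))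
      (trans (cong (λ z → (α ∧ ⟪ a , d ⟫) xor ((β ∧ ⟪ b , d ⟫) xor ((γ ∧ true) xor z))) (sym (Bool.∧-zeroʳ δ)))
        (pair′ d refl refl cd (self d td))))

-- 32 + 4 > 35: orthogonally to vs there is no room for two hyperbolic pairs.
dimension-bound : (vs : Vec (Vect 6) 32) → All Isotropic vs → AllPairs Apart vs →
  (a b c d : HM 6) → All (λ X → trace X ≡ false) (a ∷ b ∷ c ∷ d ∷ []) →
  All (λ X → ∀ j → X $ lookup vs j ≡ false) (a ∷ b ∷ c ∷ d ∷ []) →
  ⟪ a , b ⟫ ≡ true → ⟪ a , c ⟫ ≡ false → ⟪ b , c ⟫ ≡ false → ⟪ c , d ⟫ ≡ true → ⊥
dimension-bound vs iso ap a b c d traces@(ta ∷ tb ∷ tc ∷ td ∷ []) ortho ab ac bc cd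
  with (α ∷ β ∷ γ ∷ δ ∷ s) , eq , nonzero ← dependentH (a ∷ b ∷ c ∷ d ∷ map outer vs)
         (ta ∷ tb ∷ tc ∷ td ∷ traces-outer vs iso)
  = nonzero (quadruple-independent vs iso ap a b c d traces ortho ab ac bc cd α β γ δ s eq)

-- Isometries and the reduction to n = 3

record Isometry (m : ℕ) : Set where
  field
    to      : Vect m → Vect m
    from    : Vect m → Vect m
    to-+    : ∀ x y → to (x +V y) ≡ to x +V to y
    to-·    : ∀ c x → to (c ·V x) ≡ c ·V to x
    to-herm : ∀ x y → herm (to x) (to y) ≡ herm x y
    from-to : ∀ x → from (to x) ≡ x
    to-from : ∀ x → to (from x) ≡ x

  from-+ : ∀ x y → from (x +V y) ≡ from x +V from y
  from-+ x y = begin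
    from (x +V y)                      ≡⟨ cong₂ (λ x y → from (x +V y)) (to-from x) (to-from y) ⟨
    from (to (from x) +V to (from y))  ≡⟨ cong from (to-+ (from x) (from y)) ⟨
    from (to (from x +V from y))       ≡⟨ from-to (from x +V from y) ⟩
    from x +V from y                   ∎

  from-· : ∀ c x → from (c ·V x) ≡ c ·V from x
  from-· c x = begin
    from (c ·V x)             ≡⟨ cong (λ x → from (c ·V x)) (to-from x) ⟨
    from (c ·V to (from x))   ≡⟨ cong from (to-· c (from x)) ⟨
    from (to (c ·V from x))   ≡⟨ from-to (c ·V from x) ⟩
    c ·V from x               ∎

  from-herm : ∀ x y → herm (from x) (from y) ≡ herm x y
  from-herm x y = trans (sym (to-herm (from x) (from y))) (cong₂ herm (to-from x) (to-from y))

  to-zero : to zeroV ≡ zeroV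
  to-zero = trans (cong to (sym (·V-zeroˡ zeroV))) (trans (to-· 𝟎 zeroV) (·V-zeroˡ (to zeroV)))

  from-zero : from zeroV ≡ zeroV
  from-zero = trans (cong from (sym to-zero)) (from-to zeroV)

  herm-adjoint : ∀ x y → herm (to x) y ≡ herm x (from y)
  herm-adjoint x y = trans (cong (herm (to x)) (sym (to-from y))) (to-herm x (from y))

open Isometry

inverse : Isometry m → Isometry m
inverse g = record
  { to = from g ; from = to g ; to-+ = from-+ g ; to-· = from-· g
  ; to-herm = from-herm g ; from-to = to-from g ; to-from = from-to g }

infixr 9 _∘ᴵ_
_∘ᴵ_ : Isometry m → Isometry m → Isometry m
g ∘ᴵ h = record
  { to = to g ∘ to h
  ; from = from h ∘ from g
  ; to-+ = λ x y → trans (cong (to g) (to-+ h x y)) (to-+ g (to h x) (to h y))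
  ; to-· = λ c x → trans (cong (to g) (to-· h c x)) (to-· g c (to h x))
  ; to-herm = λ x y → trans (to-herm g (to h x) (to h y)) (to-herm h x y)
  ; from-to = λ x → trans (cong (from h) (from-to g (to h x))) (from-to h x)
  ; to-from = λ x → trans (cong (to g) (to-from h (from g x))) (to-from g x)
  }

extend : Isometry m → Isometry (2 + m)
extend g = record
  { to = λ { (a ∷ b ∷ x) → a ∷ b ∷ to g x }
  ; from = λ { (a ∷ b ∷ x) → a ∷ b ∷ from g x }
  ; to-+ = λ { (a ∷ b ∷ x) (c ∷ d ∷ y) → cong (λ v → _ ∷ _ ∷ v) (to-+ g x y) }
  ; to-· = λ { c (a ∷ b ∷ x) → cong (λ v → _ ∷ _ ∷ v) (to-· g c x) }
  ; to-herm = λ { (a ∷ b ∷ x) (c ∷ d ∷ y) → cong (λ h → a ⊗ conj c ⊕ (b ⊗ conj d ⊕ h)) (to-herm g x y) }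
  ; from-to = λ { (a ∷ b ∷ x) → cong (λ v → a ∷ b ∷ v) (from-to g x) }
  ; to-from = λ { (a ∷ b ∷ x) → cong (λ v → a ∷ b ∷ v) (to-from g x) }
  }

reflect : F4 → Vect m → Vect m → Vect m
reflect c u x = x +V ((c ⊗ herm x u) ·V u)

reflect-+ : (c : F4) (u x y : Vect m) → reflect c u (x +V y) ≡ reflect c u x +V reflect c u y
reflect-+ c u x y = begin
  (x +V y) +V ((c ⊗ herm (x +V y) u) ·V u)
    ≡⟨ cong (λ h → (x +V y) +V (h ·V u)) (trans (cong (c ⊗_) (herm-+ˡ x y u)) (⊗-distribˡ-⊕ c _ _)) ⟩
  (x +V y) +V (((c ⊗ herm x u) ⊕ (c ⊗ herm y u)) ·V u)
    ≡⟨ cong ((x +V y) +V_) (·V-distribʳ (c ⊗ herm x u) (c ⊗ herm y u) u) ⟩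
  (x +V y) +V (X +V Y)
    ≡⟨ +V-assoc x y (X +V Y) ⟩
  x +V (y +V (X +V Y))
    ≡⟨ cong (x +V_) (trans (sym (+V-assoc y X Y)) (trans (cong (_+V Y) (+V-comm y X)) (+V-assoc X y Y))) ⟩
  x +V (X +V (y +V Y))
    ≡⟨ +V-assoc x X (y +V Y) ⟨
  (x +V X) +V (y +V Y) ∎
  where
  X = (c ⊗ herm x u) ·V u
  Y = (c ⊗ herm y u) ·V u

reflect-· : (c : F4) (u : Vect m) (d : F4) (x : Vect m) → reflect c u (d ·V x) ≡ d ·V reflect c u x
reflect-· c u d x = trans (cong (λ h → (d ·V x) +V (h ·V u)) (begin
    c ⊗ herm (d ·V x) u  ≡⟨ cong (c ⊗_) (herm-·ˡ d x u) ⟩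
    c ⊗ (d ⊗ herm x u)   ≡⟨ from-yes (∀F? λ c → ∀F? λ d → ∀F? λ h → c ⊗ (d ⊗ h) ≟ d ⊗ (c ⊗ h)) c d (herm x u) ⟩
    d ⊗ (c ⊗ herm x u)   ∎))
  (trans (cong ((d ·V x) +V_) (sym (·V-⊗ d (c ⊗ herm x u) u))) (sym (·V-distribˡ d x ((c ⊗ herm x u) ·V u))))

-- The form changes by herm x u times the conjugate of herm y u times the left side of the
-- hypothesis. Both kinds of unitary map are covered: transvections, where u is isotropic and c is
-- fixed by `conj`, and reflections, where herm u u is 𝟏 and c is ω or ω².
reflect-herm : (c : F4) (u : Vect m) → (c ⊕ conj c) ⊕ (c ⊗ conj c) ⊗ herm u u ≡ 𝟎 →
  ∀ x y → herm (reflect c u x) (reflect c u y) ≡ herm x y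
reflect-herm c u unitary x y = begin
  herm (x +V (p ·V u)) (y +V (q ·V u))
    ≡⟨ herm-+ˡ x (p ·V u) (y +V (q ·V u)) ⟩
  herm x (y +V (q ·V u)) ⊕ herm (p ·V u) (y +V (q ·V u))
    ≡⟨ cong₂ _⊕_
         (trans (herm-+ʳ x y (q ·V u)) (cong (herm x y ⊕_) (herm-·ʳ q x u)))
         (trans (herm-·ˡ p u (y +V (q ·V u))) (cong (p ⊗_) (trans (herm-+ʳ u y (q ·V u))
           (cong₂ _⊕_ (herm-conj y u) (herm-·ʳ q u u))))) ⟩
  (herm x y ⊕ conj q ⊗ herm x u) ⊕ p ⊗ (conj (herm y u) ⊕ conj q ⊗ herm u u)
    ≡⟨ ⊕-assoc (herm x y) _ _ ⟩
  herm x y ⊕ (conj q ⊗ herm x u ⊕ p ⊗ (conj (herm y u) ⊕ conj q ⊗ herm u u))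
    ≡⟨ cong (herm x y ⊕_) (cancel c (herm u u) (herm x u) (herm y u) unitary) ⟩
  herm x y ⊕ 𝟎
    ≡⟨ ⊕-identityʳ (herm x y) ⟩
  herm x y ∎
  where
  p = c ⊗ herm x u
  q = c ⊗ herm y u
  cancel : ∀ c h ξ η → (c ⊕ conj c) ⊕ (c ⊗ conj c) ⊗ h ≡ 𝟎 →
    conj (c ⊗ η) ⊗ ξ ⊕ (c ⊗ ξ) ⊗ (conj η ⊕ conj (c ⊗ η) ⊗ h) ≡ 𝟎
  cancel = from-yes (∀F? λ c → ∀F? λ h → ∀F? λ ξ → ∀F? λ η → ((c ⊕ conj c) ⊕ (c ⊗ conj c) ⊗ h ≟ 𝟎) →-dec
    (conj (c ⊗ η) ⊗ ξ ⊕ (c ⊗ ξ) ⊗ (conj η ⊕ conj (c ⊗ η) ⊗ h) ≟ 𝟎))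

reflect-inverse : (c d : F4) (u : Vect m) → (∀ ξ → c ⊗ ξ ⊕ d ⊗ (ξ ⊕ (c ⊗ ξ) ⊗ herm u u) ≡ 𝟎) →
  ∀ x → reflect d u (reflect c u x) ≡ x
reflect-inverse c d u h x = begin
  (x +V (p ·V u)) +V ((d ⊗ herm (x +V (p ·V u)) u) ·V u)
    ≡⟨ cong (λ h → (x +V (p ·V u)) +V ((d ⊗ h) ·V u))
         (trans (herm-+ˡ x (p ·V u) u) (cong (herm x u ⊕_) (herm-·ˡ p u u))) ⟩
  (x +V (p ·V u)) +V ((d ⊗ (herm x u ⊕ p ⊗ herm u u)) ·V u)
    ≡⟨ +V-assoc x _ _ ⟩
  x +V ((p ·V u) +V ((d ⊗ (herm x u ⊕ p ⊗ herm u u)) ·V u))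
    ≡⟨ cong (x +V_) (·V-distribʳ p _ u) ⟨
  x +V ((p ⊕ d ⊗ (herm x u ⊕ p ⊗ herm u u)) ·V u)
    ≡⟨ cong (λ c → x +V (c ·V u)) (h (herm x u)) ⟩
  x +V (𝟎 ·V u)
    ≡⟨ trans (cong (x +V_) (·V-zeroˡ u)) (+V-identityʳ x) ⟩
  x ∎
  where p = c ⊗ herm x u

reflection : (c : F4) (u : Vect m) → (c ⊕ conj c) ⊕ (c ⊗ conj c) ⊗ herm u u ≡ 𝟎 → Isometry m
reflection c u unitary = record
  { to = reflect c u
  ; from = reflect (conj c) u
  ; to-+ = reflect-+ c u
  ; to-· = reflect-· c u
  ; to-herm = reflect-herm c u unitary
  ; from-to = reflect-inverse c (conj c) u λ ξ → from-yes
      (∀F? λ c → ∀F? λ h → ∀F? λ ξ → ((c ⊕ conj c) ⊕ (c ⊗ conj c) ⊗ h ≟ 𝟎) →-dec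
        (c ⊗ ξ ⊕ conj c ⊗ (ξ ⊕ (c ⊗ ξ) ⊗ h) ≟ 𝟎)) c (herm u u) ξ unitary
  ; to-from = reflect-inverse (conj c) c u λ ξ → from-yes
      (∀F? λ c → ∀F? λ h → ∀F? λ ξ → ((c ⊕ conj c) ⊕ (c ⊗ conj c) ⊗ h ≟ 𝟎) →-dec
        (conj c ⊗ ξ ⊕ c ⊗ (ξ ⊕ (conj c ⊗ ξ) ⊗ h) ≟ 𝟎)) c (herm u u) ξ unitary
  }

-- Take the direction u = a + b. As a is isotropic, herm a u = herm a b, and c is its inverse, so a
-- goes to a + u = b. The map is unitary because c has norm 𝟏 and herm u u is the trace of herm a b,
-- which equals that of c.
move-nonorthogonal : (a b : Vect m) → Isotropic a → Isotropic b → ¬ herm a b ≡ 𝟎 → ∃ λ g → to g a ≡ b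
move-nonorthogonal {m} a b aa bb ab = reflection c u unitary , (begin
  a +V ((c ⊗ herm a u) ·V u)  ≡⟨ cong (λ h → a +V ((c ⊗ h) ·V u)) au ⟩
  a +V ((c ⊗ herm a b) ·V u)  ≡⟨ cong (λ h → a +V (h ·V u)) (conj-inverse (herm a b) ab) ⟩
  a +V (𝟏 ·V (a +V b))        ≡⟨ cong (a +V_) (·V-identity (a +V b)) ⟩
  a +V (a +V b)               ≡⟨ +V-cancel a b ⟩
  b                           ∎)
  where
  u = a +V b
  c = conj (herm a b)
  au : herm a u ≡ herm a b
  au = trans (herm-+ʳ a a b) (cong (_⊕ herm a b) aa)
  uu : herm u u ≡ herm a b ⊕ conj (herm a b)
  uu = trans (herm-+ˡ a b u) (cong₂ _⊕_ au
    (trans (herm-+ʳ b a b) (trans (cong (herm b a ⊕_) bb) (trans (⊕-identityʳ (herm b a)) (herm-conj a b)))))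
  unitary : (c ⊕ conj c) ⊕ (c ⊗ conj c) ⊗ herm u u ≡ 𝟎
  unitary = trans (cong (λ h → (c ⊕ conj c) ⊕ (c ⊗ conj c) ⊗ h) uu)
    (from-yes (∀F? λ h → ¬? (h ≟ 𝟎) →-dec
      ((conj h ⊕ conj (conj h)) ⊕ (conj h ⊗ conj (conj h)) ⊗ (h ⊕ conj h) ≟ 𝟎)) (herm a b) ab)

-- An isotropic base point with e^⊥ consisting of the vectors `a ∷ a ∷ x`. Dropping the two equal
-- coordinates identifies e^⊥/e with `Vect m` and its form with `herm`; `pad` is a section of this
-- map.
e : Vect (2 + m)
e = 𝟏 ∷ 𝟏 ∷ zeroV

pad : Vect m → Vect (2 + m)
pad x = 𝟎 ∷ 𝟎 ∷ x

herm-e : (a b : F4) (x : Vect m) → herm (a ∷ b ∷ x) e ≡ a ⊕ b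
herm-e a b x = cong₂ _⊕_ (⊗-identityʳ a)
  (trans (cong₂ _⊕_ (⊗-identityʳ b) (herm-zeroʳ x)) (⊕-identityʳ b))

herm-pad : (a b : F4) (x y : Vect m) → herm (a ∷ b ∷ x) (pad y) ≡ herm x y
herm-pad a b x y = cong₂ _⊕_ (⊗-zeroʳ a) (cong (_⊕ herm x y) (⊗-zeroʳ b))

herm-diagonal : (a : F4) (x y : Vect m) (b : F4) → herm (a ∷ a ∷ x) (b ∷ b ∷ y) ≡ herm x y
herm-diagonal a x y b = trans (sym (⊕-assoc (a ⊗ conj b) (a ⊗ conj b) (herm x y)))
  (cong (_⊕ herm x y) (⊕-self (a ⊗ conj b)))

isotropic-e : Isotropic (e {m})
isotropic-e {m} = herm-e 𝟏 𝟏 (zeroV {m})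

-- A unit coordinate vector at a nonzero entry of x will do. Norm 𝟏 is asked for because it makes
-- `𝟏 ∷ 𝟎 ∷ q` isotropic.
nonzero-pairing : (x : Vect m) → NonZero x → ∃ λ q → herm q q ≡ 𝟏 × ¬ herm x q ≡ 𝟎
nonzero-pairing [] x≢0 = ⊥-elim (x≢0 refl)
nonzero-pairing {suc m} (a ∷ x) x≢0 with a ≟ 𝟎
... | no a≢𝟎 = 𝟏 ∷ zeroV , cong (𝟏 ⊕_) (herm-zeroˡ (zeroV {m})) ,
  λ eq → a≢𝟎 (trans (sym (trans (cong₂ _⊕_ (⊗-identityʳ a) (herm-zeroʳ x)) (⊕-identityʳ a))) eq)
... | yes refl with q , qq , xq ← nonzero-pairing x (x≢0 ∘ cong (𝟎 ∷_)) = 𝟎 ∷ q , qq , xq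

move-to-e : (w : Vect (2 + m)) → Isotropic w → NonZero w → ∃ λ g → to g w ≡ e
move-to-e {m} (a ∷ b ∷ x) ww w≢0 with a ⊕ b ≟ 𝟎 | a ≟ 𝟎
... | no we | _ = move-nonorthogonal _ _ ww (isotropic-e {m}) (we ∘ trans (sym (herm-e a b x)))
... | yes a+b | no a≢𝟎 with refl ← ⊕-≡𝟎 a b a+b = through (𝟏 ∷ ω ∷ zeroV)
        (cong (λ h → 𝟏 ⊕ (𝟏 ⊕ h)) (herm-zeroˡ (zeroV {m})))
        (λ eq → a≢𝟎 (lemma a (trans (cong (λ h → a ⊗ 𝟏 ⊕ (a ⊗ ω² ⊕ h)) (sym (herm-zeroʳ x))) eq)))
        (λ eq → contra (trans (sym (herm-e 𝟏 ω (zeroV {m}))) eq))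
  where
  through : (p : Vect (2 + m)) → Isotropic p → ¬ herm (a ∷ a ∷ x) p ≡ 𝟎 → ¬ herm p e ≡ 𝟎 →
    ∃ λ g → to g (a ∷ a ∷ x) ≡ e
  through p pp wp pe with g , refl ← move-nonorthogonal _ p ww pp wp
                     with h , he ← move-nonorthogonal _ e pp (isotropic-e {m}) pe = h ∘ᴵ g , he
  lemma : ∀ a → a ⊗ 𝟏 ⊕ (a ⊗ ω² ⊕ 𝟎) ≡ 𝟎 → a ≡ 𝟎
  lemma = from-yes (∀F? λ a → (a ⊗ 𝟏 ⊕ (a ⊗ ω² ⊕ 𝟎) ≟ 𝟎) →-dec (a ≟ 𝟎))
  contra : ¬ ω² ≡ 𝟎
  contra ()
... | yes a+b | yes refl with refl ← ⊕-≡𝟎 𝟎 b a+b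
      with q , qq , xq ← nonzero-pairing x (w≢0 ∘ cong (λ v → 𝟎 ∷ 𝟎 ∷ v)) = through
  where
  p = 𝟏 ∷ 𝟎 ∷ q
  contra : ¬ 𝟏 ≡ 𝟎
  contra ()
  through : ∃ λ g → to g (𝟎 ∷ 𝟎 ∷ x) ≡ e
  through with g , gw ← move-nonorthogonal (𝟎 ∷ 𝟎 ∷ x) p ww (cong (𝟏 ⊕_) qq) xq
          with h , he ← move-nonorthogonal p e (cong (𝟏 ⊕_) qq) (isotropic-e {m}) (λ eq → contra (trans (sym (herm-e 𝟏 𝟎 q)) eq))
          = h ∘ᴵ g , trans (cong (to h) gw) he

-- Totally isotropic pairs: the first vector goes to e, the second to e in the
-- remaining coordinates, up to a multiple of the first.
move-pair : (a b : Vect (4 + m)) → Isotropic a → NonZero a → Isotropic b → herm a b ≡ 𝟎 →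
  (∀ c → ¬ b ≡ c ·V a) → ∃₂ λ g s → to g a ≡ e × to g b ≡ s ∷ s ∷ e
move-pair {m} a b aa a≢0 bb ab b∉a with g , ga ← move-to-e a aa a≢0 = second (to g b) refl
  where
  second : ∀ v → to g b ≡ v → ∃₂ λ g s → to g a ≡ e × to g b ≡ s ∷ s ∷ e
  second (s ∷ t ∷ y) gb with refl ← ⊕-≡𝟎 s t (trans (sym (herm-e s t y)) (trans (cong₂ herm (sym gb) (sym ga))
    (trans (to-herm g b a) (⊥-sym a b ab)))) = extend (proj₁ h) ∘ᴵ g , s ,
      trans (cong (to (extend (proj₁ h))) ga) (cong (λ v → 𝟏 ∷ 𝟏 ∷ v) (to-zero (proj₁ h))) ,
      trans (cong (to (extend (proj₁ h))) gb) (cong (λ v → s ∷ s ∷ v) (proj₂ h))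
    where
    yy : Isotropic y
    yy = trans (sym (herm-diagonal s y y s)) (trans (cong₂ herm (sym gb) (sym gb)) (trans (to-herm g b b) bb))
    y≢0 : NonZero y
    y≢0 refl = b∉a s (begin
      b                ≡⟨ from-to g b ⟨
      from g (to g b)  ≡⟨ cong (from g) gb ⟩
      from g (s ∷ s ∷ zeroV)
        ≡⟨ cong (from g) (cong₂ (λ c v → c ∷ c ∷ v) (⊗-identityʳ s) (·V-zeroʳ s)) ⟨
      from g (s ·V e)  ≡⟨ cong (λ v → from g (s ·V v)) ga ⟨
      from g (s ·V to g a) ≡⟨ cong (from g) (to-· g s a) ⟨
      from g (to g (s ·V a)) ≡⟨ from-to g (s ·V a) ⟩
      s ·V a           ∎)
    h = move-to-e y yy y≢0

-- Generators and ovoids under isometries and quotients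

GeneratorBasis : Vec (Vect m) k → Set
GeneratorBasis bs = LinIndep bs × TotallyIsotropic bs

lincomb-map : (g : Isometry m) (c : Vec F4 k) (bs : Vec (Vect m) k) →
  lincomb c (map (to g) bs) ≡ to g (lincomb c bs)
lincomb-map g [] [] = sym (to-zero g)
lincomb-map g (c ∷ cs) (b ∷ bs) = trans
  (cong₂ _+V_ (sym (to-· g c b)) (lincomb-map g cs bs)) (sym (to-+ g (c ·V b) (lincomb cs bs)))

generator-map : (g : Isometry m) (bs : Vec (Vect m) k) → GeneratorBasis bs → GeneratorBasis (map (to g) bs)
generator-map g bs (li , ti) =
  (λ c eq → li c (trans (sym (from-to g _)) (trans (cong (from g) (trans (sym (lincomb-map g c bs)) eq)) (from-zero g)))) ,
  (λ i j → trans (cong₂ herm (lookup-map i (to g) bs) (lookup-map j (to g) bs)) (trans (to-herm g _ _) (ti i j)))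

-- A basis of the preimage in e^⊥ of a subspace of e^⊥/e.
cone : Vec (Vect m) k → Vec (Vect (2 + m)) (suc k)
cone bs = e ∷ map pad bs

lincomb-pad : (c : Vec F4 k) (bs : Vec (Vect m) k) → lincomb c (map pad bs) ≡ pad (lincomb c bs)
lincomb-pad [] [] = refl
lincomb-pad (c ∷ cs) (b ∷ bs) = trans (cong ((c ·V pad b) +V_) (lincomb-pad cs bs))
  (cong₂ (λ s t → s ∷ t ∷ ((c ·V b) +V lincomb cs bs)) (trans (⊕-identityʳ (c ⊗ 𝟎)) (⊗-zeroʳ c)) (trans (⊕-identityʳ (c ⊗ 𝟎)) (⊗-zeroʳ c)))

lincomb-cone : (c₀ : F4) (c : Vec F4 k) (bs : Vec (Vect m) k) → lincomb (c₀ ∷ c) (cone bs) ≡ c₀ ∷ c₀ ∷ lincomb c bs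
lincomb-cone c₀ c bs = trans (cong ((c₀ ·V e) +V_) (lincomb-pad c bs))
  (cong₂ (λ s v → s ∷ s ∷ v) (trans (⊕-identityʳ (c₀ ⊗ 𝟏)) (⊗-identityʳ c₀))
    (trans (cong (_+V lincomb c bs) (·V-zeroʳ c₀)) (+V-identityˡ _)))

generator-cone : (bs : Vec (Vect m) k) → GeneratorBasis bs → GeneratorBasis (cone bs)
generator-cone {m} {k} bs (li , ti) = independent , isotropic
  where
  independent : LinIndep (cone bs)
  independent (c₀ ∷ c) eq with refl ← trans (sym (cong head (lincomb-cone c₀ c bs))) (cong head eq) =
    cong (𝟎 ∷_) (li c (cong (λ v → tail (tail v)) (trans (sym (lincomb-cone 𝟎 c bs)) eq)))
  e-pad : ∀ x → herm e (pad x) ≡ 𝟎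
  e-pad x = trans (herm-pad 𝟏 𝟏 zeroV x) (herm-zeroˡ x)
  isotropic : TotallyIsotropic (cone bs)
  isotropic zero zero = isotropic-e {m}
  isotropic zero (suc j) = trans (cong (herm e) (lookup-map j pad bs)) (e-pad (lookup bs j))
  isotropic (suc i) zero = ⊥-sym e (lookup (map pad bs) i) (trans (cong (herm e) (lookup-map i pad bs)) (e-pad (lookup bs i)))
  isotropic (suc i) (suc j) = trans (cong₂ herm (lookup-map i pad bs) (lookup-map j pad bs)) (ti i j)

double : ℕ → ℕ
double zero = zero
double (suc n) = 2 + double n

2*≡double : ∀ n → 2 * n ≡ double n
2*≡double zero = refl
2*≡double (suc n) = cong suc (trans (+-suc n (n + 0)) (cong suc (2*≡double n)))

standard : ∀ n → Vec (Vect (double n)) n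
standard zero = []
standard (suc n) = cone (standard n)

generator-standard : ∀ n → GeneratorBasis (standard n)
generator-standard zero = (λ { [] _ → refl }) , λ ()
generator-standard (suc n) = generator-cone (standard n) (generator-standard n)

-- IsOvoid n is definitionally Ovoid n (2 * n); separating the rank from the
-- dimension allows to transport along 2 * n ≡ double n.
Ovoid : (k m : ℕ) → Pred (Vect m) 0ℓ → Set
Ovoid k m O =
  ((v : Vect m) → O v → IsIsotropicPoint v) ×
  ((bs : Vec (Vect m) k) → GeneratorBasis bs →
     (Σ (Vec F4 k) λ c → O (lincomb c bs)) ×
     ((c c′ : Vec F4 k) → O (lincomb c bs) → O (lincomb c′ bs) → SamePoint (lincomb c bs) (lincomb c′ bs)))

lincomb-zero : (bs : Vec (Vect m) k) → lincomb zeroV bs ≡ zeroV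
lincomb-zero [] = refl
lincomb-zero (b ∷ bs) = trans (cong₂ _+V_ (·V-zeroˡ b) (lincomb-zero bs)) (+V-identityˡ zeroV)

_≟V_ : (x y : Vect m) → Dec (x ≡ y)
_≟V_ = ≡-dec _≟_

lincomb-first : ∀ n → lincomb (𝟏 ∷ zeroV) (standard (suc n)) ≡ e
lincomb-first n = trans (lincomb-cone 𝟏 zeroV (standard n)) (cong (λ v → 𝟏 ∷ 𝟏 ∷ v) (lincomb-zero (standard n)))

-- Orthogonal points span a totally isotropic line, which lies in a generator.
ovoid-orthogonal : {O : Pred (Vect (double (2 + n))) 0ℓ} → Ovoid (2 + n) (double (2 + n)) O →
  ∀ u v → O u → O v → herm u v ≡ 𝟎 → SamePoint u v
ovoid-orthogonal {n} {O} (iso , gen) u v Ou Ov uv with iso u Ou | iso v Ov | ∃F? (λ c → u ≟V (c ·V v))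
... | u≢0 , uu | v≢0 , vv | yes (c , u≡cv) =
  c , (λ c≡𝟎 → u≢0 (trans u≡cv (trans (cong (_·V v) c≡𝟎) (·V-zeroˡ v)))) , u≡cv
... | u≢0 , uu | v≢0 , vv | no u∉v with g , s , gv , gu ← move-pair v u vv v≢0 uu (⊥-sym u v uv) (λ c eq → u∉v (c , eq))
  = conclude (s ∷ 𝟏 ∷ zeroV) (𝟏 ∷ zeroV)
      (span (s ∷ 𝟏 ∷ zeroV) gu (trans (lincomb-cone s (𝟏 ∷ zeroV) (standard (suc n))) (cong (λ v → s ∷ s ∷ v) (lincomb-first n))))
      (span (𝟏 ∷ zeroV) gv (lincomb-first (suc n)))
  where
  bs = map (from g) (standard (2 + n))
  span : ∀ {w x} c → to g w ≡ x → lincomb c (standard (2 + n)) ≡ x → lincomb c bs ≡ w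
  span {w} {x} c gw eq = trans (lincomb-map (inverse g) c (standard (2 + n)))
    (trans (cong (from g) (trans eq (sym gw))) (from-to g w))
  conclude : ∀ c d → lincomb c bs ≡ u → lincomb d bs ≡ v → SamePoint u v
  conclude c d refl refl =
    proj₂ (gen bs (generator-map (inverse g) (standard (2 + n)) (generator-standard (2 + n)))) c d Ou Ov

ovoid-map : {O : Pred (Vect m) 0ℓ} (g : Isometry m) → Ovoid k m O → Ovoid k m (O ∘ from g)
ovoid-map {O = O} g (iso , gen) =
  (λ v Ov → let v≢0 , vv = iso (from g v) Ov in
    (λ v≡0 → v≢0 (trans (cong (from g) v≡0) (from-zero g))) , trans (sym (from-herm g v v)) vv) ,
  λ bs basis → let (c , Oc) , unique = gen (map (from g) bs) (generator-map (inverse g) bs basis)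
                   pull = λ c → lincomb-map (inverse g) c bs in
    (c , subst O (pull c) Oc) ,
    λ c c′ Oc Oc′ → let d , d≢𝟎 , eq = unique c c′ (subst O (sym (pull c)) Oc) (subst O (sym (pull c′)) Oc′) in
      d , d≢𝟎 , (begin
        lincomb c bs                          ≡⟨ to-from g _ ⟨
        to g (from g (lincomb c bs))          ≡⟨ cong (to g) (trans (sym (pull c)) (trans eq (cong (d ·V_) (pull c′)))) ⟩
        to g (d ·V from g (lincomb c′ bs))    ≡⟨ to-· g d _ ⟩
        d ·V to g (from g (lincomb c′ bs))    ≡⟨ cong (d ·V_) (to-from g _) ⟩
        d ·V lincomb c′ bs                    ∎)

-- If e is not a point of O, then O ∩ e^⊥ projects to an ovoid of e^⊥/e.
ovoid-quotient : {O : Pred (Vect (2 + m)) 0ℓ} → Ovoid (suc k) (2 + m) O → (∀ s → ¬ O (s ∷ s ∷ zeroV)) →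
  Ovoid k m (λ v → ∃ λ s → O (s ∷ s ∷ v))
ovoid-quotient {O = O} (iso , gen) e∉O =
  (λ { v (s , Ov) → (λ { refl → e∉O s Ov }) , trans (sym (herm-diagonal s v v s)) (proj₂ (iso _ Ov)) }) ,
  λ bs basis → let (c , Oc) , unique = gen (cone bs) (generator-cone bs basis) in
    point c bs Oc ,
    λ { c c′ (s , Os) (s′ , Os′) → project s s′ (subst₂ SamePoint (lincomb-cone s c bs) (lincomb-cone s′ c′ bs)
          (unique (s ∷ c) (s′ ∷ c′) (subst O (sym (lincomb-cone s c bs)) Os) (subst O (sym (lincomb-cone s′ c′ bs)) Os′))) }
  where
  point : ∀ {k} (c : Vec F4 (suc k)) (bs : Vec (Vect _) k) → O (lincomb c (cone bs)) →
    Σ (Vec F4 k) λ c → ∃ λ s → O (s ∷ s ∷ lincomb c bs)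
  point (s ∷ c) bs Oc = c , s , subst O (lincomb-cone s c bs) Oc
  project : ∀ s s′ {v v′} → SamePoint (s ∷ s ∷ v) (s′ ∷ s′ ∷ v′) → SamePoint v v′
  project s s′ (d , d≢𝟎 , eq) = d , d≢𝟎 , ∷-injectiveʳ (∷-injectiveʳ eq)

NoOvoid : ℕ → Set₁
NoOvoid n = (O : Pred (Vect (double n)) 0ℓ) → ¬ Ovoid n (double n) O

-- The points e and `pad e` are distinct and orthogonal, so they are not both in O, and the quotient
-- at one that is not in O is an ovoid of smaller rank. Which one cannot be decided; instead the
-- quotient at e is refuted, which leaves e in O, and then the quotient at `pad e`, moved to e, is
-- refuted as well.
no-ovoid-step : NoOvoid (suc n) → NoOvoid (2 + n)
no-ovoid-step {n} none O ov = none _ (ovoid-quotient ov λ s Oe →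
  let g , gp = move-to-e {m = double (suc n)} (pad e) (isotropic-e {double n}) (λ ()) in
  none _ (ovoid-quotient (ovoid-map g ov) λ t Op →
    orthogonal s t Oe (subst O (trans (cong (from g)
      (trans (cong₂ (λ c v → c ∷ c ∷ v) (sym (⊗-identityʳ t)) (sym (·V-zeroʳ t))) (cong (t ·V_) (sym gp))))
      (trans (from-· g t _) (cong (t ·V_) (from-to g (pad e))))) Op)))
  where
  orthogonal : ∀ s t → O (s ∷ s ∷ zeroV) → O (t ·V pad e) → ⊥
  orthogonal s t Oe Op with ovoid-orthogonal {n = n} ov _ _ Oe Op
      (⊥-·ʳ t (s ∷ s ∷ zeroV {double (suc n)}) (pad e) (trans (herm-pad s s (zeroV {double (suc n)}) e) (herm-zeroˡ (e {double n}))))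
  ... | c , c≢𝟎 , eq = proj₁ (proj₁ ov _ Oe) (cong₂ (λ a b → a ∷ b ∷ zeroV)
      (trans (∷-injectiveˡ eq) (trans (cong (c ⊗_) (⊗-zeroʳ t)) (⊗-zeroʳ c)))
      (trans (∷-injectiveˡ (∷-injectiveʳ eq)) (trans (cong (c ⊗_) (⊗-zeroʳ t)) (⊗-zeroʳ c))))

no-ovoid-from-3 : NoOvoid 3 → ∀ n → NoOvoid (3 + n)
no-ovoid-from-3 base zero = base
no-ovoid-from-3 base (suc n) = no-ovoid-step (no-ovoid-from-3 base n)

-- Counting the points of an ovoid of H(5,4)

is𝟎 : F4 → Bool
is𝟎 x = not (nrm x)

is𝟎-true : ∀ x → is𝟎 x ≡ true → x ≡ 𝟎
is𝟎-true 𝟎 _ = refl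

bit : Bool → ℕ
bit true = 1
bit false = 0

∑ : (Elt → ℕ) → List Elt → ℕ
∑ F [] = 0
∑ F (x ∷ xs) = F x + ∑ F xs

∑-cong : {F G : Elt → ℕ} (xs : List Elt) → (∀ {x} → x ∈ xs → F x ≡ G x) → ∑ F xs ≡ ∑ G xs
∑-cong [] _ = refl
∑-cong (x ∷ xs) h = cong₂ _+_ (h (here refl)) (∑-cong xs (h ∘ there))

∑-+ : (F G : Elt → ℕ) (xs : List Elt) → ∑ (λ x → F x + G x) xs ≡ ∑ F xs + ∑ G xs
∑-+ F G [] = refl
∑-+ F G (x ∷ xs) = trans (cong (F x + G x +_) (∑-+ F G xs))
  (ℕ-Solver.solve 4 (λ a b c d → (a ℕ-Solver.:+ b) ℕ-Solver.:+ (c ℕ-Solver.:+ d) ℕ-Solver.:= (a ℕ-Solver.:+ c) ℕ-Solver.:+ (b ℕ-Solver.:+ d)) refl (F x) (G x) (∑ F xs) (∑ G xs))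

∑-* : (k : ℕ) (F : Elt → ℕ) (xs : List Elt) → ∑ (λ x → k * F x) xs ≡ k * ∑ F xs
∑-* k F [] = ℕ-Solver.solve 1 (λ k → ℕ-Solver.con 0 ℕ-Solver.:= k ℕ-Solver.:* ℕ-Solver.con 0) refl k
∑-* k F (x ∷ xs) = trans (cong (k * F x +_) (∑-* k F xs)) (sym (*-distribˡ-+ k (F x) (∑ F xs)))

∑-zero : {F : Elt → ℕ} (xs : List Elt) → (∀ {x} → x ∈ xs → F x ≡ 0) → ∑ F xs ≡ 0
∑-zero [] _ = refl
∑-zero (x ∷ xs) h = cong₂ _+_ (h (here refl)) (∑-zero xs (h ∘ there))

∑-one : (xs : List Elt) → ∑ (λ _ → 1) xs ≡ length xs
∑-one [] = refl
∑-one (x ∷ xs) = cong suc (∑-one xs)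

perp : Vect m → Vect m → Bool
perp u v = is𝟎 (herm u v)

perp-true : (u v : Vect m) → perp u v ≡ true → herm u v ≡ 𝟎
perp-true u v = is𝟎-true (herm u v)

⊥⇒perp : (u v : Vect m) → herm u v ≡ 𝟎 → perp u v ≡ true
⊥⇒perp u v = cong is𝟎

⊥⇒¬Apart : (u v : Vect m) → herm u v ≡ 𝟎 → ¬ Apart u v
⊥⇒¬Apart u v uv ap with () ← trans (sym (cong nrm uv)) ap

∑-single : (F : Vect m → ℕ) (l : List (Vect m)) → LPairs.AllPairs Apart l → ∀ {v} → v ∈ l →
  (∀ {u} → u ∈ l → Apart u v → F u ≡ 0) → ∑ F l ≡ F v
∑-single F (v ∷ l) (ap ∷ _) (here refl) h = trans
  (cong (F v +_) (∑-zero l λ u∈l → h (there u∈l) (Apart-sym v _ (LAll.lookup ap u∈l)))) (+-identityʳ (F v))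
∑-single F (u ∷ l) (ap ∷ aps) (there v∈l) h =
  cong₂ _+_ (h (here refl) (LAll.lookup ap v∈l)) (∑-single F l aps v∈l (h ∘ there))

apart-unique : (l : List (Vect m)) → LPairs.AllPairs Apart l → ∀ {u v} → u ∈ l → v ∈ l → herm u v ≡ 𝟎 → u ≡ v
apart-unique (_ ∷ _) _ (here refl) (here refl) _ = refl
apart-unique (u ∷ l) (ap ∷ _) (here refl) (there v∈l) uv = ⊥-elim (⊥⇒¬Apart u _ uv (LAll.lookup ap v∈l))
apart-unique (v ∷ l) (ap ∷ _) (there u∈l) (here refl) uv = ⊥-elim (⊥⇒¬Apart v _ (⊥-sym _ v uv) (LAll.lookup ap u∈l))
apart-unique (_ ∷ l) (_ ∷ aps) (there u∈l) (there v∈l) uv = apart-unique l aps u∈l v∈l uv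

herm-twin : (a b : F4) (x : Vect m) (s : F4) (y : Vect m) →
  herm (a ∷ b ∷ x) (s ∷ s ∷ y) ≡ (a ⊕ b) ⊗ conj s ⊕ herm x y
herm-twin a b x s y = trans (sym (⊕-assoc (a ⊗ conj s) (b ⊗ conj s) (herm x y)))
  (cong (_⊕ herm x y) (sym (⊗-distribʳ-⊕ (conj s) a b)))

-- e, pad e and pad (pad (𝟏 ∷ c ∷ [])) span a generator of H(5,4) for c ≢ 𝟎.
inGenerator : F4 → Vect 6 → Bool
inGenerator c (x₀ ∷ x₁ ∷ x₂ ∷ x₃ ∷ x₄ ∷ x₅ ∷ []) =
  is𝟎 (x₀ ⊕ x₁) ∧ (is𝟎 (x₂ ⊕ x₃) ∧ is𝟎 (x₄ ⊕ x₅ ⊗ conj c))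

∧-true : ∀ a b → a ∧ b ≡ true → a ≡ true × b ≡ true
∧-true true true _ = refl , refl

generator-isotropic : ∀ c → ¬ c ≡ 𝟎 → (x y : Vect 6) → inGenerator c x ≡ true → inGenerator c y ≡ true → herm x y ≡ 𝟎
generator-isotropic c c≢𝟎 (x₀ ∷ x₁ ∷ x₂ ∷ x₃ ∷ x₄ ∷ x₅ ∷ []) (y₀ ∷ y₁ ∷ y₂ ∷ y₃ ∷ y₄ ∷ y₅ ∷ []) gx gy
  with x01 , gx′ ← ∧-true _ _ gx | y01 , gy′ ← ∧-true _ _ gy
  with x23 , x45 ← ∧-true _ _ gx′ | y23 , y45 ← ∧-true _ _ gy′
  with refl ← ⊕-≡𝟎 x₀ x₁ (is𝟎-true _ x01) | refl ← ⊕-≡𝟎 y₀ y₁ (is𝟎-true _ y01)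
     | refl ← ⊕-≡𝟎 x₂ x₃ (is𝟎-true _ x23) | refl ← ⊕-≡𝟎 y₂ y₃ (is𝟎-true _ y23)
     | refl ← ⊕-≡𝟎 x₄ (x₅ ⊗ conj c) (is𝟎-true _ x45) | refl ← ⊕-≡𝟎 y₄ (y₅ ⊗ conj c) (is𝟎-true _ y45) =
  trans (herm-diagonal x₀ (x₂ ∷ x₂ ∷ x₅ ⊗ conj c ∷ x₅ ∷ []) (y₂ ∷ y₂ ∷ y₅ ⊗ conj c ∷ y₅ ∷ []) y₀) (trans (herm-diagonal x₂ (x₅ ⊗ conj c ∷ x₅ ∷ []) (y₅ ⊗ conj c ∷ y₅ ∷ []) y₂)
    (from-yes (∀F? λ c → ∀F? λ x → ∀F? λ y → ¬? (c ≟ 𝟎) →-dec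
      ((x ⊗ conj c) ⊗ conj (y ⊗ conj c) ⊕ (x ⊗ conj y ⊕ 𝟎) ≟ 𝟎)) c x₅ y₅ c≢𝟎))

-- One vector for each point of an ovoid of H(5,4). Every generator is the preimage
-- of a standard one under an isometry, so meets quantifies over isometries.
record OvoidList (l : List (Vect 6)) : Set where
  field
    isotropic : ∀ {v} → v ∈ l → Isotropic v
    nonzero   : ∀ {v} → v ∈ l → NonZero v
    apart     : LPairs.AllPairs Apart l
    meets     : ∀ (g : Isometry 6) c → ¬ c ≡ 𝟎 → ∃ λ v → v ∈ l × inGenerator c (to g v) ≡ true

module Counting {l : List (Vect 6)} (ovoid : OvoidList l) where
  open OvoidList ovoid

  unique : ∀ {u v} → u ∈ l → v ∈ l → herm u v ≡ 𝟎 → u ≡ v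
  unique = apart-unique l apart

  generator-count : (g : Isometry 6) (c : F4) → ¬ c ≡ 𝟎 → ∑ (λ v → bit (inGenerator c (to g v))) l ≡ 1
  generator-count g c c≢𝟎 with v , v∈l , gv ← meets g c c≢𝟎 =
    trans (∑-single _ l apart v∈l λ {u} _ uv → outside u uv _ refl) (cong bit gv)
    where
    outside : ∀ u → Apart u v → ∀ b → inGenerator c (to g u) ≡ b → bit (inGenerator c (to g u)) ≡ 0
    outside u uv false eq = cong bit eq
    outside u uv true eq = ⊥-elim (⊥⇒¬Apart u v
      (trans (sym (to-herm g u v)) (generator-isotropic c c≢𝟎 (to g u) (to g v) eq gv)) uv)

  -- A totally isotropic line lies in exactly three generators.
  line-count : (a b : Vect 6) → Isotropic a → NonZero a → Isotropic b → herm a b ≡ 𝟎 → (∀ c → ¬ b ≡ c ·V a) →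
    (∀ {v} → v ∈ l → ∀ α β → ¬ v ≡ (α ·V a) +V (β ·V b)) → ∑ (λ v → bit (perp v a ∧ perp v b)) l ≡ 3
  line-count a b aa a≢0 bb ab b∉a missed with g , s , ga , gb ← move-pair a b aa a≢0 bb ab b∉a = begin
    ∑ (λ v → bit (perp v a ∧ perp v b)) l
      ≡⟨ ∑-cong l (λ v∈l → split v∈l _ refl) ⟩
    ∑ (λ v → G 𝟏 v + (G ω v + G ω² v)) l
      ≡⟨ trans (∑-+ (G 𝟏) _ l) (cong (∑ (G 𝟏) l +_) (∑-+ (G ω) (G ω²) l)) ⟩
    ∑ (G 𝟏) l + (∑ (G ω) l + ∑ (G ω²) l)
      ≡⟨ cong₂ _+_ (generator-count g 𝟏 λ ()) (cong₂ _+_ (generator-count g ω λ ()) (generator-count g ω² λ ())) ⟩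
    3 ∎
    where
    G : F4 → Vect 6 → ℕ
    G c v = bit (inGenerator c (to g v))
    F : F4 → F4 → F4 → F4 → F4 → ℕ
    F c p q x y = bit (is𝟎 p ∧ (is𝟎 q ∧ is𝟎 (x ⊕ y ⊗ conj c)))
    -- For a vector orthogonal to the line, (x , y) is its image in a hyperbolic plane. Being
    -- isotropic and nonzero, it is a multiple of (𝟏 , c) for exactly one c ≢ 𝟎, so the vector is
    -- counted in exactly one of the three generators.
    pointwise : ∀ p q s x y → (p ≡ 𝟎 → q ≡ 𝟎 → ¬ (x ≡ 𝟎 × y ≡ 𝟎) × x ⊗ conj x ⊕ (y ⊗ conj y ⊕ 𝟎) ≡ 𝟎) →
      bit (is𝟎 p ∧ is𝟎 (p ⊗ conj s ⊕ q)) ≡ F 𝟏 p q x y + (F ω p q x y + F ω² p q x y)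
    pointwise 𝟎 𝟎 s x y h with x≢0 , xx ← h refl refl = from-yes
      (∀F? λ x → ∀F? λ y → ¬? ((x ≟ 𝟎) ×-dec (y ≟ 𝟎)) →-dec (x ⊗ conj x ⊕ (y ⊗ conj y ⊕ 𝟎) ≟ 𝟎) →-dec
        (1 ≟ℕ F 𝟏 𝟎 𝟎 x y + (F ω 𝟎 𝟎 x y + F ω² 𝟎 𝟎 x y))) x y x≢0 xx
    pointwise 𝟎 𝟏 s x y h = refl
    pointwise 𝟎 ω s x y h = refl
    pointwise 𝟎 ω² s x y h = refl
    pointwise 𝟏 q s x y h = refl
    pointwise ω q s x y h = refl
    pointwise ω² q s x y h = refl
    split : ∀ {v} → v ∈ l → ∀ x → to g v ≡ x →
      bit (perp v a ∧ perp v b) ≡ G 𝟏 v + (G ω v + G ω² v)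
    split {v} v∈l x@(x₀ ∷ x₁ ∷ x₂ ∷ x₃ ∷ x₄ ∷ x₅ ∷ []) gv = begin
      bit (perp v a ∧ perp v b)
        ≡⟨ cong₂ (λ p q → bit (is𝟎 p ∧ is𝟎 q)) va vb ⟩
      bit (is𝟎 (x₀ ⊕ x₁) ∧ is𝟎 ((x₀ ⊕ x₁) ⊗ conj s ⊕ (x₂ ⊕ x₃)))
        ≡⟨ pointwise (x₀ ⊕ x₁) (x₂ ⊕ x₃) s x₄ x₅ on-line ⟩
      bit (inGenerator 𝟏 x) + (bit (inGenerator ω x) + bit (inGenerator ω² x))
        ≡⟨ cong (λ x → bit (inGenerator 𝟏 x) + (bit (inGenerator ω x) + bit (inGenerator ω² x))) gv ⟨
      G 𝟏 v + (G ω v + G ω² v) ∎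
      where
      transport : ∀ {w y} → to g w ≡ y → herm v w ≡ herm x y
      transport gw = trans (sym (to-herm g v _)) (cong₂ herm gv gw)
      va : herm v a ≡ x₀ ⊕ x₁
      va = trans (transport ga) (herm-e x₀ x₁ (x₂ ∷ x₃ ∷ x₄ ∷ x₅ ∷ []))
      vb : herm v b ≡ (x₀ ⊕ x₁) ⊗ conj s ⊕ (x₂ ⊕ x₃)
      vb = trans (transport gb) (trans (herm-twin x₀ x₁ (x₂ ∷ x₃ ∷ x₄ ∷ x₅ ∷ []) s e)
        (cong ((x₀ ⊕ x₁) ⊗ conj s ⊕_) (herm-e x₂ x₃ (x₄ ∷ x₅ ∷ []))))
      on-line : x₀ ⊕ x₁ ≡ 𝟎 → x₂ ⊕ x₃ ≡ 𝟎 → ¬ (x₄ ≡ 𝟎 × x₅ ≡ 𝟎) × x₄ ⊗ conj x₄ ⊕ (x₅ ⊗ conj x₅ ⊕ 𝟎) ≡ 𝟎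
      on-line x01 x23 with refl ← ⊕-≡𝟎 x₀ x₁ x01 | refl ← ⊕-≡𝟎 x₂ x₃ x23 =
        -- Vanishing last coordinates would put v on the line. The coefficient of a is corrected by
        -- `x₂ ⊗ s`, because the image of b is `s ∷ s ∷ e` and not `pad e`.
        (λ { (refl , refl) → missed v∈l (x₀ ⊕ x₂ ⊗ s) x₂ (begin
          v                                    ≡⟨ from-to g v ⟨
          from g (to g v)                      ≡⟨ cong (from g) gv ⟩
          from g x                             ≡⟨ cong (from g) (coordinates x₀ x₂ s) ⟩
          from g (((x₀ ⊕ x₂ ⊗ s) ·V e) +V (x₂ ·V (s ∷ s ∷ e)))
            ≡⟨ cong₂ (λ a b → from g (((x₀ ⊕ x₂ ⊗ s) ·V a) +V (x₂ ·V b))) ga gb ⟨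
          from g (((x₀ ⊕ x₂ ⊗ s) ·V to g a) +V (x₂ ·V to g b))
            ≡⟨ cong₂ (λ a b → from g (a +V b)) (to-· g (x₀ ⊕ x₂ ⊗ s) a) (to-· g x₂ b) ⟨
          from g (to g ((x₀ ⊕ x₂ ⊗ s) ·V a) +V to g (x₂ ·V b))
            ≡⟨ cong (from g) (to-+ g _ _) ⟨
          from g (to g (((x₀ ⊕ x₂ ⊗ s) ·V a) +V (x₂ ·V b)))
            ≡⟨ from-to g _ ⟩
          ((x₀ ⊕ x₂ ⊗ s) ·V a) +V (x₂ ·V b) ∎) }) ,
        trans (sym (trans (herm-diagonal x₀ (x₂ ∷ x₂ ∷ x₄ ∷ x₅ ∷ []) (x₂ ∷ x₂ ∷ x₄ ∷ x₅ ∷ []) x₀) (herm-diagonal x₂ (x₄ ∷ x₅ ∷ []) (x₄ ∷ x₅ ∷ []) x₂)))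
          (trans (cong₂ herm (sym gv) (sym gv)) (trans (to-herm g v v) (isotropic v∈l)))
        where
        coordinates : ∀ x₀ x₂ s → (x₀ ∷ x₀ ∷ x₂ ∷ x₂ ∷ 𝟎 ∷ 𝟎 ∷ []) ≡ ((x₀ ⊕ x₂ ⊗ s) ·V e) +V (x₂ ·V (s ∷ s ∷ e))
        coordinates = from-yes (∀F? λ x₀ → ∀F? λ x₂ → ∀F? λ s →
          (x₀ ∷ x₀ ∷ x₂ ∷ x₂ ∷ 𝟎 ∷ 𝟎 ∷ []) ≟V (((x₀ ⊕ x₂ ⊗ s) ·V e) +V (x₂ ·V (s ∷ s ∷ e))))

  degree : Vect 6 → ℕ
  degree w = ∑ (λ v → bit (perp v w)) l

  Missed : Vect 6 → Set
  Missed w = ∀ {v} → v ∈ l → ∀ c → ¬ v ≡ c ·V w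

  record MissedLine (a b : Vect 6) : Set where
    field
      b-isotropic : Isotropic b
      orthogonal  : herm a b ≡ 𝟎
      independent : ∀ c → ¬ b ≡ c ·V a
      missed      : ∀ {v} → v ∈ l → ∀ α β → ¬ v ≡ (α ·V a) +V (β ·V b)

  -- A generator through the missed point w contains one point p of the ovoid;
  -- the four lines of it through w that avoid p are missed.
  module MissedPoint (w : Vect 6) (ww : Isotropic w) (w≢0 : NonZero w) (w∉l : Missed w) where
    neighbour : ∃ λ p → p ∈ l × herm p w ≡ 𝟎
    neighbour with g , gw ← move-to-e w ww w≢0 with p , p∈l , gp ← meets g 𝟏 (λ ()) = p , p∈l ,
      trans (sym (to-herm g p w)) (trans (cong (herm (to g p)) gw) (orth (to g p) gp))
      where
      orth : ∀ x → inGenerator 𝟏 x ≡ true → herm x e ≡ 𝟎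
      orth (x₀ ∷ x₁ ∷ x₂ ∷ x₃ ∷ x₄ ∷ x₅ ∷ []) gx = trans (herm-e x₀ x₁ (x₂ ∷ x₃ ∷ x₄ ∷ x₅ ∷ [])) (is𝟎-true _ (proj₁ (∧-true _ _ gx)))

    p : Vect 6
    p = proj₁ neighbour
    p∈l : p ∈ l
    p∈l = proj₁ (proj₂ neighbour)

    private
      moved : ∃₂ λ g s → to g w ≡ e × to g p ≡ s ∷ s ∷ e
      moved = move-pair w p ww w≢0 (isotropic p∈l) (⊥-sym p w (proj₂ (proj₂ neighbour))) (w∉l p∈l)
      g : Isometry 6
      g = proj₁ moved
      s : F4
      s = proj₁ (proj₂ moved)
      gw : to g w ≡ e
      gw = proj₁ (proj₂ (proj₂ moved))
      gp : to g p ≡ s ∷ s ∷ e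
      gp = proj₂ (proj₂ (proj₂ moved))

    -- Within the generator spanned by e, `pad e` and `pad (pad e)`, modulo e, these are the four
    -- points of a projective line other than `pad e`, and `pad e` is the image of p.
    direction : F4 → Vect 6
    direction β = pad (β ∷ β ∷ e)

    second : F4 → Vect 6
    second β = from g (direction β)

    missed-line : ∀ β → MissedLine w (second β)
    missed-line β = record
      { b-isotropic = trans (from-herm g (direction β) (direction β)) (herm-diagonal β (e {0}) (e {0}) β)
      ; orthogonal = trans (sym (herm-adjoint g w _)) (trans (cong (λ w → herm w (direction β)) gw)
          (trans (herm-pad 𝟏 𝟏 zeroV (β ∷ β ∷ e {0})) (herm-zeroˡ (β ∷ β ∷ e {0}))))
      ; independent = λ c eq → contra₁ c (cong fifth (trans (sym (to-from g (direction β)))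
          (trans (cong (to g) eq) (trans (to-· g c w) (cong (c ·V_) gw)))))
      ; missed = λ {v} v∈l α γ eq → contra₂ α β γ (coordinates v∈l α γ eq)
      }
      where
      fifth : Vect 6 → F4
      fifth (_ ∷ _ ∷ _ ∷ _ ∷ x ∷ _) = x
      contra₁ : ∀ c → ¬ 𝟏 ≡ c ⊗ 𝟎
      contra₁ = from-yes (∀F? λ c → ¬? (𝟏 ≟ c ⊗ 𝟎))
      contra₂ : ∀ α β γ → ¬ (s ∷ s ∷ e) ≡ (α ·V e) +V (γ ·V direction β)
      contra₂ α β γ eq = from-yes (∀F? λ α → ∀F? λ β → ∀F? λ γ →
          (𝟎 ≟ α ⊗ 𝟎 ⊕ γ ⊗ 𝟏) →-dec ¬? (𝟏 ≟ α ⊗ 𝟎 ⊕ γ ⊗ β)) α β γ (cong fifth eq) (cong third eq)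
        where
        third : Vect 6 → F4
        third (_ ∷ _ ∷ x ∷ _) = x
      coordinates : ∀ {v} → v ∈ l → ∀ α γ → v ≡ (α ·V w) +V (γ ·V second β) →
        (s ∷ s ∷ e) ≡ (α ·V e) +V (γ ·V direction β)
      coordinates {v} v∈l α γ eq = begin
        s ∷ s ∷ e                       ≡⟨ gp ⟨
        to g p                          ≡⟨ cong (to g) (unique v∈l p∈l vp) ⟨
        to g v                          ≡⟨ gv ⟩
        (α ·V e) +V (γ ·V direction β)  ∎
        where
        gv : to g v ≡ (α ·V e) +V (γ ·V direction β)
        gv = trans (cong (to g) eq) (trans (to-+ g _ _) (cong₂ _+V_
          (trans (to-· g α w) (cong (α ·V_) gw)) (trans (to-· g γ _) (cong (γ ·V_) (to-from g (direction β))))))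
        vp : herm v p ≡ 𝟎
        vp = trans (sym (to-herm g v p)) (trans (cong₂ herm gv gp)
          (from-yes (∀F? λ α → ∀F? λ β → ∀F? λ γ → ∀F? λ s →
            herm ((α ·V e) +V (γ ·V direction β)) (s ∷ s ∷ e) ≟ 𝟎) α β γ s))

    -- Each of the four missed lines through w has three ovoid points in its perp, 12 in all. An
    -- ovoid point of w^⊥ other than p is not orthogonal to p, so it is orthogonal to exactly one of
    -- the four lines, whereas p is orthogonal to all four. Hence 12 is the degree plus 3.
    degree≡9 : degree w ≡ 9
    degree≡9 = +-cancelʳ-≡ 3 (degree w) 9 (sym (begin
      12
        ≡⟨ cong₂ _+_ (lines 𝟎) (cong₂ _+_ (lines 𝟏) (cong₂ _+_ (lines ω) (lines ω²))) ⟨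
      ∑ (L 𝟎) l + (∑ (L 𝟏) l + (∑ (L ω) l + ∑ (L ω²) l))
        ≡⟨ trans (∑-+ (L 𝟎) _ l) (cong (∑ (L 𝟎) l +_) (trans (∑-+ (L 𝟏) _ l)
             (cong (∑ (L 𝟏) l +_) (∑-+ (L ω) (L ω²) l)))) ⟨
      ∑ (λ v → L 𝟎 v + (L 𝟏 v + (L ω v + L ω² v))) l
        ≡⟨ ∑-cong l (λ v∈l → split v∈l _ refl) ⟩
      ∑ (λ v → bit (perp v w) + 3 * bit (perp v p)) l
        ≡⟨ trans (∑-+ _ _ l) (cong (degree w +_) (∑-* 3 _ l)) ⟩
      degree w + 3 * ∑ (λ v → bit (perp v p)) l
        ≡⟨ cong (λ k → degree w + 3 * k) (trans (∑-single _ l apart p∈l λ {u} _ → not-perp u)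
             (cong bit (⊥⇒perp p p (isotropic p∈l)))) ⟩
      degree w + 3 ∎))
      where
      L : F4 → Vect 6 → ℕ
      L β v = bit (perp v w ∧ perp v (second β))
      lines : ∀ β → ∑ (L β) l ≡ 3
      lines β = line-count w (second β) ww w≢0 b-isotropic orthogonal independent missed
        where open MissedLine (missed-line β)
      not-perp : ∀ u → Apart u p → bit (perp u p) ≡ 0
      not-perp u up = cong (bit ∘ not) up
      F : F4 → F4 → F4 → F4 → ℕ
      F β h y z = bit (is𝟎 h ∧ is𝟎 (y ⊗ conj β ⊕ z))
      pointwise : ∀ h s y z → (h ⊗ conj s ⊕ y ≡ 𝟎 → h ≡ 𝟎 × z ≡ 𝟎) →
        F 𝟎 h y z + (F 𝟏 h y z + (F ω h y z + F ω² h y z)) ≡ bit (is𝟎 h) + 3 * bit (is𝟎 (h ⊗ conj s ⊕ y))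
      pointwise = from-yes (∀F? λ h → ∀F? λ s → ∀F? λ y → ∀F? λ z →
        ((h ⊗ conj s ⊕ y ≟ 𝟎) →-dec ((h ≟ 𝟎) ×-dec (z ≟ 𝟎))) →-dec
        (F 𝟎 h y z + (F 𝟏 h y z + (F ω h y z + F ω² h y z)) ≟ℕ bit (is𝟎 h) + 3 * bit (is𝟎 (h ⊗ conj s ⊕ y))))
      split : ∀ {v} → v ∈ l → ∀ x → to g v ≡ x →
        L 𝟎 v + (L 𝟏 v + (L ω v + L ω² v)) ≡ bit (perp v w) + 3 * bit (perp v p)
      split {v} v∈l x@(x₀ ∷ x₁ ∷ x₂ ∷ x₃ ∷ x₄ ∷ x₅ ∷ []) gv = begin
        L 𝟎 v + (L 𝟏 v + (L ω v + L ω² v))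
          ≡⟨ cong₂ _+_ (eval 𝟎) (cong₂ _+_ (eval 𝟏) (cong₂ _+_ (eval ω) (eval ω²))) ⟩
        F 𝟎 h y z + (F 𝟏 h y z + (F ω h y z + F ω² h y z))
          ≡⟨ pointwise h s y z at-p ⟩
        bit (is𝟎 h) + 3 * bit (is𝟎 (h ⊗ conj s ⊕ y))
          ≡⟨ cong₂ (λ a b → bit (is𝟎 a) + 3 * bit (is𝟎 b)) vw vp ⟨
        bit (perp v w) + 3 * bit (perp v p) ∎
        where
        h = x₀ ⊕ x₁
        y = x₂ ⊕ x₃
        z = x₄ ⊕ x₅
        transport : ∀ {w y} → to g w ≡ y → herm v w ≡ herm x y
        transport gw = trans (sym (to-herm g v _)) (cong₂ herm gv gw)
        vw : herm v w ≡ h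
        vw = trans (transport gw) (herm-e x₀ x₁ (x₂ ∷ x₃ ∷ x₄ ∷ x₅ ∷ []))
        vp : herm v p ≡ h ⊗ conj s ⊕ y
        vp = trans (transport gp) (trans (herm-twin x₀ x₁ (x₂ ∷ x₃ ∷ x₄ ∷ x₅ ∷ []) s e) (cong (h ⊗ conj s ⊕_) (herm-e x₂ x₃ (x₄ ∷ x₅ ∷ []))))
        eval : ∀ β → L β v ≡ F β h y z
        eval β = cong₂ (λ a b → bit (is𝟎 a ∧ is𝟎 b)) vw (trans (transport (to-from g (direction β)))
          (trans (herm-pad x₀ x₁ (x₂ ∷ x₃ ∷ x₄ ∷ x₅ ∷ []) (β ∷ β ∷ e {0})) (trans (herm-twin x₂ x₃ (x₄ ∷ x₅ ∷ []) β (e {0}))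
            (cong (y ⊗ conj β ⊕_) (herm-e x₄ x₅ [])))))
        at-p : h ⊗ conj s ⊕ y ≡ 𝟎 → h ≡ 𝟎 × z ≡ 𝟎
        at-p eq with unique v∈l p∈l (trans vp eq)
        ... | refl with refl ← trans (sym gv) gp = ⊕-self s , refl

  degree-on : ∀ {v} → v ∈ l → degree v ≡ 1
  degree-on {v} v∈l = trans (∑-single _ l apart v∈l λ _ uv → cong (bit ∘ not) uv) (cong bit (⊥⇒perp v v (isotropic v∈l)))

  missed? : ∀ w → Missed w ⊎ ∃₂ λ v c → v ∈ l × v ≡ c ·V w
  missed? w with any? (λ v → ∃F? λ c → v ≟V (c ·V w)) l
  ... | no none = inj₁ λ v∈l c eq → none (lose v∈l (c , eq))
  ... | yes some with v , v∈l , c , eq ← find some = inj₂ (v , c , v∈l , eq)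

  degree-values : ∀ w → Isotropic w → NonZero w → degree w ≡ 9 ⊎ degree w ≡ 1
  degree-values w ww w≢0 with missed? w
  ... | inj₁ w∉l = inj₁ (MissedPoint.degree≡9 w ww w≢0 w∉l)
  ... | inj₂ (v , c , v∈l , v≡cw) = inj₂ (trans (∑-cong l λ {u} _ → cong bit (same u)) (degree-on v∈l))
    where
    c≢𝟎 : ¬ c ≡ 𝟎
    c≢𝟎 refl = nonzero v∈l (trans v≡cw (·V-zeroˡ w))
    same : ∀ u → perp u w ≡ perp u v
    same u = trans (from-yes (∀F? λ c → ∀F? λ h → ¬? (c ≟ 𝟎) →-dec (is𝟎 h Bool.≟ is𝟎 (conj c ⊗ h))) c (herm u w) c≢𝟎)
      (cong is𝟎 (sym (trans (cong (herm u) v≡cw) (herm-·ʳ c u w))))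

  -- Each ovoid point is orthogonal to one or all five points of a missed line.
  missed-line⇒length : ∀ w b → Isotropic w → NonZero w → MissedLine w b → length l ≡ 33
  -- Double counting of orthogonal pairs: five points of degree 9 give 45. Each ovoid point
  -- contributes 1, and the three that are orthogonal to the whole line contribute 4 more.
  missed-line⇒length w b ww w≢0 line = +-cancelʳ-≡ 12 (length l) 33 (sym (begin
    45
      ≡⟨ cong₂ _+_ (degree-free w ww w≢0 w∉l) (cong₂ _+_ (degree-pt 𝟎) (cong₂ _+_ (degree-pt 𝟏)
           (cong₂ _+_ (degree-pt ω) (degree-pt ω²)))) ⟨
    degree w + (degree (pt 𝟎) + (degree (pt 𝟏) + (degree (pt ω) + degree (pt ω²))))
      ≡⟨ trans (∑-+ (P w) _ l) (cong (degree w +_) (trans (∑-+ (P (pt 𝟎)) _ l) (cong (degree (pt 𝟎) +_)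
           (trans (∑-+ (P (pt 𝟏)) _ l) (cong (degree (pt 𝟏) +_) (∑-+ (P (pt ω)) (P (pt ω²)) l)))))) ⟨
    ∑ (λ v → P w v + (P (pt 𝟎) v + (P (pt 𝟏) v + (P (pt ω) v + P (pt ω²) v)))) l
      ≡⟨ ∑-cong l (λ {v} _ → split v) ⟩
    ∑ (λ v → 1 + 4 * bit (perp v w ∧ perp v b)) l
      ≡⟨ trans (∑-+ _ _ l) (cong₂ _+_ (∑-one l) (∑-* 4 _ l)) ⟩
    length l + 4 * ∑ (λ v → bit (perp v w ∧ perp v b)) l
      ≡⟨ cong (λ k → length l + 4 * k) (line-count w b ww w≢0 b-isotropic orthogonal independent missed) ⟩
    length l + 12 ∎))
    where
    open MissedLine line
    P : Vect 6 → Vect 6 → ℕ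
    P w v = bit (perp v w)
    pt : F4 → Vect 6
    pt c = b +V (c ·V w)
    degree-free : ∀ w → Isotropic w → NonZero w → Missed w → degree w ≡ 9
    degree-free = MissedPoint.degree≡9
    w∉l : Missed w
    w∉l v∈l c eq = missed v∈l c 𝟎 (trans eq (sym (trans (cong ((c ·V w) +V_) (·V-zeroˡ b)) (+V-identityʳ (c ·V w)))))
    degree-pt : ∀ c → degree (pt c) ≡ 9
    degree-pt c = degree-free (pt c)
      (isotropic-+ b (c ·V w) b-isotropic (isotropic-· c w ww) (⊥-·ʳ c b w (⊥-sym w b orthogonal)))
      (λ pt≡0 → independent c (begin
        b                             ≡⟨ +V-identityʳ b ⟨
        b +V zeroV                    ≡⟨ cong (b +V_) pt≡0 ⟨
        b +V (b +V (c ·V w))          ≡⟨ +V-cancel b (c ·V w) ⟩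
        c ·V w                        ∎))
      (λ v∈l d eq → missed v∈l (d ⊗ c) d (trans eq (trans (·V-distribˡ d b (c ·V w))
        (trans (cong ((d ·V b) +V_) (·V-⊗ d c w)) (+V-comm (d ·V b) _)))))
    split : ∀ v → P w v + (P (pt 𝟎) v + (P (pt 𝟏) v + (P (pt ω) v + P (pt ω²) v)))
      ≡ 1 + 4 * bit (perp v w ∧ perp v b)
    split v = trans
      (cong (P w v +_) (cong₂ _+_ (eval 𝟎) (cong₂ _+_ (eval 𝟏) (cong₂ _+_ (eval ω) (eval ω²)))))
      (from-yes (∀F? λ h → ∀F? λ y →
        bit (is𝟎 h) + (F 𝟎 h y + (F 𝟏 h y + (F ω h y + F ω² h y))) ≟ℕ 1 + 4 * bit (is𝟎 h ∧ is𝟎 y)) (herm v w) (herm v b))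
      where
      F : F4 → F4 → F4 → ℕ
      F c h y = bit (is𝟎 (y ⊕ conj c ⊗ h))
      eval : ∀ c → P (pt c) v ≡ F c (herm v w) (herm v b)
      eval c = cong (bit ∘ is𝟎) (trans (herm-+ʳ v b (c ·V w)) (cong (herm v b ⊕_) (herm-·ʳ c v w)))

  missed-point⇒length : ∀ w → Isotropic w → NonZero w → Missed w → length l ≡ 33
  missed-point⇒length w ww w≢0 w∉l = missed-line⇒length w (second 𝟎) ww w≢0 (missed-line 𝟎)
    where open MissedPoint w ww w≢0 w∉l

  -- A missed point exists because e and `pad e` are distinct and orthogonal, so at most one of them
  -- is on the ovoid.
  length≡33 : length l ≡ 33
  length≡33 with missed? e | missed? (pad e)
  ... | inj₁ e∉l | _ = missed-point⇒length e refl (λ ()) e∉l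
  ... | inj₂ _ | inj₁ pad-e∉l = missed-point⇒length (pad e) refl (λ ()) pad-e∉l
  ... | inj₂ (v , c , v∈l , v≡ce) | inj₂ (u , d , u∈l , u≡de) = ⊥-elim (nonzero v∈l
    (trans v≡ce (trans (cong (_·V e) c≡𝟎) (·V-zeroˡ e))))
    where
    v≡u : v ≡ u
    v≡u = unique v∈l u∈l (trans (cong₂ herm v≡ce u≡de)
      (from-yes (∀F? λ c → ∀F? λ d → herm (c ·V e) (d ·V pad {4} e) ≟ 𝟎) c d))
    c≡𝟎 : c ≡ 𝟎
    c≡𝟎 = trans (sym (⊗-identityʳ c)) (trans (∷-injectiveˡ (trans (sym v≡ce) (trans v≡u u≡de))) (⊗-zeroʳ d))

-- Defects

odd : ℕ → Bool
odd zero = false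
odd (suc n) = not (odd n)

odd-+ : ∀ a b → odd (a + b) ≡ odd a xor odd b
odd-+ zero b = refl
odd-+ (suc a) b = trans (cong not (odd-+ a b)) (Bool.not-distribˡ-xor (odd a) (odd b))

odd-bit : ∀ b → odd (bit b) ≡ b
odd-bit true = refl
odd-bit false = refl

-- The parity of n choose 2.
pairs : ℕ → Bool
pairs zero = false
pairs (suc n) = pairs n xor odd n

sumIf : (Vect m → Bool) → List (Vect m) → HM m
sumIf f [] = 0H
sumIf f (u ∷ us) = outer u when f u +H sumIf f us

sumIf-$ : (f : Vect m → Bool) (us : List (Vect m)) (y : Vect m) →
  sumIf f us $ y ≡ odd (∑ (λ u → bit (f u ∧ nrm (herm u y))) us)
sumIf-$ f [] y = ⟪⟫-0ˡ (outer y)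
sumIf-$ f (u ∷ us) y = trans (⟪⟫-+ˡ (outer u when f u) (sumIf f us) (outer y))
  (trans (cong₂ _xor_ (trans (⟪⟫-when (outer u) (outer y) (f u)) (trans (cong (f u ∧_) (outer-$ u y))
      (sym (odd-bit (f u ∧ nrm (herm u y)))))) (sumIf-$ f us y))
    (sym (odd-+ (bit (f u ∧ nrm (herm u y))) _)))

trace-sumIf : (f : Vect m → Bool) (us : List (Vect m)) → (∀ {u} → u ∈ us → Isotropic u) → trace (sumIf f us) ≡ false
trace-sumIf {m} f [] _ = trace-0H {m}
trace-sumIf f (u ∷ us) iso = trans (trace-+ (outer u when f u) (sumIf f us))
  (cong₂ _xor_ (trans (trace-when (outer u) (f u)) (trans (cong (f u ∧_) (trace-isotropic u (iso (here refl)))) (Bool.∧-zeroʳ (f u))))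
    (trace-sumIf f us (iso ∘ there)))

-- Every summand has e₂ = 0 and trace 0, and any two summands pair to `true`; by polarisation only
-- the number of pairs remains.
e₂-sumIf : (f : Vect m → Bool) (us : List (Vect m)) → (∀ {u} → u ∈ us → Isotropic u) → LPairs.AllPairs Apart us →
  e₂ (sumIf f us) ≡ pairs (∑ (bit ∘ f) us)
e₂-sumIf {m} f [] _ _ = e₂-0H {m}
e₂-sumIf f (u ∷ us) iso (ap ∷ aps) with f u
... | false = trans (cong e₂ (+H-identityˡ (sumIf f us))) (e₂-sumIf f us (iso ∘ there) aps)
... | true = begin
  e₂ (outer u +H R)
    ≡⟨ e₂-+ (outer u) R ⟩
  ((e₂ (outer u) xor e₂ R) xor (trace (outer u) ∧ trace R)) xor ⟪ outer u , R ⟫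
    ≡⟨ cong₂ (λ p q → ((p xor e₂ R) xor (q ∧ trace R)) xor ⟪ outer u , R ⟫) (e₂-outer u) (trace-isotropic u (iso (here refl))) ⟩
  (e₂ R xor false) xor ⟪ outer u , R ⟫
    ≡⟨ cong₂ _xor_ (trans (Bool.xor-identityʳ (e₂ R)) (e₂-sumIf f us (iso ∘ there) aps))
         (trans (⟪⟫-comm (outer u) R) (trans (sumIf-$ f us u) (cong odd (∑-cong us λ {v} v∈us →
           cong bit (trans (cong (f v ∧_) (Apart-sym u v (LAll.lookup ap v∈us))) (Bool.∧-identityʳ (f v))))))) ⟩
  pairs (∑ (bit ∘ f) us) xor odd (∑ (bit ∘ f) us) ∎
  where R = sumIf f us

sumH : (Vect m → HM m) → List (Vect m) → HM m
sumH F [] = 0H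
sumH F (p ∷ ps) = F p +H sumH F ps

sumH-+ : (F G : Vect m → HM m) (ps : List (Vect m)) → sumH (λ p → F p +H G p) ps ≡ sumH F ps +H sumH G ps
sumH-+ F G [] = sym (+H-identityˡ 0H)
sumH-+ F G (p ∷ ps) = trans (cong (F p +H G p +H_) (sumH-+ F G ps)) (+H-interchange (F p) (G p) (sumH F ps) (sumH G ps))

parity : (Vect m → Bool) → List (Vect m) → Bool
parity f [] = false
parity f (p ∷ ps) = f p xor parity f ps

sumH-when : (X : HM m) (f : Vect m → Bool) (ps : List (Vect m)) → sumH (λ p → X when f p) ps ≡ X when parity f ps
sumH-when X f [] = refl
sumH-when X f (p ∷ ps) = trans (cong (X when f p +H_) (sumH-when X f ps)) (sym (when-xor X (f p) (parity f ps)))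

parity-not : (f : Vect m → Bool) (ps : List (Vect m)) → parity (not ∘ f) ps ≡ odd (length ps) xor parity f ps
parity-not f [] = refl
parity-not f (p ∷ ps) = trans (cong (not (f p) xor_) (parity-not f ps)) (lemma (f p) (odd (length ps)) (parity f ps))
  where
  lemma : ∀ a b c → not a xor (b xor c) ≡ not b xor (a xor c)
  lemma a b c = trans (cong (_xor (b xor c)) (sym (Bool.true-xor a)))
    (trans (solve 3 (λ a b c → (con true :+ a) :+ (b :+ c) := (con true :+ b) :+ (a :+ c)) refl a b c)
      (cong (_xor (a xor c)) (Bool.true-xor b)))

⟪⟫-sumH : (X : HM m) (F : Vect m → HM m) (ps : List (Vect m)) → ⟪ X , sumH F ps ⟫ ≡ parity (λ p → ⟪ X , F p ⟫) ps
⟪⟫-sumH X F [] = trans (⟪⟫-comm X 0H) (⟪⟫-0ˡ X)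
⟪⟫-sumH X F (p ∷ ps) = trans (⟪⟫-+ʳ X (F p) (sumH F ps)) (cong (⟪ X , F p ⟫ xor_) (⟪⟫-sumH X F ps))

-- Isotropic points of three mutually orthogonal hyperbolic lines.
frame : List (Vect 6)
frame = orthogonal-lines (λ v → v) List.++ (orthogonal-lines rotate List.++ orthogonal-lines (rotate ∘ rotate))
  where
  rotate : Vect 6 → Vect 6
  rotate (a ∷ b ∷ c ∷ d ∷ x ∷ y ∷ []) = x ∷ y ∷ a ∷ b ∷ c ∷ d ∷ []
  orthogonal-lines : (Vect 6 → Vect 6) → List (Vect 6)
  orthogonal-lines f = List.map (λ c → f (𝟏 ∷ c ∷ zeroV)) (𝟏 ∷ ω ∷ ω² ∷ [])

frame-points : LAll.All IsIsotropicPoint frame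
frame-points =
  ((λ ()) , refl) ∷ ((λ ()) , refl) ∷ ((λ ()) , refl) ∷
  ((λ ()) , refl) ∷ ((λ ()) , refl) ∷ ((λ ()) , refl) ∷
  ((λ ()) , refl) ∷ ((λ ()) , refl) ∷ ((λ ()) , refl) ∷ []

-- The outer squares of the three isotropic points of a hyperbolic line sum to its identity matrix,
-- so those of the frame sum to the identity of order 6. Pairing with uu* shows that the number of
-- frame points not orthogonal to u is even, and the frame has nine points.
parity-frame : (u : Vect 6) → Isotropic u → parity (λ w → perp u w) frame ≡ true
parity-frame u uu = trans (parity-not (λ w → nrm (herm u w)) frame) (cong (true xor_) (begin
  parity (λ w → nrm (herm u w)) frame        ≡⟨ cong-parity frame ⟩
  parity (λ w → ⟪ outer u , outer w ⟫) frame ≡⟨ ⟪⟫-sumH (outer u) outer frame ⟨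
  ⟪ outer u , scalar true ⟫                  ≡⟨ ⟪⟫-scalar (outer u) ⟩
  trace (outer u)                            ≡⟨ trace-isotropic u uu ⟩
  false                                      ∎))
  where
  cong-parity : ∀ ps → parity (λ w → nrm (herm u w)) ps ≡ parity (λ w → ⟪ outer u , outer w ⟫) ps
  cong-parity [] = refl
  cong-parity (p ∷ ps) = cong₂ _xor_ (sym (outer-$ u p)) (cong-parity ps)

toVec : (us : List (Vect m)) {n : ℕ} → length us ≡ n → (∀ {u} → u ∈ us → Isotropic u) → LPairs.AllPairs Apart us →
  Σ (Vec (Vect m) n) λ vs → All Isotropic vs × AllPairs Apart vs × (∀ j → lookup vs j ∈ us)
toVec [] refl _ _ = [] , [] , [] , λ ()
toVec (u ∷ us) refl iso (ap ∷ aps) with vs , isos , pairs , mem ← toVec us refl (iso ∘ there) aps =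
  u ∷ vs , iso (here refl) ∷ isos , lookup⁻ (λ j → LAll.lookup ap (mem j)) ∷ pairs ,
  λ { zero → here refl ; (suc j) → there (mem j) }

true≢false : ¬ true ≡ false
true≢false ()

module Contradiction {l : List (Vect 6)} (ovoid : OvoidList l) where
  open OvoidList ovoid
  open Counting ovoid

  neighbours : Vect 6 → HM 6
  neighbours w = sumIf (λ u → perp u w) l

  defect : Vect 6 → HM 6
  defect w = outer w +H neighbours w

  Ortho : HM 6 → Set
  Ortho X = trace X ≡ false × (∀ {v} → v ∈ l → X $ v ≡ false)

  Ortho-+ : ∀ X Y → Ortho X → Ortho Y → Ortho (X +H Y)
  Ortho-+ X Y (tX , X⊥) (tY , Y⊥) = trans (trace-+ X Y) (cong₂ _xor_ tX tY) ,
    λ {v} v∈l → trans (⟪⟫-+ˡ X Y (outer v)) (cong₂ _xor_ (X⊥ v∈l) (Y⊥ v∈l))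

  odd-degree : ∀ w → IsIsotropicPoint w → odd (degree w) ≡ true
  odd-degree w (w≢0 , ww) with degree-values w ww w≢0
  ... | inj₁ eq = cong odd eq
  ... | inj₂ eq = cong odd eq

  pairs-degree : ∀ w → IsIsotropicPoint w → pairs (degree w) ≡ false
  pairs-degree w (w≢0 , ww) with degree-values w ww w≢0
  ... | inj₁ eq = cong pairs eq
  ... | inj₂ eq = cong pairs eq

  -- The value at v is the parity of the neighbours of w not orthogonal to v, that is, of all
  -- neighbours except possibly v itself. As the degree is odd, it is `true` exactly when v is not a
  -- neighbour.
  neighbours-$ : ∀ w → IsIsotropicPoint w → ∀ {v} → v ∈ l → neighbours w $ v ≡ nrm (herm w v)
  neighbours-$ w point {v} v∈l = begin
    neighbours w $ v
      ≡⟨ sumIf-$ (λ u → perp u w) l v ⟩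
    odd N
      ≡⟨ solve 2 (λ n p → n := (n :+ p) :+ p) refl (odd N) (perp v w) ⟩
    (odd N xor perp v w) xor perp v w
      ≡⟨ cong (λ b → (odd N xor b) xor perp v w) (odd-bit (perp v w)) ⟨
    (odd N xor odd (bit (perp v w))) xor perp v w
      ≡⟨ cong (_xor perp v w) (odd-+ N (bit (perp v w))) ⟨
    odd (N + bit (perp v w)) xor perp v w
      ≡⟨ cong (λ n → odd n xor perp v w) (trans (cong (N +_) (sym at-v)) (sym (∑-+ _ _ l))) ⟩
    odd (∑ (λ u → bit (perp u w ∧ nrm (herm u v)) + bit (perp u w ∧ perp u v)) l) xor perp v w
      ≡⟨ cong (λ n → odd n xor perp v w) (∑-cong l λ {u} _ → split (perp u w) (nrm (herm u v))) ⟩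
    odd (degree w) xor perp v w
      ≡⟨ cong (_xor perp v w) (odd-degree w point) ⟩
    not (not (nrm (herm v w)))
      ≡⟨ Bool.not-involutive (nrm (herm v w)) ⟩
    nrm (herm v w)
      ≡⟨ trans (cong nrm (herm-conj w v)) (nrm-conj (herm w v)) ⟩
    nrm (herm w v) ∎
    where
    N = ∑ (λ u → bit (perp u w ∧ nrm (herm u v))) l
    split : ∀ a b → bit (a ∧ b) + bit (a ∧ not b) ≡ bit a
    split false _ = refl
    split true false = refl
    split true true = refl
    at-v : ∑ (λ u → bit (perp u w ∧ perp u v)) l ≡ bit (perp v w)
    at-v = trans (∑-single _ l apart v∈l λ {u} _ uv → cong bit
        (trans (cong (λ b → perp u w ∧ not b) uv) (Bool.∧-zeroʳ (perp u w))))
      (cong bit (trans (cong (perp v w ∧_) (⊥⇒perp v v (isotropic v∈l))) (Bool.∧-identityʳ (perp v w))))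

  defect-ortho : ∀ w → IsIsotropicPoint w → Ortho (defect w)
  defect-ortho w point@(w≢0 , ww) =
    trans (trace-+ (outer w) (neighbours w)) (cong₂ _xor_ (trace-isotropic w ww) (trace-sumIf _ l isotropic)) ,
    λ {v} v∈l → trans (⟪⟫-+ˡ (outer w) (neighbours w) (outer v))
      (trans (cong₂ _xor_ (outer-$ w v) (neighbours-$ w point v∈l)) (Bool.xor-same (nrm (herm w v))))

  -- The degree is 9 or 1, and 9 choose 2 = 36 and 1 choose 2 = 0 are both even. The cross term
  -- vanishes since all neighbours are orthogonal to w.
  e₂-defect : ∀ w → IsIsotropicPoint w → e₂ (defect w) ≡ false
  e₂-defect w point@(w≢0 , ww) = begin
    e₂ (outer w +H T)
      ≡⟨ e₂-+ (outer w) T ⟩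
    ((e₂ (outer w) xor e₂ T) xor (trace (outer w) ∧ trace T)) xor ⟪ outer w , T ⟫
      ≡⟨ cong₂ _xor_ (cong₂ _xor_
           (cong₂ _xor_ (e₂-outer w) (trans (e₂-sumIf _ l isotropic apart) (pairs-degree w point)))
           (cong (_∧ trace T) (trace-isotropic w ww)))
           (trans (⟪⟫-comm (outer w) T) (trans (sumIf-$ _ l w) (cong odd (∑-zero l λ {u} _ → clash (nrm (herm u w)))))) ⟩
    false ∎
    where
    T = neighbours w
    clash : ∀ b → bit (not b ∧ b) ≡ 0
    clash true = refl
    clash false = refl

  -- The correction terms in the defect are outer squares of ovoid points, to which X is orthogonal.
  -- So defects represent evaluation at points.
  ⟪⟫-defect : ∀ X → Ortho X → ∀ w → ⟪ X , defect w ⟫ ≡ X $ w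
  ⟪⟫-defect X (_ , X⊥) w = trans (⟪⟫-+ʳ X (outer w) (neighbours w))
    (trans (cong (X $ w xor_) (trans (⟪⟫-comm X (neighbours w)) (vanish l (λ v → v)))) (Bool.xor-identityʳ (X $ w)))
    where
    vanish : ∀ us → (∀ {u} → u ∈ us → u ∈ l) → ⟪ sumIf (λ u → perp u w) us , X ⟫ ≡ false
    vanish [] _ = ⟪⟫-0ˡ X
    vanish (u ∷ us) sub = trans (⟪⟫-+ˡ (outer u when perp u w) _ X) (cong₂ _xor_
      (trans (⟪⟫-when (outer u) X (perp u w)) (trans (cong (perp u w ∧_) (trans (⟪⟫-comm (outer u) X) (X⊥ (sub (here refl)))))
        (Bool.∧-zeroʳ (perp u w)))) (vanish us (sub ∘ there)))

  defect-sym : ∀ p q → IsIsotropicPoint p → IsIsotropicPoint q → defect p $ q ≡ defect q $ p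
  defect-sym p q pp qq = trans (sym (⟪⟫-defect (defect p) (defect-ortho p pp) q))
    (trans (⟪⟫-comm (defect p) (defect q)) (⟪⟫-defect (defect q) (defect-ortho q qq) p))

  -- This encodes D(w) w = 0 through values of the form alone. It holds because every vector whose
  -- outer square enters D(w), w included, is orthogonal to w.
  defect-radical : ∀ w → Isotropic w → ∀ y → defect w $ (w +V y) ≡ defect w $ y
  defect-radical w ww y = trans (⟪⟫-+ˡ (outer w) (neighbours w) (outer (w +V y)))
    (trans (cong₂ _xor_ (trans (outer-$ w (w +V y)) (trans (cong nrm (shift w ww)) (sym (outer-$ w y)))) (sums l))
      (sym (⟪⟫-+ˡ (outer w) (neighbours w) (outer y))))
    where
    shift : ∀ u → herm u w ≡ 𝟎 → herm u (w +V y) ≡ herm u y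
    shift u uw = trans (herm-+ʳ u w y) (cong (_⊕ herm u y) uw)
    term : ∀ u b → perp u w ≡ b → b ∧ nrm (herm u (w +V y)) ≡ b ∧ nrm (herm u y)
    term u false _ = refl
    term u true uw = cong nrm (shift u (perp-true u w uw))
    sums : ∀ us → sumIf (λ u → perp u w) us $ (w +V y) ≡ sumIf (λ u → perp u w) us $ y
    sums us = trans (sumIf-$ _ us (w +V y)) (trans (cong odd (∑-cong us λ {u} _ → cong bit (term u (perp u w) refl)))
      (sym (sumIf-$ _ us y)))

  defect-self : ∀ w → IsIsotropicPoint w → ⟪ defect w , defect w ⟫ ≡ false
  defect-self w point = trans (⟪⟫-self (defect w)) (proj₁ (defect-ortho w point))

  ≢0-from-$ : (X : HM 6) (p : Vect 6) → X $ p ≡ true → NonZero p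
  ≢0-from-$ X p Xp refl = true≢false (trans (sym Xp) ($-zero X))

  -- If c were `true` at p, then c and D(p) would be a second hyperbolic pair next to a and b. One
  -- of the 33 ovoid points is discarded to reach the even size 32.
  no-room : ∀ a b c → Ortho a → Ortho b → Ortho c → ⟪ a , b ⟫ ≡ true → ⟪ a , c ⟫ ≡ false → ⟪ b , c ⟫ ≡ false →
    ∀ p → Isotropic p → c $ p ≡ false
  no-room a b c oa ob oc ab ac bc p pp = Bool.¬-not λ cp → bound cp l isotropic apart (λ v → v) length≡33
    where
    bound : c $ p ≡ true → ∀ us → (∀ {u} → u ∈ us → Isotropic u) → LPairs.AllPairs Apart us →
      (∀ {u} → u ∈ us → u ∈ l) → length us ≡ 33 → ⊥
    bound cp (u ∷ us) iso (_ ∷ aps) sub len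
      with vs , isos , pairs , mem ← toVec us (suc-injective len) (iso ∘ there) aps =
      dimension-bound vs isos pairs a b c (defect p)
        (proj₁ oa ∷ proj₁ ob ∷ proj₁ oc ∷ proj₁ od ∷ [])
        ((λ j → proj₂ oa (sub (there (mem j)))) ∷ (λ j → proj₂ ob (sub (there (mem j)))) ∷
         (λ j → proj₂ oc (sub (there (mem j)))) ∷ (λ j → proj₂ od (sub (there (mem j)))) ∷ [])
        ab ac bc (trans (⟪⟫-defect c oc p) cp)
      where
      od : Ortho (defect p)
      od = defect-ortho p (≢0-from-$ c p cp , pp)

  -- Otherwise the defects of the four points u, x, y = u + x and z = u + ωx of a line pair to
  -- `true` two by two, a Gram matrix J - I of rank 4. Concretely, D(u) and D(x) form a hyperbolic
  -- pair, and D(y) + D(u) + D(x) is orthogonal to both but `true` at z.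
  collinear-defect : ∀ u x → IsIsotropicPoint u → IsIsotropicPoint x → herm u x ≡ 𝟎 → defect u $ x ≡ false
  collinear-defect u x pu@(_ , uu) px@(_ , xx) ux = Bool.¬-not λ Du-x →
    let
      Dx-u = trans (defect-sym x u px pu) Du-x
      y = u +V x
      z = u +V (ω ·V x)
      Du-y = trans (defect-radical u uu x) Du-x
      Dx-y = trans (cong (defect x $_) (+V-comm u x)) (trans (defect-radical x xx u) Dx-u)
      yy = isotropic-+ u x uu xx ux
      py = ≢0-from-$ (defect x) y Dx-y , yy
      Du-z = trans (defect-radical u uu (ω ·V x)) (trans ($-· (defect u) ω (λ ()) x) Du-x)
      -- Scaling z by ω² turns it into x + ω²u, to which the radical property of D(x) applies.
      Dx-z = begin
        defect x $ z                    ≡⟨ $-· (defect x) ω² (λ ()) z ⟨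
        defect x $ (ω² ·V z)            ≡⟨ cong (defect x $_) (trans (·V-distribˡ ω² u (ω ·V x))
                                             (trans (cong ((ω² ·V u) +V_) (trans (·V-⊗ ω² ω x) (·V-identity x))) (+V-comm _ x))) ⟩
        defect x $ (x +V (ω² ·V u))     ≡⟨ defect-radical x xx (ω² ·V u) ⟩
        defect x $ (ω² ·V u)            ≡⟨ $-· (defect x) ω² (λ ()) u ⟩
        defect x $ u                    ≡⟨ Dx-u ⟩
        true                            ∎
      Dy-z = begin
        defect y $ z                    ≡⟨ cong (defect y $_) (trans (cong (u +V_) (trans (·V-distribʳ 𝟏 ω² x)
                                             (cong (_+V (ω² ·V x)) (·V-identity x)))) (sym (+V-assoc u x (ω² ·V x)))) ⟩
        defect y $ (y +V (ω² ·V x))     ≡⟨ defect-radical y yy (ω² ·V x) ⟩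
        defect y $ (ω² ·V x)            ≡⟨ $-· (defect y) ω² (λ ()) x ⟩
        defect y $ x                    ≡⟨ defect-sym y x py px ⟩
        defect x $ y                    ≡⟨ Dx-y ⟩
        true                            ∎
      ou = defect-ortho u pu
      ox = defect-ortho x px
      oy = defect-ortho y py
      expand = λ Z → trans (⟪⟫-+ʳ Z (defect y) (defect u +H defect x))
                       (cong (⟪ Z , defect y ⟫ xor_) (⟪⟫-+ʳ Z (defect u) (defect x)))
      Du-c = trans (expand (defect u)) (cong₂ _xor_ (trans (⟪⟫-defect (defect u) ou y) Du-y)
               (cong₂ _xor_ (defect-self u pu) (trans (⟪⟫-defect (defect u) ou x) Du-x)))
      Dx-c = trans (expand (defect x)) (cong₂ _xor_ (trans (⟪⟫-defect (defect x) ox y) Dx-y)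
               (cong₂ _xor_ (trans (⟪⟫-defect (defect x) ox u) Dx-u) (defect-self x px)))
      c-z = trans (⟪⟫-+ˡ (defect y) (defect u +H defect x) (outer z))
              (cong₂ _xor_ Dy-z (trans (⟪⟫-+ˡ (defect u) (defect x) (outer z)) (cong₂ _xor_ Du-z Dx-z)))
      zz = isotropic-+ u (ω ·V x) uu (isotropic-· ω x xx) (⊥-·ʳ ω u x ux)
    in true≢false (trans (sym c-z) (no-room (defect u) (defect x) (defect y +H (defect u +H defect x)) ou ox
         (Ortho-+ (defect y) (defect u +H defect x) oy (Ortho-+ (defect u) (defect x) ou ox))
         (trans (⟪⟫-defect (defect u) ou x) Du-x) Du-c Dx-c z zz))

  all-ovoid : HM 6
  all-ovoid = sumIf (λ _ → true) l

  sum-defects : sumH defect frame ≡ scalar true +H all-ovoid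
  sum-defects = trans (sumH-+ outer neighbours frame) (cong (sumH outer frame +H_) (collect l isotropic))
    where
    collect : ∀ us → (∀ {u} → u ∈ us → Isotropic u) → sumH (λ w → sumIf (λ u → perp u w) us) frame ≡ sumIf (λ _ → true) us
    collect [] _ = refl
    collect (u ∷ us) iso = trans (sumH-+ (λ w → outer u when perp u w) (λ w → sumIf (λ u → perp u w) us) frame)
      (cong₂ _+H_ (trans (sumH-when (outer u) (perp u) frame) (cong (outer u when_) (parity-frame u (iso (here refl)))))
        (collect us (iso ∘ there)))

  -- The identity contributes 15 and the ovoid 33 choose 2 = 528, which is even; the remaining term
  -- is the trace of `all-ovoid`, which is zero.
  e₂-sum-defects : e₂ (sumH defect frame) ≡ true
  e₂-sum-defects = trans (cong e₂ sum-defects) (trans (e₂-+ (scalar true) all-ovoid)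
    (cong₂ _xor_ (cong (λ b → (true xor b) xor false)
        (trans (e₂-sumIf _ l isotropic apart) (cong pairs (trans (∑-one l) length≡33))))
      (trans (⟪⟫-comm (scalar true) all-ovoid) (trans (⟪⟫-scalar all-ovoid) (trace-sumIf _ l isotropic)))))

  -- While no defect is `true` at a later point of the list, the defects are pairwise orthogonal, so
  -- e₂ is additive on them and vanishes on their sum.
  search : ∀ ps → LAll.All IsIsotropicPoint ps →
    (∃₂ λ p q → IsIsotropicPoint p × IsIsotropicPoint q × defect p $ q ≡ true) ⊎ e₂ (sumH defect ps) ≡ false
  search [] _ = inj₂ refl
  search (p ∷ ps) (pp ∷ pps) with any? (λ q → defect p $ q Bool.≟ true) ps
  ... | yes some with q , q∈ps , pq ← find some = inj₁ (p , q , pp , LAll.lookup pps q∈ps , pq)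
  ... | no none with search ps pps
  ...   | inj₁ found = inj₁ found
  ...   | inj₂ rest = inj₂ (trans (e₂-+ (defect p) R) (cong₂ _xor_
            (cong₂ _xor_ (cong₂ _xor_ (e₂-defect p pp) rest) (cong (_∧ trace R) (proj₁ (defect-ortho p pp))))
            (trans (⟪⟫-sumH (defect p) defect ps) (zeros ps (¬Any⇒All¬ ps none)))))
    where
    R = sumH defect ps
    zeros : ∀ qs → LAll.All (λ q → ¬ defect p $ q ≡ true) qs → parity (λ q → ⟪ defect p , defect q ⟫) qs ≡ false
    zeros [] [] = refl
    zeros (q ∷ qs) (nq ∷ nqs) = cong₂ _xor_
      (trans (⟪⟫-defect (defect p) (defect-ortho p pp) q) (Bool.¬-not nq)) (zeros qs nqs)

  module Pair (w₀ w : Vect 6) (pw₀ : IsIsotropicPoint w₀) (pw : IsIsotropicPoint w) (w₀-w : defect w₀ $ w ≡ true) where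
    private
      D₀ = defect w₀
      A = defect w
      ww = proj₂ pw
      o₀ = defect-ortho w₀ pw₀
      oA = defect-ortho w pw

    -- Next to the hyperbolic pair D₀, A, the sum D(x) + A is orthogonal to both: to D₀ since both
    -- summands pair to `true`, to A since x and w are collinear. So it vanishes at all isotropic
    -- points, and its e₂ is 0, which makes it zero.
    same-defect : ∀ x → Isotropic x → herm w x ≡ 𝟎 → D₀ $ x ≡ true → defect x ≡ A
    same-defect x xx wx D₀x = begin
      defect x                    ≡⟨ trans (cong (defect x +H_) (+H-self A)) (+H-identityʳ (defect x)) ⟨
      defect x +H (A +H A)        ≡⟨ +H-assoc (defect x) A A ⟨
      (defect x +H A) +H A        ≡⟨ cong (_+H A) (vanishing⇒0H (defect x +H A)
                                       (no-room D₀ A (defect x +H A) o₀ oA (Ortho-+ (defect x) A ox oA) (trans (⟪⟫-defect D₀ o₀ w) w₀-w) D₀-E A-E) e₂-E) ⟩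
      0H +H A                     ≡⟨ +H-identityˡ A ⟩
      A                           ∎
      where
      px : IsIsotropicPoint x
      px = ≢0-from-$ D₀ x D₀x , xx
      ox = defect-ortho x px
      A-x : ⟪ A , defect x ⟫ ≡ false
      A-x = trans (⟪⟫-defect A oA x) (collinear-defect w x pw px wx)
      D₀-E : ⟪ D₀ , defect x +H A ⟫ ≡ false
      D₀-E = trans (⟪⟫-+ʳ D₀ (defect x) A) (cong₂ _xor_ (trans (⟪⟫-defect D₀ o₀ x) D₀x) (trans (⟪⟫-defect D₀ o₀ w) w₀-w))
      A-E : ⟪ A , defect x +H A ⟫ ≡ false
      A-E = trans (⟪⟫-+ʳ A (defect x) A) (cong₂ _xor_ A-x (defect-self w pw))
      e₂-E : e₂ (defect x +H A) ≡ false
      e₂-E = trans (e₂-+ (defect x) A) (cong₂ _xor_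
        (cong₂ _xor_ (cong₂ _xor_ (e₂-defect x px) (e₂-defect w pw)) (cong₂ _∧_ (proj₁ ox) (proj₁ oA)))
        (trans (⟪⟫-comm (defect x) A) A-x))

    -- Membership in the radical of the Hermitian form A, expressed by translation invariance of its
    -- values.
    Radical : Vect 6 → Set
    Radical x = ∀ y → A $ (x +V y) ≡ A $ y

    radical-from : ∀ x → Isotropic x → herm w x ≡ 𝟎 → D₀ $ x ≡ true → Radical x
    radical-from x xx wx D₀x y = begin
      A $ (x +V y)          ≡⟨ cong (_$ (x +V y)) (same-defect x xx wx D₀x) ⟨
      defect x $ (x +V y)   ≡⟨ defect-radical x xx y ⟩
      defect x $ y          ≡⟨ cong (_$ y) (same-defect x xx wx D₀x) ⟩
      A $ y                 ∎

    -- A line through w has a second point where D₀ does not vanish.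
    radical-isotropic : ∀ x → Isotropic x → herm w x ≡ 𝟎 → Radical x
    radical-isotropic x xx wx y = by-cases _ _ _ _ refl refl refl refl ($-line D₀ w x)
      where
      via : ∀ c → ¬ c ≡ 𝟎 → D₀ $ (w +V (c ·V x)) ≡ true → A $ (x +V y) ≡ A $ y
      via c c≢𝟎 eq = begin
        A $ (x +V y)                          ≡⟨ $-· A c c≢𝟎 (x +V y) ⟨
        A $ (c ·V (x +V y))                   ≡⟨ cong (A $_) (·V-distribˡ c x y) ⟩
        A $ ((c ·V x) +V (c ·V y))            ≡⟨ defect-radical w ww _ ⟨
        A $ (w +V ((c ·V x) +V (c ·V y)))     ≡⟨ cong (A $_) (+V-assoc w (c ·V x) (c ·V y)) ⟨
        A $ ((w +V (c ·V x)) +V (c ·V y))     ≡⟨ radical-from (w +V (c ·V x))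
                                                   (isotropic-+ w (c ·V x) ww (isotropic-· c x xx) (⊥-·ʳ c w x wx))
                                                   (⊥-+ʳ w w (c ·V x) ww (⊥-·ʳ c w x wx)) eq (c ·V y) ⟩
        A $ (c ·V y)                          ≡⟨ $-· A c c≢𝟎 y ⟩
        A $ y                                 ∎
      by-cases : ∀ p q r s → D₀ $ (w +V (𝟏 ·V x)) ≡ p → D₀ $ (w +V (ω ·V x)) ≡ q → D₀ $ (w +V (ω² ·V x)) ≡ r → D₀ $ x ≡ s →
        D₀ $ (w +V (𝟏 ·V x)) xor (D₀ $ (w +V (ω ·V x)) xor D₀ $ (w +V (ω² ·V x))) ≡ D₀ $ w xor D₀ $ x →
        A $ (x +V y) ≡ A $ y
      by-cases true _ _ _ p _ _ _ _ = via 𝟏 (λ ()) p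
      by-cases _ true _ _ _ q _ _ _ = via ω (λ ()) q
      by-cases _ _ true _ _ _ r _ _ = via ω² (λ ()) r
      by-cases _ _ _ true _ _ _ s _ = radical-from x xx wx s y
      -- If D₀ vanished at the other four points of the line, the five-point relation would make it
      -- vanish at w too.
      by-cases false false false false p q r s line =
        ⊥-elim (true≢false (sym (trans (sym (cong₂ _xor_ p (cong₂ _xor_ q r))) (trans line (cong₂ _xor_ w₀-w s)))))

    -- Move w to e. The generator spanned by e, `pad e` and `pad (pad e)` is its own perp; x, being
    -- non-isotropic, is not in it and hence not orthogonal to one of the last two basis vectors.
    detect : ∀ x → herm x w ≡ 𝟎 → ¬ herm x x ≡ 𝟎 → ∃ λ f → Isotropic f × herm w f ≡ 𝟎 × ¬ herm x f ≡ 𝟎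
    detect x xw xx≢𝟎 with g , gw ← move-to-e w ww (proj₁ pw) = choose (to g x) refl
      where
      candidate : ∀ f → Isotropic f → herm e f ≡ 𝟎 → ¬ herm (to g x) f ≡ 𝟎 →
        ∃ λ f → Isotropic f × herm w f ≡ 𝟎 × ¬ herm x f ≡ 𝟎
      candidate f ff ef xf = from g f , trans (from-herm g f f) ff ,
        trans (sym (herm-adjoint g w f)) (trans (cong (λ w → herm w f) gw) ef) ,
        xf ∘ trans (herm-adjoint g x f)
      choose : ∀ y → to g x ≡ y → ∃ λ f → Isotropic f × herm w f ≡ 𝟎 × ¬ herm x f ≡ 𝟎
      choose (a ∷ b ∷ c ∷ d ∷ p ∷ q ∷ []) gx with c ⊕ d ≟ 𝟎 | p ⊕ q ≟ 𝟎
      ... | no cd | _ = candidate (pad e) refl refl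
              (cd ∘ trans (sym (trans (cong (λ y → herm y (pad e)) gx) (trans (herm-pad a b (c ∷ d ∷ p ∷ q ∷ []) (e {2})) (herm-e c d (p ∷ q ∷ []))))))
      ... | yes _ | no pq = candidate (pad (pad e)) refl refl
              (pq ∘ trans (sym (trans (cong (λ y → herm y (pad (pad e))) gx)
                (trans (herm-pad a b (c ∷ d ∷ p ∷ q ∷ []) (pad (e {0}))) (trans (herm-pad c d (p ∷ q ∷ []) (e {0})) (herm-e p q []))))))
      ... | yes cd | yes pq with refl ← ⊕-≡𝟎 c d cd | refl ← ⊕-≡𝟎 p q pq
              | refl ← ⊕-≡𝟎 a b (trans (sym (herm-e a b (c ∷ d ∷ p ∷ q ∷ []))) (trans (cong₂ herm (sym gx) (sym gw)) (trans (to-herm g x w) xw))) =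
              ⊥-elim (xx≢𝟎 (trans (sym (to-herm g x x)) (trans (cong₂ herm gx gx)
                (trans (herm-diagonal a (c ∷ c ∷ p ∷ p ∷ []) (c ∷ c ∷ p ∷ p ∷ []) a) (trans (herm-diagonal c (p ∷ p ∷ []) (p ∷ p ∷ []) c) (herm-diagonal p [] [] p))))))

    -- A non-isotropic vector of w^⊥ is a sum of two isotropic ones.
    radical-perp : ∀ x → herm x w ≡ 𝟎 → Radical x
    radical-perp x xw y with herm x x ≟ 𝟎
    ... | yes xx = radical-isotropic x xx (⊥-sym x w xw) y
    ... | no xx≢𝟎 with f , ff , wf , xf ← detect x xw xx≢𝟎 = begin
      A $ (x +V y)                  ≡⟨ cong (λ y → A $ (x +V y)) (+V-cancel f′ y) ⟨
      A $ (x +V (f′ +V (f′ +V y)))    ≡⟨ cong (A $_) (+V-assoc x f′ (f′ +V y)) ⟨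
      A $ ((x +V f′) +V (f′ +V y))    ≡⟨ radical-isotropic (x +V f′) sum-isotropic (⊥-+ʳ w x f′ (⊥-sym x w xw) wf′) (f′ +V y) ⟩
      A $ (f′ +V y)                  ≡⟨ radical-isotropic f′ (isotropic-· (h ⊗ ω) f ff) wf′ y ⟩
      A $ y                         ∎
      where
      h = herm x f
      -- The scalar makes herm x f′ equal to ω², whose trace 𝟏 cancels herm x x = 𝟏, so that x + f′
      -- is isotropic.
      f′ = (h ⊗ ω) ·V f
      wf′ : herm w f′ ≡ 𝟎
      wf′ = ⊥-·ʳ (h ⊗ ω) w f wf
      xx≡𝟏 : herm x x ≡ 𝟏
      xx≡𝟏 = lemma (trace (outer x)) (herm-self x)
        where
        lemma : ∀ b → herm x x ≡ ι b → herm x x ≡ 𝟏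
        lemma true eq = eq
        lemma false eq = ⊥-elim (xx≢𝟎 eq)
      xf′ : herm x f′ ≡ conj (h ⊗ ω) ⊗ h
      xf′ = herm-·ʳ (h ⊗ ω) x f
      sum-isotropic : Isotropic (x +V f′)
      sum-isotropic = begin
        herm (x +V f′) (x +V f′)
          ≡⟨ trans (herm-+ˡ x f′ (x +V f′)) (cong₂ _⊕_ (herm-+ʳ x x f′) (herm-+ʳ f′ x f′)) ⟩
        (herm x x ⊕ herm x f′) ⊕ (herm f′ x ⊕ herm f′ f′)
          ≡⟨ cong₂ _⊕_ (cong₂ _⊕_ xx≡𝟏 xf′)
               (cong₂ _⊕_ (trans (herm-conj x f′) (cong conj xf′)) (isotropic-· (h ⊗ ω) f ff)) ⟩
        (𝟏 ⊕ conj (h ⊗ ω) ⊗ h) ⊕ (conj (conj (h ⊗ ω) ⊗ h) ⊕ 𝟎)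
          ≡⟨ from-yes (∀F? λ h → ¬? (h ≟ 𝟎) →-dec
               ((𝟏 ⊕ conj (h ⊗ ω) ⊗ h) ⊕ (conj (conj (h ⊗ ω) ⊗ h) ⊕ 𝟎) ≟ 𝟎)) h xf ⟩
        𝟎 ∎

    A-w₀ : A $ w₀ ≡ true
    A-w₀ = trans (defect-sym w w₀ pw pw₀) w₀-w

    -- Otherwise w would have degree 33, whereas degrees are 9 or 1.
    outside : ∃ λ v → v ∈ l × ¬ herm v w ≡ 𝟎
    outside with any? (λ v → ¬? (herm v w ≟ 𝟎)) l
    ... | yes some = find some
    ... | no none = ⊥-elim ([ (λ ()) ∘ trans (sym full) , (λ ()) ∘ trans (sym full) ]′ (degree-values w ww (proj₁ pw)))
      where
      full : degree w ≡ 33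
      full = trans (∑-cong l λ {v} v∈l → cong bit (⊥⇒perp v w (decidable-stable (herm v w ≟ 𝟎) (λ vw → none (lose v∈l vw)))))
        (trans (∑-one l) length≡33)

    -- Modulo w^⊥, which is in the radical of A, every ovoid point off w^⊥ is a
    -- multiple of w₀.
    absurd : ⊥
    absurd with v , v∈l , vw ← outside = true≢false (begin
      true                      ≡⟨ A-w₀ ⟨
      A $ w₀                    ≡⟨ radical-perp (v′ +V w₀) sum-⊥ w₀ ⟨
      A $ ((v′ +V w₀) +V w₀)    ≡⟨ cong (A $_) (trans (+V-assoc v′ w₀ w₀) (trans (cong (v′ +V_) (+V-self w₀)) (+V-identityʳ v′))) ⟩
      A $ v′                    ≡⟨ $-· A c c≢𝟎 v ⟩
      A $ v                     ≡⟨ proj₂ oA v∈l ⟩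
      false                     ∎)
      where
      -- If w₀ were in w^⊥, it would be in the radical of A, and A would vanish there.
      w₀w≢𝟎 : ¬ herm w₀ w ≡ 𝟎
      w₀w≢𝟎 eq = true≢false (trans (sym A-w₀) (trans (cong (A $_) (sym (+V-identityʳ w₀)))
        (trans (radical-perp w₀ eq zeroV) ($-zero A))))
      -- Conjugation inverts herm v w, so v′ has the same product with w as w₀, and v′ + w₀ lies in
      -- w^⊥.
      c = herm w₀ w ⊗ conj (herm v w)
      v′ = c ·V v
      c≢𝟎 : ¬ c ≡ 𝟎
      c≢𝟎 = ⊗-≢𝟎 _ _ w₀w≢𝟎 (vw ∘ conj-≡𝟎 (herm v w))
      sum-⊥ : herm (v′ +V w₀) w ≡ 𝟎
      sum-⊥ = trans (herm-+ˡ v′ w₀ w) (trans (cong (_⊕ herm w₀ w) (trans (herm-·ˡ c v w)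
        (trans (⊗-assoc (herm w₀ w) (conj (herm v w)) (herm v w))
          (trans (cong (herm w₀ w ⊗_) (conj-inverse (herm v w) vw)) (⊗-identityʳ (herm w₀ w))))))
        (⊕-self (herm w₀ w)))

  contradiction : ⊥
  contradiction with search frame frame-points
  ... | inj₁ (w₀ , w , pw₀ , pw , eq) = Pair.absurd w₀ w pw₀ pw eq
  ... | inj₂ eq = true≢false (trans (sym e₂-sum-defects) eq)

-- From an ovoid to a list of representatives

vectors : ∀ m → List (Vect m)
vectors zero = [] ∷ []
vectors (suc m) = cartesianProductWith _∷_ (𝟎 ∷ 𝟏 ∷ ω ∷ ω² ∷ []) (vectors m)

∈-vectors : (v : Vect m) → v ∈ vectors m
∈-vectors [] = here refl
∈-vectors (a ∷ v) = ∈-cartesianProductWith⁺ _∷_ (scalars a) (∈-vectors v)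
  where
  scalars : ∀ a → a ∈ 𝟎 ∷ 𝟏 ∷ ω ∷ ω² ∷ []
  scalars 𝟎 = here refl
  scalars 𝟏 = there (here refl)
  scalars ω = there (there (here refl))
  scalars ω² = there (there (there (here refl)))

-- `covers` asks only for orthogonality to a listed vector. For an ovoid this already means the same
-- projective point, and unlike membership in O it is decidable.
record Representatives (O : Pred (Vect m) 0ℓ) (us : List (Vect m)) : Set where
  field
    list   : List (Vect m)
    inside : ∀ {v} → v ∈ list → O v
    apart  : LPairs.AllPairs Apart list
    covers : ∀ {u} → u ∈ us → O u → ∃ λ v → v ∈ list × herm v u ≡ 𝟎

-- A greedy choice: a vector of O is added unless it is orthogonal to one already listed. The double
-- negation supplies the case distinction on `O u`.
representatives : (O : Pred (Vect m) 0ℓ) → (∀ v → O v → Isotropic v) → ∀ us → ¬ ¬ Representatives O us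
representatives O iso [] k = k record { list = [] ; inside = λ () ; apart = [] ; covers = λ () }
representatives O iso (u ∷ us) k = representatives O iso us λ R → let open Representatives R in
  (λ cases → cases λ Ou → new R Ou) λ Ou⇒ → k record
    { list = list ; inside = inside ; apart = apart
    ; covers = λ { (here refl) Ou → ⊥-elim (Ou⇒ Ou) ; (there u∈us) Ou → covers u∈us Ou } }
  where
  new : Representatives O us → O u → ⊥
  new R Ou with any? (λ v → herm v u ≟ 𝟎) list
    where open Representatives R
  ... | yes some = k record
      { list = list ; inside = inside ; apart = apart
      ; covers = λ { (here refl) _ → find some ; (there u∈us) Ou → covers u∈us Ou } }
    where open Representatives R
  ... | no none = k record
      { list = u ∷ list
      ; inside = λ { (here refl) → Ou ; (there v∈l) → inside v∈l }
      ; apart = LAll.map (λ {v} vu → Apart-sym v u (≢𝟎⇒nrm (herm v u) vu)) (¬Any⇒All¬ list none) ∷ apart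
      ; covers = λ { (here refl) _ → u , here refl , iso u Ou
                   ; (there u∈us) Ou → let v , v∈l , vu = covers u∈us Ou in v , there v∈l , vu } }
    where open Representatives R

line-generator : ∀ c → ¬ c ≡ 𝟎 → GeneratorBasis ((𝟏 ∷ c ∷ []) ∷ [])
line-generator c c≢𝟎 =
  (λ { (a ∷ []) eq → cong (_∷ []) (trans (sym (trans (⊕-identityʳ (a ⊗ 𝟏)) (⊗-identityʳ a))) (cong head eq)) }) ,
  λ { zero zero → from-yes (∀F? λ c → ¬? (c ≟ 𝟎) →-dec (herm (𝟏 ∷ c ∷ []) (𝟏 ∷ c ∷ []) ≟ 𝟎)) c c≢𝟎 }

ovoid-list : {O : Pred (Vect 6) 0ℓ} → Ovoid 3 6 O → (R : Representatives O (vectors 6)) → OvoidList (Representatives.list R)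
ovoid-list {O} ov@(iso , gen) R = record
  { isotropic = λ v∈l → proj₂ (iso _ (inside v∈l))
  ; nonzero = λ v∈l → proj₁ (iso _ (inside v∈l))
  ; apart = apart
  ; meets = meets
  }
  where
  open Representatives R
  meets : ∀ (g : Isometry 6) c → ¬ c ≡ 𝟎 → ∃ λ v → v ∈ list × inGenerator c (to g v) ≡ true
  meets g c c≢𝟎 with gen (map (from g) bs) (generator-map (inverse g) bs (generator-cone _ (generator-cone _ (line-generator c c≢𝟎))))
    where bs = cone (cone ((𝟏 ∷ c ∷ []) ∷ []))
  -- The vector of O found in the generator need not be the listed one. A listed vector orthogonal
  -- to it is a multiple of it, hence in the same generator.
  ... | (cs@(a ∷ b ∷ d ∷ []) , Ou) , _ with v , v∈l , vu ← covers (∈-vectors _) Ou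
    with k , _ , v≡ku ← ovoid-orthogonal {n = 1} ov v _ (inside v∈l) Ou vu = v , v∈l , trans (cong (inGenerator c) gv) (check k)
    where
    bs = cone (cone ((𝟏 ∷ c ∷ []) ∷ []))
    u = a ∷ a ∷ b ∷ b ∷ (d ⊗ 𝟏 ⊕ 𝟎) ∷ (d ⊗ c ⊕ 𝟎) ∷ []
    gv : to g v ≡ k ·V u
    gv = trans (cong (to g) v≡ku) (trans (to-· g k _) (cong (k ·V_) (trans (cong (to g) (lincomb-map (inverse g) cs bs))
      (trans (to-from g _) (trans (lincomb-cone a (b ∷ d ∷ []) (cone ((𝟏 ∷ c ∷ []) ∷ [])))
        (cong (λ v → a ∷ a ∷ v) (lincomb-cone b (d ∷ []) ((𝟏 ∷ c ∷ []) ∷ []))))))))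
    check : ∀ k → inGenerator c (k ·V u) ≡ true
    check k = cong₂ (λ p q → is𝟎 p ∧ q) (⊕-self (k ⊗ a)) (cong₂ (λ p q → is𝟎 p ∧ is𝟎 q) (⊕-self (k ⊗ b))
      (from-yes (∀F? λ k → ∀F? λ c → ∀F? λ d → ¬? (c ≟ 𝟎) →-dec (k ⊗ (d ⊗ 𝟏 ⊕ 𝟎) ⊕ (k ⊗ (d ⊗ c ⊕ 𝟎)) ⊗ conj c ≟ 𝟎)) k c d c≢𝟎))

no-ovoid-3 : NoOvoid 3
no-ovoid-3 O ov = representatives O (λ v Ov → proj₂ (proj₁ ov v Ov)) (vectors 6) λ R →
  Contradiction.contradiction (ovoid-list ov R)

theorem5p4 : (n : ℕ) → 3 ≤ n → ¬ (Σ (Pred (Vect (2 * n)) 0ℓ) (IsOvoid n))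
theorem5p4 (suc (suc (suc n))) (s≤s (s≤s (s≤s z≤n))) (O , ov) =
  subst (λ m → (O : Pred (Vect m) 0ℓ) → ¬ Ovoid (3 + n) m O) (sym (2*≡double (3 + n))) (no-ovoid-from-3 no-ovoid-3 n) O ov
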